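{- Let $w$ be the weight system on the lecture hall graph defined, for integers $t\ge 0$ and $0\le j\le i$, by \[ w(t;i,j)=\begin{cases}(aq^{j}+a^{ -1}q^{ -j})/2 & \text{if } t=0,\\ \widetilde w(t-1;i,j) & \text{if } t\ge 1,\end{cases} \] where, for $m\ge 0$, \[ \widetilde w(t;i,j)=\frac12 (abcd\,q^{2i})^m q^j\times\begin{cases} -a^{ -1}q^{ -i} & t=8m,\\ d & t=8m+1,\\ c & t=8m+2,\\ -acd\,q^{i} & t=8m+3,\\ b & t=8m+4,\\ -abd\,q^{i} & t=8m+5,\\ -abc\,q^{i} & t=8m+6,\\ a^2bcd\,q^{2i} & t=8m+7.\end{cases} \] Then the mixed moments $\sigma^{AW}_{n,k}(a,b,c,d;q)$ of the Askey--Wilson polynomials satisfy \[ \sigma^{AW}_{n,k}(a,b,c,d;q)=h^{w}_{n,k}\qquad (n\ge k\ge 0). \]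
   Context: Lecture hall graph. For integers $t\ge0$, $0\le j\le i$ put $v^t_{i,j}=(i,\,t+\frac{j}{i+1})$, and set $v^t_{i,i+1}:=v^{t+1}_{i,0}$. The vertices of the lecture hall graph are all $v^t_{i,j}$; its edges join $v^t_{i,j}$ with $v^t_{i,j+1}$ (vertical edges) and $v^t_{i,j}$ with $v^t_{i+1,j}$, for $t\ge 0$, $0\le j\le i$. An east step is a directed edge $(v^t_{i,j},v^t_{i+1,j})$; a south step is a vertical edge directed downwards, $(v^t_{i,j+1},v^t_{i,j})$. A weight system $w$ assigns a weight $w(t;i,j)$ to each east step $(v^t_{i,j},v^t_{i+1,j})$. The weight $w(p)$ of a path is the product of the weights of its east steps. $\mathrm{SE}((k,\infty)\to(n,0))$ is the set of paths $(\dots,v_2,v_1,v_0)$ with $v_0=(n,0)$, $\lim_{m\to\infty}v_m=(k,\infty)$, and each $(v_{m+1},v_m)$ a south or east step. Define $h^w_{n,k}=\sum_{p\in \mathrm{SE}((k,\infty)\to(n,0))}w(p)$ (so $h^w_{n,n}=1$). Askey--Wilson polynomials. The monic Askey--Wilson polynomials are \[ p_n(x;a,b,c,d|q)=\frac{(ab,ac,ad;q)_n}{2^na^n(abcdq^{n-1};q)_n}\;{}_4\phi_3\!\left(\begin{matrix}q^{ -n},\,abcdq^{n-1},\,ae^{\mathbf i\theta},\,ae^{ -\mathbf i\theta}\\ ab,\,ac,\,ad\end{matrix};q,q\right),\quad x=\cos\theta, \] with the standard notation $(z;q)_n=\prod_{i=0}^{n-1}(1-zq^i)$, $(z_1,\dots,z_r;q)_n=\prod_s(z_s;q)_n$,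 ${}_{4}\phi_3(\alpha_1,\dots,\alpha_4;\beta_1,\beta_2,\beta_3;q,z)=\sum_{k\ge0}\frac{(\alpha_1,\dots,\alpha_4;q)_k}{(q,\beta_1,\beta_2,\beta_3;q)_k}z^k$. The mixed moments are defined by $x^n=\sum_{k=0}^n\sigma^{AW}_{n,k}(a,b,c,d;q)\,p_k(x;a,b,c,d|q)$. Here $a,b,c,d,q$ are indeterminates, and the infinite sum $h^w_{n,k}$ is understood as the formal power series expansion, in $b,c,d$ with coefficients in $\mathbb{Q}(q)[a,a^{ -1}]$. -}

module Defs where

open import Algebra.Bundles using (CommutativeRing; RawRing)
open import Algebra.Morphism.Structures using (module RingMorphisms)
import Algebra.Definitions as AlgebraDefinitions
import Algebra.Morphism.Construct.Composition as Composition
import Algebra.Morphism.RingMonomorphism as RingMonomorphism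
import Algebra.Properties.Ring as RingProperties
import Algebra.Properties.Semiring.Exp as SemiringExp
import Algebra.Properties.Semiring.Sum as SemiringSum
import Algebra.Solver.Ring.NaturalCoefficients.Default as RingSolver
open import Data.Empty using (⊥-elim)
open import Data.Fin.Base using (Fin; zero; suc; toℕ; inject₁)
open import Data.Fin.Relation.Unary.Top using (view; ‵fromℕ; ‵inject₁)
import Data.Fin.Properties as Fin
open import Data.Integer.Base using (ℤ; +_; -[1+_])
import Data.Integer.Base as ℤ
open import Data.List.Base using (List; foldr; map)
import Data.List.Membership.Setoid as Membership
import Data.List.Relation.Unary.Unique.Setoid as UniqueSetoid
open import Data.Nat.Base using (ℕ; zero; suc; z≤n; s≤s; _≤_; _∸_)
import Data.Nat.Base as ℕ
import Data.Nat.Properties as ℕ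
open import Data.Nat.DivMod using (_/_; _mod_)
open import Data.Product.Base using (Σ; ∃; _×_; _,_; proj₁; proj₂)
open import Data.Rational.Base using (0ℚ; ½)
import Data.Rational.Base as ℚ
import Data.Rational.Properties as ℚ
open import Data.Sum.Base using (_⊎_; inj₁; inj₂)
open import Data.Vec.Base using (Vec; []; _∷_; lookup)
open import Function.Base using (_∘_)
open import Level using (0ℓ)
open import Relation.Binary.Bundles using (Setoid)
open import Relation.Binary.PropositionalEquality as ≡ using (_≡_)
import Relation.Binary.Reasoning.Setoid as SetoidReasoning
open import Relation.Binary.Structures using (IsEquivalence)
open import Relation.Nullary.Decidable.Core using (Dec; yes; no)
open import Relation.Nullary.Negation.Core using (¬_; contradiction)

Ring₀ : Set₁
Ring₀ = CommutativeRing 0ℓ 0ℓ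

module Units (R : Ring₀) where
  open CommutativeRing R hiding (zero)
  open AlgebraDefinitions _≈_ using (Invertible)
  open SemiringExp semiring using (_^_)
  open SetoidReasoning setoid

  IsUnit : Carrier → Set
  IsUnit = Invertible 1# _*_

  Unit : Set
  Unit = ∃ IsUnit

  infixl 7 _÷_
  _÷_ : Carrier → Unit → Carrier
  x ÷ (_ , y⁻¹ , _) = x * y⁻¹

  infixr 8 _^ᶻ_
  _^ᶻ_ : Unit → ℤ → Carrier
  (x , _)       ^ᶻ (+ n)      = x ^ n
  (_ , x⁻¹ , _) ^ᶻ (-[1+ n ]) = x⁻¹ ^ suc n

  mkUnit : ∀ {x y} → x * y ≈ 1# → IsUnit x
  mkUnit {x} {y} xy≈1 = y , trans (*-comm y x) xy≈1 , xy≈1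

  isUnit-resp : ∀ {x y} → x ≈ y → IsUnit x → IsUnit y
  isUnit-resp x≈y (x⁻¹ , _ , xx⁻¹≈1) = mkUnit (trans (*-congʳ (sym x≈y)) xx⁻¹≈1)

  isUnit-1 : IsUnit 1#
  isUnit-1 = mkUnit (*-identityˡ 1#)

  isUnit-* : ∀ {x y} → IsUnit x → IsUnit y → IsUnit (x * y)
  isUnit-* {x} {y} (u , _ , xu≈1) (v , _ , yv≈1) = mkUnit (begin
    (x * y) * (u * v) ≈⟨ solve 4 (λ x y u v → (x :* y) :* (u :* v) := (x :* u) :* (y :* v)) refl x y u v ⟩
    (x * u) * (y * v) ≈⟨ *-cong xu≈1 yv≈1 ⟩
    1# * 1#           ≈⟨ *-identityˡ 1# ⟩
    1#                ∎)
    where open RingSolver commutativeSemiring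

  isUnit-^ : ∀ {x} → IsUnit x → ∀ n → IsUnit (x ^ n)
  isUnit-^ u zero    = isUnit-1
  isUnit-^ u (suc n) = isUnit-* u (isUnit-^ u n)

record _⟶_ (A B : Ring₀) : Set where
  private
    module A = CommutativeRing A
    module B = CommutativeRing B
  open RingMorphisms A.rawRing B.rawRing
  field
    to             : A.Carrier → B.Carrier
    isHomomorphism : IsRingHomomorphism to
  open IsRingHomomorphism isHomomorphism public
  private
    module ^A = SemiringExp A.semiring
    module ^B = SemiringExp B.semiring
    module UA = Units A
    module UB = Units B

  ^-homo : ∀ x n → to (x ^A.^ n) B.≈ (to x ^B.^ n)
  ^-homo x zero    = 1#-homo
  ^-homo x (suc n) = B.trans (*-homo x (x ^A.^ n)) (B.*-congˡ (^-homo x n))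

  isUnit : ∀ {x} → UA.IsUnit x → UB.IsUnit (to x)
  isUnit {x} (y , _ , xy≈1) =
    UB.mkUnit (B.trans (B.sym (*-homo x y)) (B.trans (⟦⟧-cong xy≈1) 1#-homo))

  unit : UA.Unit → UB.Unit
  unit (x , u) = to x , isUnit u

  ^ᶻ-homo : ∀ u z → to (u UA.^ᶻ z) B.≈ unit u UB.^ᶻ z
  ^ᶻ-homo (x , _)       (+ n)      = ^-homo x n
  ^ᶻ-homo (_ , x⁻¹ , _) (-[1+ n ]) = ^-homo x⁻¹ (suc n)

  1-homo : ∀ x y n → to (A.1# A.- x A.* y ^A.^ n) B.≈ B.1# B.- to x B.* to y ^B.^ n
  1-homo x y n = B.trans (+-homo A.1# _) (B.+-cong 1#-homo
    (B.trans (-‿homo _) (B.-‿cong (B.trans (*-homo x _) (B.*-congˡ (^-homo y n))))))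

  isUnit-1+1 : UA.IsUnit (A.1# A.+ A.1#) → UB.IsUnit (B.1# B.+ B.1#)
  isUnit-1+1 u = UB.isUnit-resp (B.trans (+-homo A.1# A.1#) (B.+-cong 1#-homo 1#-homo)) (isUnit u)

  isUnit-1-to : ∀ x y n → UB.IsUnit (to (A.1# A.- x A.* y ^A.^ n)) → UB.IsUnit (B.1# B.- to x B.* to y ^B.^ n)
  isUnit-1-to x y n = UB.isUnit-resp (1-homo x y n)

  isUnit-1-xyⁿ : ∀ {x y} n → UA.IsUnit (A.1# A.- x A.* y ^A.^ n) → UB.IsUnit (B.1# B.- to x B.* to y ^B.^ n)
  isUnit-1-xyⁿ {x} {y} n u = isUnit-1-to x y n (isUnit u)

infixr 9 _⟫_
_⟫_ : ∀ {A B C} → A ⟶ B → B ⟶ C → A ⟶ C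
_⟫_ {C = C} f g = record
  { to             = g.to ∘ f.to
  ; isHomomorphism = Composition.isRingHomomorphism (CommutativeRing.trans C) f.isHomomorphism g.isHomomorphism
  }
  where
  module f = _⟶_ f
  module g = _⟶_ g

mkHom : ∀ (A B : Ring₀) → let module A = CommutativeRing A; module B = CommutativeRing B in
        (f : A.Carrier → B.Carrier) →
        (∀ {x y} → x A.≈ y → f x B.≈ f y) →
        (∀ x y → f (x A.+ y) B.≈ f x B.+ f y) →
        (∀ x y → f (x A.* y) B.≈ f x B.* f y) →
        (∀ x → f (A.- x) B.≈ B.- f x) →
        f A.0# B.≈ B.0# →
        f A.1# B.≈ B.1# →
        A ⟶ B
mkHom A B f f-cong f-+ f-* f-neg f-0 f-1 = record
  { to             = f
  ; isHomomorphism = record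
    { isSemiringHomomorphism = record
      { isNearSemiringHomomorphism = record
        { +-isMonoidHomomorphism = record
          { isMagmaHomomorphism = record
            { isRelHomomorphism = record { cong = f-cong }
            ; homo              = f-+
            }
          ; ε-homo              = f-0
          }
        ; *-homo = f-*
        }
      ; 1#-homo = f-1
      }
    ; -‿homo = f-neg
    }
  }

-- R[[X]]
module PowerSeries (R : Ring₀) where
  open CommutativeRing R hiding (zero)
  open SemiringSum semiring
  open Units R using (IsUnit)
  private
    open module Solver = RingSolver commutativeSemiring using (solve; _:+_; _:*_; _:=_)

  Series : Set
  Series = ℕ → Carrier

  infix 4 _≋_
  record _≋_ (f g : Series) : Set where
    constructor mk≋
    field at : ∀ n → f n ≈ g n
  open _≋_ public

  infixl 6 _⊕_
  infixl 7 _⊛_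

  _⊕_ : Series → Series → Series
  (f ⊕ g) n = f n + g n

  ⊖_ : Series → Series
  (⊖ f) n = - f n

  _⊛_ : Series → Series → Series
  (f ⊛ g) n = ∑[ i < suc n ] (f (toℕ i) * g (n ∸ toℕ i))

  const : Carrier → Series
  const x zero    = x
  const x (suc _) = 0#

  X : Series
  X zero    = 0#
  X (suc n) = const 1# n

  tail : Series → Series
  tail f n = f (suc n)

  private
    open SetoidReasoning setoid

    ⊛-cong-≤ : ∀ {f f′ g g′} n → (∀ i → i ≤ n → f i ≈ f′ i) → (∀ i → i ≤ n → g i ≈ g′ i) →
               (f ⊛ g) n ≈ (f′ ⊛ g′) n
    ⊛-cong-≤ n p q = sum-cong-≋ {suc n} λ i →
      *-cong (p (toℕ i) (ℕ.≤-pred (Fin.toℕ<n i))) (q (n ∸ toℕ i) (ℕ.m∸n≤m n (toℕ i)))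

    ⊛-cong : ∀ {f f′ g g′} → f ≋ f′ → g ≋ g′ → f ⊛ g ≋ f′ ⊛ g′
    ⊛-cong p q .at n = ⊛-cong-≤ n (λ i _ → at p i) (λ i _ → at q i)

    ⊛-zeroˡ : ∀ f g n → (∀ i → f i ≈ 0#) → (f ⊛ g) n ≈ 0#
    ⊛-zeroˡ f g n f≈0 = trans
      (sum-cong-≋ {suc n} λ i → trans (*-congʳ (f≈0 (toℕ i))) (zeroˡ (g (n ∸ toℕ i))))
      (sum-replicate-zero (suc n))

    ⊛-last : ∀ f g n → (f ⊛ g) (suc n) ≈ (f ⊛ tail g) n + f (suc n) * g 0
    ⊛-last f g zero    = solve 2 (λ p q → p :+ (q :+ con 0) := (p :+ con 0) :+ q) refl _ _
      where open Solver using (con)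
    ⊛-last f g (suc n) = trans (+-congˡ (⊛-last (tail f) g n)) (sym (+-assoc _ _ _))

    ⊛-comm : ∀ f g n → (f ⊛ g) n ≈ (g ⊛ f) n
    ⊛-comm f g zero    = +-congʳ (*-comm _ _)
    ⊛-comm f g (suc n) = begin
      f 0 * g (suc n) + (tail f ⊛ g) n  ≈⟨ +-cong (*-comm _ _) (⊛-comm (tail f) g n) ⟩
      g (suc n) * f 0 + (g ⊛ tail f) n  ≈⟨ +-comm _ _ ⟩
      (g ⊛ tail f) n + g (suc n) * f 0  ≈⟨ ⊛-last g f n ⟨
      (g ⊛ f) (suc n)                   ∎

    ⊛-distribˡ : ∀ f g h n → (f ⊛ (g ⊕ h)) n ≈ (f ⊛ g ⊕ f ⊛ h) n
    ⊛-distribˡ f g h n = trans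
      (sum-cong-≋ {suc n} λ i → distribˡ (f (toℕ i)) (g (n ∸ toℕ i)) (h (n ∸ toℕ i)))
      (∑-distrib-+ {suc n} (λ i → f (toℕ i) * g (n ∸ toℕ i)) (λ i → f (toℕ i) * h (n ∸ toℕ i)))

    ⊛-distribʳ : ∀ f g h n → ((g ⊕ h) ⊛ f) n ≈ (g ⊛ f ⊕ h ⊛ f) n
    ⊛-distribʳ f g h n = trans (⊛-comm (g ⊕ h) f n)
      (trans (⊛-distribˡ f g h n) (+-cong (⊛-comm f g n) (⊛-comm f h n)))

    ⊛-scale : ∀ x f g n → ((λ i → x * f i) ⊛ g) n ≈ x * (f ⊛ g) n
    ⊛-scale x f g n = trans
      (sum-cong-≋ {suc n} λ i → *-assoc x (f (toℕ i)) (g (n ∸ toℕ i)))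
      (sym (*-distribˡ-sum {suc n} x (λ i → f (toℕ i) * g (n ∸ toℕ i))))

    ⊛-assoc : ∀ f g h n → ((f ⊛ g) ⊛ h) n ≈ (f ⊛ (g ⊛ h)) n
    ⊛-assoc f g h zero    = solve 3 (λ x y z →
      (x :* y :+ con 0) :* z :+ con 0 := x :* (y :* z :+ con 0) :+ con 0) refl (f 0) (g 0) (h 0)
      where open Solver using (con)
    ⊛-assoc f g h (suc n) = begin
      (f 0 * g 0 + 0#) * h (suc n) + (((λ i → f 0 * g (suc i)) ⊕ tail f ⊛ g) ⊛ h) n
        ≈⟨ +-cong (*-congʳ (+-identityʳ _)) (⊛-distribʳ h (λ i → f 0 * g (suc i)) (tail f ⊛ g) n) ⟩
      f 0 * g 0 * h (suc n) + (((λ i → f 0 * g (suc i)) ⊛ h) n + ((tail f ⊛ g) ⊛ h) n)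
        ≈⟨ +-congˡ (+-cong (⊛-scale (f 0) (tail g) h n) (⊛-assoc (tail f) g h n)) ⟩
      f 0 * g 0 * h (suc n) + (f 0 * (tail g ⊛ h) n + (tail f ⊛ (g ⊛ h)) n)
        ≈⟨ solve 5 (λ x y z u v → x :* y :* z :+ (x :* u :+ v) := x :* (y :* z :+ u) :+ v) refl
             (f 0) (g 0) (h (suc n)) ((tail g ⊛ h) n) ((tail f ⊛ (g ⊛ h)) n) ⟩
      f 0 * (g ⊛ h) (suc n) + (tail f ⊛ (g ⊛ h)) n ∎

    const-⊛ : ∀ x f n → (const x ⊛ f) n ≈ x * f n
    const-⊛ x f zero    = +-identityʳ _
    const-⊛ x f (suc n) = trans (+-congˡ (⊛-zeroˡ (tail (const x)) f n (λ _ → refl))) (+-identityʳ _)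

    ⊛-identityˡ : ∀ f n → (const 1# ⊛ f) n ≈ f n
    ⊛-identityˡ f n = trans (const-⊛ 1# f n) (*-identityˡ _)

    const-0 : ∀ n → const 0# n ≈ 0#
    const-0 zero    = refl
    const-0 (suc n) = refl

  seriesRing : Ring₀
  seriesRing = record
    { Carrier = Series
    ; _≈_     = _≋_
    ; _+_     = _⊕_
    ; _*_     = _⊛_
    ; -_      = ⊖_
    ; 0#      = λ _ → 0#
    ; 1#      = const 1#
    ; isCommutativeRing = record
      { isRing = record
        { +-isAbelianGroup = record
          { isGroup = record
            { isMonoid = record
              { isSemigroup = record
                { isMagma = record
                  { isEquivalence = record
                    { refl  = mk≋ λ _ → refl
                    ; sym   = λ p → mk≋ λ n → sym (at p n)
                    ; trans = λ p q → mk≋ λ n → trans (at p n) (at q n)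
                    }
                  ; ∙-cong = λ p q → mk≋ λ n → +-cong (at p n) (at q n)
                  }
                ; assoc = λ f g h → mk≋ λ n → +-assoc (f n) (g n) (h n)
                }
              ; identity = (λ f → mk≋ λ n → +-identityˡ (f n)) , (λ f → mk≋ λ n → +-identityʳ (f n))
              }
            ; inverse = (λ f → mk≋ λ n → -‿inverseˡ (f n)) , (λ f → mk≋ λ n → -‿inverseʳ (f n))
            ; ⁻¹-cong = λ p → mk≋ λ n → -‿cong (at p n)
            }
          ; comm = λ f g → mk≋ λ n → +-comm (f n) (g n)
          }
        ; *-cong     = ⊛-cong
        ; *-assoc    = λ f g h → mk≋ (⊛-assoc f g h)
        ; *-identity = (λ f → mk≋ (⊛-identityˡ f))
                     , (λ f → mk≋ λ n → trans (⊛-comm f (const 1#) n) (⊛-identityˡ f n))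
        ; distrib    = (λ f g h → mk≋ (⊛-distribˡ f g h)) , (λ f g h → mk≋ (⊛-distribʳ f g h))
        }
      ; *-comm = λ f g → mk≋ (⊛-comm f g)
      }
    }

  constHom : R ⟶ seriesRing
  constHom = mkHom R seriesRing const
    (λ p → mk≋ λ { zero → p ; (suc _) → refl })
    (λ x y → mk≋ λ { zero → refl ; (suc _) → sym (+-identityˡ 0#) })
    (λ x y → mk≋ λ { zero → sym (const-⊛ x (const y) zero)
                   ; (suc n) → sym (trans (const-⊛ x (const y) (suc n)) (zeroʳ x)) })
    (λ x → mk≋ λ { zero → refl ; (suc _) → sym -0#≈0# })
    (mk≋ const-0)
    (mk≋ λ _ → refl)
    where open RingProperties (CommutativeRing.ring R) using (-0#≈0#)

  headHom : seriesRing ⟶ R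
  headHom = mkHom seriesRing R (λ f → f 0) (λ p → at p 0)
    (λ _ _ → refl) (λ _ _ → +-identityʳ _) (λ _ → refl) refl refl

  X-⊛ : ∀ f n → (X ⊛ f) (suc n) ≈ f n
  X-⊛ f n = trans (+-cong (zeroˡ (f (suc n))) (⊛-identityˡ f n)) (+-identityˡ (f n))

  module _ (f : Series) (u : IsUnit (f 0)) where
    private
      f₀⁻¹ : Carrier
      f₀⁻¹ = proj₁ u

      -- The k-th approximation agrees with the inverse series up to degree k.
      approx : ℕ → Series
      approx zero    _       = f₀⁻¹
      approx (suc k) zero    = f₀⁻¹
      approx (suc k) (suc n) = - (f₀⁻¹ * (tail f ⊛ approx k) n)

      inverse : Series
      inverse n = approx n n

      stable : ∀ k k′ n → n ≤ k → n ≤ k′ → approx k n ≈ approx k′ n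
      stable zero    zero     _       _       _        = refl
      stable zero    (suc k′) zero    _       _        = refl
      stable (suc k) zero     zero    _       _        = refl
      stable (suc k) (suc k′) zero    _       _        = refl
      stable (suc k) (suc k′) (suc n) (s≤s p) (s≤s p′) = -‿cong (*-congˡ
        (⊛-cong-≤ {tail f} {tail f} n (λ _ _ → refl) (λ i i≤n → stable k k′ i (ℕ.≤-trans i≤n p) (ℕ.≤-trans i≤n p′))))

      f⊛inverse : ∀ n → (f ⊛ inverse) n ≈ const 1# n
      f⊛inverse zero    = trans (+-identityʳ _) (proj₂ (proj₂ u))
      f⊛inverse (suc n) = begin
        f 0 * - (f₀⁻¹ * (tail f ⊛ approx n) n) + r  ≈⟨ +-congʳ (sym (-‿distribʳ-* (f 0) _)) ⟩
        - (f 0 * (f₀⁻¹ * (tail f ⊛ approx n) n)) + r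
          ≈⟨ +-congʳ (-‿cong (trans (sym (*-assoc _ _ _)) (trans (*-congʳ (proj₂ (proj₂ u))) (*-identityˡ _)))) ⟩
        - (tail f ⊛ approx n) n + r
          ≈⟨ +-congʳ (-‿cong (⊛-cong-≤ {tail f} {tail f} n (λ _ _ → refl) (λ i i≤n → stable n i i i≤n ℕ.≤-refl))) ⟩
        - r + r                                     ≈⟨ -‿inverseˡ r ⟩
        0#                                          ∎
        where
        r = (tail f ⊛ inverse) n
        open RingProperties (CommutativeRing.ring R) using (-‿distribʳ-*)

    isUnit-series : Units.IsUnit seriesRing f
    isUnit-series = Units.mkUnit seriesRing (mk≋ f⊛inverse)

-- R[X], as the power series with finitely many nonzero coefficients.
module Polynomials (R : Ring₀) where
  open CommutativeRing R hiding (zero)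
  private
    open module PS = PowerSeries R using (Series; _≋_; mk≋; at; _⊕_; ⊖_; _⊛_; const; tail)
  open SemiringSum semiring using (sum-cong-≋; sum-replicate-zero)

  VanishesFrom : ℕ → Series → Set
  VanishesFrom N f = ∀ i → N ≤ i → f i ≈ 0#

  record Poly : Set where
    constructor poly
    field
      coeff   : Series
      bound   : ℕ
      bounded : VanishesFrom bound coeff
  open Poly public

  infix 4 _≈ₚ_
  record _≈ₚ_ (f g : Poly) : Set where
    constructor mk≈ₚ
    field coeff-≋ : coeff f ≋ coeff g
  open _≈ₚ_ public

  private
    ⊛-bounded : ∀ {f g M N} → VanishesFrom M f → VanishesFrom N g → VanishesFrom (M ℕ.+ N) (f ⊛ g)
    ⊛-bounded {f} {g} {M} {N} p q n M+N≤n = trans (sum-cong-≋ {suc n} term) (sum-replicate-zero (suc n))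
      where
      term : ∀ (i : Fin (suc n)) → f (toℕ i) * g (n ∸ toℕ i) ≈ 0#
      term i with M ℕ.≤? toℕ i
      ... | yes M≤i = trans (*-congʳ (p (toℕ i) M≤i)) (zeroˡ _)
      ... | no  M≰i = trans (*-congˡ (q (n ∸ toℕ i) (ℕ.≤-trans
              (ℕ.≤-trans (ℕ.≤-reflexive (≡.sym (ℕ.m+n∸m≡n M N))) (ℕ.∸-monoˡ-≤ M M+N≤n))
              (ℕ.∸-monoʳ-≤ n (ℕ.<⇒≤ (ℕ.≰⇒> M≰i)))))) (zeroʳ _)

    +-bounded : ∀ {f g M N} → VanishesFrom M f → VanishesFrom N g → VanishesFrom (M ℕ.⊔ N) (f ⊕ g)
    +-bounded {M = M} {N} p q i le = trans
      (+-cong (p i (ℕ.≤-trans (ℕ.m≤m⊔n M N) le)) (q i (ℕ.≤-trans (ℕ.m≤n⊔m M N) le))) (+-identityʳ 0#)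

    const-bounded : ∀ x → VanishesFrom 1 (const x)
    const-bounded x (suc i) _ = refl

    constₚ : Carrier → Poly
    constₚ x = poly (const x) 1 (const-bounded x)

    open RingProperties (CommutativeRing.ring R) using (-0#≈0#)

    rawPolyRing : RawRing 0ℓ 0ℓ
    rawPolyRing = record
      { Carrier = Poly
      ; _≈_     = _≈ₚ_
      ; _+_     = λ f g → poly (coeff f ⊕ coeff g) (bound f ℕ.⊔ bound g) (+-bounded (bounded f) (bounded g))
      ; _*_     = λ f g → poly (coeff f ⊛ coeff g) (bound f ℕ.+ bound g) (⊛-bounded (bounded f) (bounded g))
      ; -_      = λ f → poly (⊖ coeff f) (bound f) (λ i le → trans (-‿cong (bounded f i le)) -0#≈0#)
      ; 0#      = poly (λ _ → 0#) 0 (λ _ _ → refl)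
      ; 1#      = constₚ 1#
      }

    module PSR = CommutativeRing PS.seriesRing

    coeff-monomorphism : RingMorphisms.IsRingMonomorphism rawPolyRing PSR.rawRing coeff
    coeff-monomorphism = record
      { isRingHomomorphism = record
        { isSemiringHomomorphism = record
          { isNearSemiringHomomorphism = record
            { +-isMonoidHomomorphism = record
              { isMagmaHomomorphism = record
                { isRelHomomorphism = record { cong = coeff-≋ }
                ; homo              = λ _ _ → PSR.refl
                }
              ; ε-homo = PSR.refl
              }
            ; *-homo = λ _ _ → PSR.refl
            }
          ; 1#-homo = PSR.refl
          }
        ; -‿homo = λ _ → PSR.refl
        }
      ; injective = mk≈ₚ
      }

  polynomialRing : Ring₀
  polynomialRing = record
    { isCommutativeRing = RingMonomorphism.isCommutativeRing coeff-monomorphism PSR.isCommutativeRing }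

  constHom : R ⟶ polynomialRing
  constHom = mkHom R polynomialRing constₚ
    (λ p → mk≈ₚ (C.⟦⟧-cong p)) (λ x y → mk≈ₚ (C.+-homo x y)) (λ x y → mk≈ₚ (C.*-homo x y))
    (λ x → mk≈ₚ (C.-‿homo x)) (mk≈ₚ C.0#-homo) (mk≈ₚ C.1#-homo)
    where module C = _⟶_ PS.constHom

  X : Poly
  X = poly PS.X 2 X-bounded
    where
    X-bounded : VanishesFrom 2 PS.X
    X-bounded (suc (suc i)) _ = refl
    X-bounded (suc zero) (s≤s ())

  module _ (_≟0 : ∀ x → Dec (x ≈ 0#)) (no-zero-divisors : ∀ {x y} → x * y ≈ 0# → ¬ y ≈ 0# → x ≈ 0#) where
    private
      g₀≉0 : ∀ f g → ¬ g 0 ≈ 0# → (∀ n → (f ⊛ g) n ≈ 0#) → ∀ n → f n ≈ 0#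
      g₀≉0 f g g₀≉0# fg≈0 = go
        where
        f₀≈0 : f 0 ≈ 0#
        f₀≈0 = no-zero-divisors (trans (sym (+-identityʳ _)) (fg≈0 0)) g₀≉0#
        go : ∀ n → f n ≈ 0#
        go zero    = f₀≈0
        go (suc n) = g₀≉0 (tail f) g g₀≉0# (λ m →
          trans (sym (trans (+-congʳ (trans (*-congʳ f₀≈0) (zeroˡ _))) (+-identityˡ _))) (fg≈0 (suc m))) n

      domain : ∀ N f g → VanishesFrom N g → ¬ (∀ n → g n ≈ 0#) → (∀ n → (g ⊛ f) n ≈ 0#) → ∀ n → f n ≈ 0#
      domain zero    f g g≈0 g≉0 _    = ⊥-elim (g≉0 (λ i → g≈0 i z≤n))
      domain (suc N) f g g≈0 g≉0 gf≈0 with g 0 ≟0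
      ... | no  g₀≉0# = g₀≉0 f g g₀≉0# (λ n → trans (at (PSR.*-comm f g) n) (gf≈0 n))
      ... | yes g₀≈0  = domain N f (tail g) (λ i le → g≈0 (suc i) (s≤s le))
          (λ t≈0 → g≉0 λ { zero → g₀≈0 ; (suc i) → t≈0 i })
          (λ n → trans (sym (trans (+-congʳ (trans (*-congʳ g₀≈0) (zeroˡ _))) (+-identityˡ _))) (gf≈0 (suc n)))

    private module P = CommutativeRing polynomialRing

    no-zero-divisors-poly : ∀ {f g} → f P.* g P.≈ P.0# → ¬ g P.≈ P.0# → f P.≈ P.0#
    no-zero-divisors-poly {f} {g} fg≈0 g≉0 = mk≈ₚ (mk≋ (domain (bound g) (coeff f) (coeff g) (bounded g)
      (λ p → g≉0 (mk≈ₚ (mk≋ p)))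
      (λ n → trans (at (PSR.*-comm (coeff g) (coeff f)) n) (at (coeff-≋ fg≈0) n))))

record MultiplicativeSet (R : Ring₀) : Set₁ where
  open CommutativeRing R hiding (zero)
  field
    _∈S    : Carrier → Set
    1∈S    : 1# ∈S
    *∈S    : ∀ {s t} → s ∈S → t ∈S → (s * t) ∈S
    cancel : ∀ {s x y} → s ∈S → x * s ≈ y * s → x ≈ y

module Localization (R : Ring₀) (S : MultiplicativeSet R) where
  open CommutativeRing R hiding (zero)
  open MultiplicativeSet S
  open RingProperties (CommutativeRing.ring R) using (-‿distribˡ-*)
  open RingSolver commutativeSemiring using (solve; con; _:+_; _:*_; _:=_)
  open SetoidReasoning setoid

  record Fraction : Set where
    constructor fraction
    field
      num   : Carrier
      den   : Carrier
      den∈S : den ∈S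
  open Fraction public

  infix 4 _≃_
  record _≃_ (x y : Fraction) : Set where
    constructor mk≃
    field cross : num x * den y ≈ num y * den x
  open _≃_ public

  embed : Carrier → Fraction
  embed x = fraction x 1# 1∈S

  fractionRing : Ring₀
  fractionRing = record
    { Carrier = Fraction
    ; _≈_     = _≃_
    ; _+_     = λ x y → fraction (num x * den y + num y * den x) (den x * den y) (*∈S (den∈S x) (den∈S y))
    ; _*_     = λ x y → fraction (num x * num y) (den x * den y) (*∈S (den∈S x) (den∈S y))
    ; -_      = λ x → fraction (- num x) (den x) (den∈S x)
    ; 0#      = embed 0#
    ; 1#      = embed 1#
    ; isCommutativeRing = record
      { isRing = record
        { +-isAbelianGroup = record
          { isGroup = record
            { isMonoid = record
              { isSemigroup = record
                { isMagma = record
                  { isEquivalence = record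
                    { refl  = mk≃ refl
                    ; sym   = λ p → mk≃ (sym (cross p))
                    ; trans = λ {x} {y} {z} p q → mk≃ (≃-trans x y z (cross p) (cross q))
                    }
                  ; ∙-cong = λ {x} {x′} {y} {y′} p q → mk≃ (+-cong′ x x′ y y′ (cross p) (cross q))
                  }
                ; assoc = λ (fraction a s _) (fraction b t _) (fraction c u _) → mk≃ (solve 6
                    (λ a b c s t u → ((a :* t :+ b :* s) :* u :+ c :* (s :* t)) :* (s :* (t :* u))
                                  := (a :* (t :* u) :+ (b :* u :+ c :* t) :* s) :* ((s :* t) :* u))
                    refl a b c s t u)
                }
              ; identity = (λ (fraction a s _) → mk≃ (solve 2
                             (λ a s → (con 0 :* s :+ a :* con 1) :* s := a :* (con 1 :* s)) refl a s))
                         , (λ (fraction a s _) → mk≃ (solve 2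
                             (λ a s → (a :* con 1 :+ con 0 :* s) :* s := a :* (s :* con 1)) refl a s))
              }
            ; inverse = (λ x → mk≃ (0/s (den x * den x) (trans (sym (distribʳ (den x) (- num x) (num x)))
                                     (trans (*-congʳ (-‿inverseˡ (num x))) (zeroˡ _)))))
                      , (λ x → mk≃ (0/s (den x * den x) (trans (sym (distribʳ (den x) (num x) (- num x)))
                                     (trans (*-congʳ (-‿inverseʳ (num x))) (zeroˡ _)))))
            ; ⁻¹-cong = λ p → mk≃ (trans (sym (-‿distribˡ-* _ _))
                                   (trans (-‿cong (cross p)) (-‿distribˡ-* _ _)))
            }
          ; comm = λ (fraction a s _) (fraction b t _) → mk≃ (solve 4
              (λ a b s t → (a :* t :+ b :* s) :* (t :* s) := (b :* s :+ a :* t) :* (s :* t)) refl a b s t)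
          }
        ; *-cong = λ {x} {x′} {y} {y′} p q → mk≃ (*-cong′ x x′ y y′ (cross p) (cross q))
        ; *-assoc = λ (fraction a s _) (fraction b t _) (fraction c u _) → mk≃ (solve 6
            (λ a b c s t u → ((a :* b) :* c) :* (s :* (t :* u)) := (a :* (b :* c)) :* ((s :* t) :* u))
            refl a b c s t u)
        ; *-identity = (λ (fraction a s _) → mk≃ (solve 2
                         (λ a s → (con 1 :* a) :* s := a :* (con 1 :* s)) refl a s))
                     , (λ (fraction a s _) → mk≃ (solve 2
                         (λ a s → (a :* con 1) :* s := a :* (s :* con 1)) refl a s))
        ; distrib = (λ (fraction a s _) (fraction b t _) (fraction c u _) → mk≃ (solve 6
                      (λ a b c s t u →
                         (a :* (b :* u :+ c :* t)) :* ((s :* t) :* (s :* u))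
                      := ((a :* b) :* (s :* u) :+ (a :* c) :* (s :* t)) :* (s :* (t :* u)))
                      refl a b c s t u))
                  , (λ (fraction a s _) (fraction b t _) (fraction c u _) → mk≃ (solve 6
                      (λ a b c s t u →
                         ((b :* u :+ c :* t) :* a) :* ((t :* s) :* (u :* s))
                      := ((b :* a) :* (u :* s) :+ (c :* a) :* (t :* s)) :* ((t :* u) :* s))
                      refl a b c s t u))
        }
      ; *-comm = λ (fraction a s _) (fraction b t _) → mk≃ (solve 4
          (λ a b s t → (a :* b) :* (t :* s) := (b :* a) :* (s :* t)) refl a b s t)
      }
    }
    where
    0/s : ∀ {x} s → x ≈ 0# → x * 1# ≈ 0# * s
    0/s s x≈0 = trans (*-congʳ x≈0) (trans (zeroˡ _) (sym (zeroˡ s)))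

    ≃-trans : ∀ x y z → num x * den y ≈ num y * den x → num y * den z ≈ num z * den y →
              num x * den z ≈ num z * den x
    ≃-trans (fraction a s _) (fraction b t t∈S) (fraction c u _) p q = cancel t∈S (begin
      a * u * t ≈⟨ solve 3 (λ a u t → a :* u :* t := a :* t :* u) refl a u t ⟩
      a * t * u ≈⟨ *-congʳ p ⟩
      b * s * u ≈⟨ solve 3 (λ b s u → b :* s :* u := b :* u :* s) refl b s u ⟩
      b * u * s ≈⟨ *-congʳ q ⟩
      c * t * s ≈⟨ solve 3 (λ c t s → c :* t :* s := c :* s :* t) refl c t s ⟩
      c * s * t ∎)

    +-cong′ : ∀ x x′ y y′ → num x * den x′ ≈ num x′ * den x → num y * den y′ ≈ num y′ * den y →
              (num x * den y + num y * den x) * (den x′ * den y′)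
              ≈ (num x′ * den y′ + num y′ * den x′) * (den x * den y)
    +-cong′ (fraction a s _) (fraction a′ s′ _) (fraction b t _) (fraction b′ t′ _) p q = begin
      (a * t + b * s) * (s′ * t′)
        ≈⟨ solve 6 (λ a b s t s′ t′ → (a :* t :+ b :* s) :* (s′ :* t′)
                                   := (a :* s′) :* (t :* t′) :+ (b :* t′) :* (s :* s′)) refl a b s t s′ t′ ⟩
      (a * s′) * (t * t′) + (b * t′) * (s * s′)
        ≈⟨ +-cong (*-congʳ p) (*-congʳ q) ⟩
      (a′ * s) * (t * t′) + (b′ * t) * (s * s′)
        ≈⟨ solve 6 (λ a b s t s′ t′ → (a :* s) :* (t :* t′) :+ (b :* t) :* (s :* s′)
                                   := (a :* t′ :+ b :* s′) :* (s :* t)) refl a′ b′ s t s′ t′ ⟩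
      (a′ * t′ + b′ * s′) * (s * t) ∎

    *-cong′ : ∀ x x′ y y′ → num x * den x′ ≈ num x′ * den x → num y * den y′ ≈ num y′ * den y →
              (num x * num y) * (den x′ * den y′) ≈ (num x′ * num y′) * (den x * den y)
    *-cong′ (fraction a s _) (fraction a′ s′ _) (fraction b t _) (fraction b′ t′ _) p q = begin
      (a * b) * (s′ * t′) ≈⟨ interchange a b s′ t′ ⟩
      (a * s′) * (b * t′) ≈⟨ *-cong p q ⟩
      (a′ * s) * (b′ * t) ≈⟨ interchange a′ b′ s t ⟨
      (a′ * b′) * (s * t) ∎
      where
      interchange : ∀ a b s t → (a * b) * (s * t) ≈ (a * s) * (b * t)
      interchange = solve 4 (λ a b s t → (a :* b) :* (s :* t) := (a :* s) :* (b :* t)) refl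

  embedHom : R ⟶ fractionRing
  embedHom = mkHom R fractionRing embed
    (λ p → mk≃ (*-congʳ p))
    (λ x y → mk≃ (solve 2 (λ x y → (x :+ y) :* (con 1 :* con 1) := (x :* con 1 :+ y :* con 1) :* con 1) refl x y))
    (λ x y → mk≃ (solve 2 (λ x y → (x :* y) :* (con 1 :* con 1) := (x :* y) :* con 1) refl x y))
    (λ x → mk≃ refl) (mk≃ refl) (mk≃ refl)

  isUnit-embed : ∀ {s} → s ∈S → Units.IsUnit fractionRing (embed s)
  isUnit-embed {s} s∈S = Units.mkUnit fractionRing {y = fraction 1# s s∈S}
    (mk≃ (solve 1 (λ s → (s :* con 1) :* con 1 := con 1 :* (con 1 :* s)) refl s))

nonZero : (R : Ring₀) → let open CommutativeRing R in
          (∀ {x y} → x * y ≈ 0# → ¬ y ≈ 0# → x ≈ 0#) → ¬ 1# ≈ 0# → MultiplicativeSet R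
nonZero R no-zero-divisors 1≉0 = record
  { _∈S    = λ s → ¬ s ≈ 0#
  ; 1∈S    = 1≉0
  ; *∈S    = λ s≉0 t≉0 st≈0 → s≉0 (no-zero-divisors st≈0 t≉0)
  ; cancel = λ {s} {x} {y} s≉0 xs≈ys → x∙y⁻¹≈ε⇒x≈y x y (no-zero-divisors
      (trans (distribʳ s x (- y)) (trans (+-cong xs≈ys (sym (-‿distribˡ-* y s))) (-‿inverseʳ (y * s)))) s≉0)
  }
  where
  open CommutativeRing R
  open RingProperties (CommutativeRing.ring R) using (-‿distribˡ-*; x∙y⁻¹≈ε⇒x≈y)

-- R[X, X⁻¹], as the localization of R[X] at the powers of X.
module LaurentPolynomials (R : Ring₀) where
  private
    module R  = CommutativeRing R
    module PS = PowerSeries R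
    module P  = Polynomials R
    module PR = CommutativeRing P.polynomialRing
    open SemiringExp PR.semiring using (_^_; ^-homo-*)

    X-cancel : ∀ {f g} → f PR.* P.X PR.≈ g PR.* P.X → f PR.≈ g
    X-cancel {f} {g} p = P.mk≈ₚ (PS.mk≋ λ n →
      R.trans (R.sym (PS.X-⊛ (P.coeff f) n))
        (R.trans (PS.at (P.coeff-≋ Xf≈Xg) (suc n)) (PS.X-⊛ (P.coeff g) n)))
      where
      Xf≈Xg : P.X PR.* f PR.≈ P.X PR.* g
      Xf≈Xg = PR.trans (PR.*-comm P.X f) (PR.trans p (PR.*-comm g P.X))

    X^-cancel : ∀ n {f g} → f PR.* P.X ^ n PR.≈ g PR.* P.X ^ n → f PR.≈ g
    X^-cancel zero    {f} {g} p = PR.trans (PR.sym (PR.*-identityʳ f)) (PR.trans p (PR.*-identityʳ g))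
    X^-cancel (suc n) {f} {g} p = X-cancel (X^-cancel n
      (PR.trans (PR.*-assoc f P.X (P.X ^ n)) (PR.trans p (PR.sym (PR.*-assoc g P.X (P.X ^ n))))))

  powersOfX : MultiplicativeSet P.polynomialRing
  powersOfX = record
    { _∈S    = λ s → ∃ λ n → s PR.≈ P.X ^ n
    ; 1∈S    = 0 , PR.refl
    ; *∈S    = λ (m , p) (n , q) → m ℕ.+ n , PR.trans (PR.*-cong p q) (PR.sym (^-homo-* P.X m n))
    ; cancel = λ { (n , p) q → X^-cancel n (PR.trans (PR.sym (PR.*-congˡ p)) (PR.trans q (PR.*-congˡ p))) }
    }

  open Localization P.polynomialRing powersOfX public using () renaming (fractionRing to laurentRing)
  private module L = Localization P.polynomialRing powersOfX

  constHom : R ⟶ laurentRing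
  constHom = P.constHom ⟫ L.embedHom

  X : Units.Unit laurentRing
  X = L.embed P.X , L.isUnit-embed (1 , PR.sym (PR.*-identityʳ P.X))

-- qPoch z q n is (z;q)ₙ and qPochs zs q n is (z₁,…,z_r;q)ₙ.
module QSeries (A : Ring₀) where
  open CommutativeRing A hiding (zero)
  open Units A
  open SemiringExp semiring using (_^_)
  open SemiringSum semiring using (sum-syntax)

  qPoch : Carrier → Carrier → ℕ → Carrier
  qPoch z q zero    = 1#
  qPoch z q (suc n) = qPoch z q n * (1# - z * q ^ n)

  qPochs : ∀ {r} → Vec Carrier r → Carrier → ℕ → Carrier
  qPochs []       q n = 1#
  qPochs (z ∷ zs) q n = qPoch z q n * qPochs zs q n

  isUnit-qPoch : ∀ {z q} → (∀ i → IsUnit (1# - z * q ^ i)) → ∀ n → IsUnit (qPoch z q n)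
  isUnit-qPoch u zero    = isUnit-1
  isUnit-qPoch u (suc n) = isUnit-* (isUnit-qPoch u n) (u n)

  -- The sum is cut off after k = N; this is the full ₄φ₃ series whenever
  -- one of the upper parameters is q⁻ᴺ, since (q⁻ᴺ;q)ₖ = 0 for k > N.
  ₄φ₃ : (α : Vec Carrier 4) (β : Vec Carrier 3) (q z : Carrier) (N : ℕ) →
        (∀ k → IsUnit (qPochs (q ∷ β) q k)) → Carrier
  ₄φ₃ α β q z N u = ∑[ k < suc N ]
    (qPochs α q (toℕ k) ÷ (qPochs (q ∷ β) q (toℕ k) , u (toℕ k)) * z ^ toℕ k)

record AskeyWilsonParameters (A : Ring₀) : Set where
  open CommutativeRing A hiding (zero)
  open Units A
  open SemiringExp semiring using (_^_)
  field
    aᵘ qᵘ : Unit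
    b c d : Carrier

  a : Carrier
  a = proj₁ aᵘ

  q : Carrier
  q = proj₁ qᵘ

  abcdqⁿ⁻¹ : ℕ → Carrier
  abcdqⁿ⁻¹ n = a * b * c * d * qᵘ ^ᶻ (+ n ℤ.- + 1)

  field
    isUnit-2        : IsUnit (1# + 1#)
    isUnit-q        : ∀ i → IsUnit (1# - q * q ^ i)
    isUnit-ab       : ∀ i → IsUnit (1# - a * b * q ^ i)
    isUnit-ac       : ∀ i → IsUnit (1# - a * c * q ^ i)
    isUnit-ad       : ∀ i → IsUnit (1# - a * d * q ^ i)
    isUnit-abcdqⁿ⁻¹ : ∀ n i → IsUnit (1# - abcdqⁿ⁻¹ n * q ^ i)

mapParameters : ∀ {A B} → A ⟶ B → AskeyWilsonParameters A → AskeyWilsonParameters B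
mapParameters {A} {B} f P = record
  { aᵘ = f.unit aᵘ
  ; qᵘ = f.unit qᵘ
  ; b  = f.to b
  ; c  = f.to c
  ; d  = f.to d
  ; isUnit-2        = f.isUnit-1+1 isUnit-2
  ; isUnit-q        = λ i → f.isUnit-1-xyⁿ i (isUnit-q i)
  ; isUnit-ab       = λ i → image i (f.*-homo a b) (isUnit-ab i)
  ; isUnit-ac       = λ i → image i (f.*-homo a c) (isUnit-ac i)
  ; isUnit-ad       = λ i → image i (f.*-homo a d) (isUnit-ad i)
  ; isUnit-abcdqⁿ⁻¹ = λ n i → image i (f-abcdqⁿ⁻¹ n) (isUnit-abcdqⁿ⁻¹ n i)
  }
  where
  open CommutativeRing A hiding (zero)
  open SemiringExp semiring using (_^_)
  open AskeyWilsonParameters P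
  module B  = CommutativeRing B
  module ^B = SemiringExp B.semiring
  module UA = Units A
  module UB = Units B
  module f  = _⟶_ f

  image : ∀ {x y} i → f.to x B.≈ y → UA.IsUnit (1# - x * q ^ i) →
          UB.IsUnit (B.1# B.- y B.* f.to q ^B.^ i)
  image {x} i fx≈y u = UB.isUnit-resp
    (B.+-congˡ (B.-‿cong (B.*-congʳ fx≈y))) (f.isUnit-1-xyⁿ i u)

  f-abcdqⁿ⁻¹ : ∀ n → f.to (abcdqⁿ⁻¹ n)
                     B.≈ f.to a B.* f.to b B.* f.to c B.* f.to d B.* f.unit qᵘ UB.^ᶻ (+ n ℤ.- + 1)
  f-abcdqⁿ⁻¹ n = B.trans (f.*-homo (a * b * c * d) _) (B.*-cong
    (B.trans (f.*-homo (a * b * c) d) (B.*-congʳ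
      (B.trans (f.*-homo (a * b) c) (B.*-congʳ (f.*-homo a b)))))
    (f.^ᶻ-homo qᵘ (+ n ℤ.- + 1)))

-- The parameters a, b, c, d, q in a ring R in which the scalars a and q come from
-- a ring K over which b, c, d have constant term 0, where an element of R is
-- invertible as soon as its constant term is.
parametersOver : ∀ {K R : Ring₀} (κ : K ⟶ R) (ε : R ⟶ K) → let open CommutativeRing in
  (∀ f → Units.IsUnit K (_⟶_.to ε f) → Units.IsUnit R f) →
  (aᵘ qᵘ : Units.Unit K) (b c d : Carrier R) →
  (∀ x → x ≡ b ⊎ x ≡ c ⊎ x ≡ d → _≈_ K (_⟶_.to ε x) (0# K)) →
  Units.IsUnit K (_+_ K (1# K) (1# K)) →
  (∀ i → Units.IsUnit K (_-_ K (1# K) (_*_ K (proj₁ qᵘ) (SemiringExp._^_ (semiring K) (proj₁ qᵘ) i)))) →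
  AskeyWilsonParameters R
parametersOver {K} {R} κ ε reflect aᵘ qᵘ b c d ε≈0 isUnit-2 isUnit-q = record
  { aᵘ = κ.unit aᵘ
  ; qᵘ = κ.unit qᵘ
  ; b  = b
  ; c  = c
  ; d  = d
  ; isUnit-2        = κ.isUnit-1+1 isUnit-2
  ; isUnit-q        = λ i → κ.isUnit-1-xyⁿ i (isUnit-q i)
  ; isUnit-ab       = isUnit-1-xqⁱ (ε-*0 (ε≈0 b (inj₁ ≡.refl)))
  ; isUnit-ac       = isUnit-1-xqⁱ (ε-*0 (ε≈0 c (inj₂ (inj₁ ≡.refl))))
  ; isUnit-ad       = isUnit-1-xqⁱ (ε-*0 (ε≈0 d (inj₂ (inj₂ ≡.refl))))
  ; isUnit-abcdqⁿ⁻¹ = λ n → isUnit-1-xqⁱ (ε-0* (ε-*0 (ε≈0 d (inj₂ (inj₂ ≡.refl)))))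
  }
  where
  module K = CommutativeRing K
  module κ = _⟶_ κ
  module ε = _⟶_ ε
  open CommutativeRing R hiding (zero)
  open Units R
  open SemiringExp semiring using (_^_)
  open RingProperties K.ring using (-0#≈0#)

  q : Carrier
  q = κ.to (proj₁ qᵘ)

  isUnit-1-xqⁱ : ∀ {x} → ε.to x K.≈ K.0# → ∀ i → IsUnit (1# - x * q ^ i)
  isUnit-1-xqⁱ {x} εx≈0 i = reflect _ (Units.isUnit-resp K (K.sym ε≈1) (Units.isUnit-1 K))
    where
    ε≈1 : ε.to (1# - x * q ^ i) K.≈ K.1#
    ε≈1 = K.trans (ε.1-homo x q i) (K.trans
      (K.+-congˡ (K.trans (K.-‿cong (K.trans (K.*-congʳ εx≈0) (K.zeroˡ _))) -0#≈0#)) (K.+-identityʳ K.1#))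

  ε-*0 : ∀ {x y} → ε.to y K.≈ K.0# → ε.to (x * y) K.≈ K.0#
  ε-*0 {x} {y} p = K.trans (ε.*-homo x y) (K.trans (K.*-congˡ p) (K.zeroʳ _))

  ε-0* : ∀ {x y} → ε.to x K.≈ K.0# → ε.to (x * y) K.≈ K.0#
  ε-0* {x} {y} p = K.trans (ε.*-homo x y) (K.trans (K.*-congʳ p) (K.zeroˡ _))

-- e^{iθ} is a formal unit of A, so that x = cos θ = (e^{iθ} + e^{-iθ})/2.
module AskeyWilson {A : Ring₀} (P : AskeyWilsonParameters A) (eⁱᶿ : Units.Unit A) where
  open CommutativeRing A hiding (zero)
  open Units A
  open QSeries A
  open SemiringExp semiring using (_^_)
  open AskeyWilsonParameters P

  x : Carrier
  x = (proj₁ eⁱᶿ + eⁱᶿ ^ᶻ -[1+ 0 ]) ÷ (1# + 1# , isUnit-2)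

  p : ℕ → Carrier
  p n = qPochs (a * b ∷ a * c ∷ a * d ∷ []) q n
          ÷ ((1# + 1#) ^ n * a ^ n * qPoch (abcdqⁿ⁻¹ n) q n , isUnit-prefactor)
      * ₄φ₃ (qᵘ ^ᶻ (ℤ.- + n) ∷ abcdqⁿ⁻¹ n ∷ a * proj₁ eⁱᶿ ∷ a * eⁱᶿ ^ᶻ -[1+ 0 ] ∷ [])
            (a * b ∷ a * c ∷ a * d ∷ []) q q n isUnit-lower
    where
    isUnit-prefactor : IsUnit ((1# + 1#) ^ n * a ^ n * qPoch (abcdqⁿ⁻¹ n) q n)
    isUnit-prefactor = isUnit-* (isUnit-* (isUnit-^ isUnit-2 n) (isUnit-^ (proj₂ aᵘ) n))
                                (isUnit-qPoch (isUnit-abcdqⁿ⁻¹ n) n)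
    isUnit-lower : ∀ k → IsUnit (qPochs (q ∷ a * b ∷ a * c ∷ a * d ∷ []) q k)
    isUnit-lower k = isUnit-* (isUnit-qPoch isUnit-q k) (isUnit-* (isUnit-qPoch isUnit-ab k)
      (isUnit-* (isUnit-qPoch isUnit-ac k) (isUnit-* (isUnit-qPoch isUnit-ad k) isUnit-1)))

-- vertex i t j is the point v^t_{i,j} = (i , t + j/(i+1)) with 0 ≤ j ≤ i.
record Vertex : Set where
  constructor vertex
  field
    column : ℕ
    level  : ℕ
    index  : Fin (suc column)
open Vertex public

-- The extended notation with 0 ≤ j ≤ i+1, where v^t_{i,i+1} = v^{t+1}_{i,0}.
v[_,_,_] : (t i : ℕ) → Fin (suc (suc i)) → Vertex
v[ t , i , j ] with view j
... | ‵fromℕ      = vertex i (suc t) zero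
... | ‵inject₁ j′ = vertex i t j′

IsSouthStep : Vertex → Vertex → Set
IsSouthStep u v = u ≡ v[ level v , column v , suc (index v) ]

IsEastStep : Vertex → Vertex → Set
IsEastStep u v = v ≡ vertex (suc (column u)) (level u) (inject₁ (index u))

-- A path (… , v₂ , v₁ , v₀) from (k , ∞) to (n , 0).  Since the height of a
-- vertex lies in [level , level + 1), it tends to ∞ iff the level does.
record SE (k n : ℕ) : Set where
  field
    at           : ℕ → Vertex
    end          : at 0 ≡ vertex n 0 zero
    step         : ∀ m → IsSouthStep (at (suc m)) (at m) ⊎ IsEastStep (at (suc m)) (at m)
    column-limit : ∃ λ M → ∀ m → M ≤ m → column (at m) ≡ k
    height-limit : ∀ H → ∃ λ M → ∀ m → M ≤ m → H ≤ level (at m)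

SE-setoid : ℕ → ℕ → Setoid 0ℓ 0ℓ
SE-setoid k n = record
  { Carrier       = SE k n
  ; _≈_           = λ p p′ → ∀ m → SE.at p m ≡ SE.at p′ m
  ; isEquivalence = record
    { refl  = λ _ → ≡.refl
    ; sym   = λ p m → ≡.sym (p m)
    ; trans = λ p p′ m → ≡.trans (p m) (p′ m)
    }
  }

module Weights (R : Ring₀) where
  open CommutativeRing R hiding (zero)

  WeightSystem : Set
  WeightSystem = (t i : ℕ) → Fin (suc i) → Carrier

  stepWeight : WeightSystem → ∀ {u v} → IsSouthStep u v ⊎ IsEastStep u v → Carrier
  stepWeight w         (inj₁ _) = 1#
  stepWeight w {u = u} (inj₂ _) = w (level u) (column u) (index u)

  -- Beyond the bound given by column-limit the path stays in column k, so
  -- all its east steps occur before that bound.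
  weight : WeightSystem → ∀ {k n} → SE k n → Carrier
  weight w p = go (proj₁ (SE.column-limit p))
    where
    go : ℕ → Carrier
    go zero    = 1#
    go (suc m) = go m * stepWeight w (SE.step p m)

record QScalars (K : Ring₀) : Set where
  open CommutativeRing K hiding (zero)
  open Units K
  open SemiringExp semiring using (_^_)
  field
    qᵘ       : Unit
    isUnit-2 : IsUnit (1# + 1#)
    isUnit-q : ∀ i → IsUnit (1# - proj₁ qᵘ * proj₁ qᵘ ^ i)

record CoefficientRing : Set₁ where
  field
    K        : Ring₀
    aᵘ       : Units.Unit K
    qScalars : QScalars K
  open QScalars qScalars public

imageScalars : ∀ {A B : Ring₀} (f : A ⟶ B) → let open CommutativeRing A; open SemiringExp semiring in
  (q : Carrier) → Units.IsUnit B (_⟶_.to f q) → Units.IsUnit B (_⟶_.to f (1# + 1#)) →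
  (∀ i → Units.IsUnit B (_⟶_.to f (1# - q * q ^ i))) → QScalars B
imageScalars {B = B} f q isUnit-q isUnit-2 isUnit-1-qⁱ⁺¹ = record
  { qᵘ       = f.to q , isUnit-q
  ; isUnit-2 = Units.isUnit-resp B (CommutativeRing.trans B (f.+-homo _ _)
                 (CommutativeRing.+-cong B f.1#-homo f.1#-homo)) isUnit-2
  ; isUnit-q = λ i → f.isUnit-1-to q q i (isUnit-1-qⁱ⁺¹ i)
  }
  where module f = _⟶_ f

laurentCoefficients : (F : Ring₀) → QScalars F → CoefficientRing
laurentCoefficients F scalars = record
  { K        = LaurentPolynomials.laurentRing F
  ; aᵘ       = LaurentPolynomials.X F
  ; qScalars = imageScalars c (proj₁ S.qᵘ) (C.isUnit (proj₂ S.qᵘ)) (C.isUnit S.isUnit-2) (λ i → C.isUnit (S.isUnit-q i))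
  }
  where
  module S = QScalars scalars
  c : F ⟶ LaurentPolynomials.laurentRing F
  c = LaurentPolynomials.constHom F
  module C = _⟶_ c

module MixedMoments (𝒦 : CoefficientRing) where
  private
    module 𝒦  = CoefficientRing 𝒦
    module K  = CommutativeRing 𝒦.K
    module S₁ = PowerSeries 𝒦.K
    module S₂ = PowerSeries S₁.seriesRing
    module S₃ = PowerSeries S₂.seriesRing

  -- K[[b,c,d]] as K[[b]][[c]][[d]].
  R : Ring₀
  R = S₃.seriesRing

  open CommutativeRing R hiding (zero)
  open Units R
  open SemiringExp semiring using (_^_)

  FormalPowerSeries : Set
  FormalPowerSeries = Carrier

  -- coeff f (i , j , l) is the coefficient of bⁱcʲdˡ.
  coeff : FormalPowerSeries → ℕ × ℕ × ℕ → K.Carrier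
  coeff f (i , j , l) = f l j i

  -- The family f of formal power series, indexed by a setoid, is summable
  -- with sum s: for every monomial all but finitely many members of the
  -- family have coefficient 0, and those coefficients add up to that of s.
  HasSum : (I : Setoid 0ℓ 0ℓ) → (Setoid.Carrier I → FormalPowerSeries) → FormalPowerSeries → Set
  HasSum I f s = ∀ e → Σ (List (Setoid.Carrier I)) λ is →
      Unique is
    × (∀ i → ¬ i ∈ is → coeff (f i) e K.≈ K.0#)
    × coeff s e K.≈ foldr K._+_ K.0# (map (λ i → coeff (f i) e) is)
    where
    open UniqueSetoid I using (Unique)
    open Membership I using (_∈_)

  scalar : 𝒦.K ⟶ R
  scalar = S₁.constHom ⟫ S₂.constHom ⟫ S₃.constHom

  constantTerm : R ⟶ 𝒦.K
  constantTerm = S₃.headHom ⟫ S₂.headHom ⟫ S₁.headHom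

  parameters : AskeyWilsonParameters R
  parameters = parametersOver scalar constantTerm
    (λ f u → S₃.isUnit-series f (S₂.isUnit-series (f 0) (S₁.isUnit-series (f 0 0) u)))
    𝒦.aᵘ 𝒦.qᵘ (S₃.const (S₂.const S₁.X)) (S₃.const S₂.X) S₃.X
    (λ { _ (inj₁ ≡.refl)        → K.refl
       ; _ (inj₂ (inj₁ ≡.refl)) → K.refl
       ; _ (inj₂ (inj₂ ≡.refl)) → K.refl })
    𝒦.isUnit-2 𝒦.isUnit-q

  open AskeyWilsonParameters parameters using (a; b; c; d; q; aᵘ; qᵘ; isUnit-2)

  2ᵘ : Unit
  2ᵘ = 1# + 1# , isUnit-2

  w̃ : (t i : ℕ) → Fin (suc i) → Carrier
  w̃ t i j = (a * b * c * d * q ^ (2 ℕ.* i)) ^ (t / 8) * q ^ toℕ j * lookup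
    ( - (aᵘ ^ᶻ -[1+ 0 ] * qᵘ ^ᶻ (ℤ.- + i))
    ∷ d
    ∷ c
    ∷ - (a * c * d * q ^ i)
    ∷ b
    ∷ - (a * b * d * q ^ i)
    ∷ - (a * b * c * q ^ i)
    ∷ a ^ 2 * b * c * d * q ^ (2 ℕ.* i)
    ∷ []) (t mod 8) ÷ 2ᵘ

  open Weights R public

  w : WeightSystem
  w zero    i j = (a * q ^ toℕ j + aᵘ ^ᶻ -[1+ 0 ] * qᵘ ^ᶻ (ℤ.- + toℕ j)) ÷ 2ᵘ
  w (suc t) i j = w̃ t i j

  -- R[e^{iθ}, e^{-iθ}]
  T : Ring₀
  T = LaurentPolynomials.laurentRing R

  embedding : R ⟶ T
  embedding = LaurentPolynomials.constHom R

  module AW = AskeyWilson (mapParameters embedding parameters) (LaurentPolynomials.X R)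

  -- σ is the family of mixed moments: xⁿ = Σ_{k≤n} σ n k · p_k(x), as an identity
  -- of Laurent polynomials in e^{iθ}, where x = cos θ.
  IsMixedMoments : (ℕ → ℕ → FormalPowerSeries) → Set
  IsMixedMoments σ = ∀ n → AW.x ^ᵀ n T.≈ ∑[ k < suc n ] (_⟶_.to embedding (σ n (toℕ k)) T.* AW.p (toℕ k))
    where
    module T = CommutativeRing T
    open SemiringExp T.semiring using () renaming (_^_ to _^ᵀ_)
    open SemiringSum T.semiring using (sum-syntax)

ℚ-no-zero-divisors : ∀ {x y} → x ℚ.* y ≡ 0ℚ → ¬ y ≡ 0ℚ → x ≡ 0ℚ
ℚ-no-zero-divisors {x} {y} xy≡0 y≢0 = begin
  x                      ≡⟨ ℚ.*-identityʳ x ⟨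
  x ℚ.* ℚ.1ℚ             ≡⟨ ≡.cong (x ℚ.*_) (ℚ.*-inverseʳ y) ⟨
  x ℚ.* (y ℚ.* (ℚ.1/ y)) ≡⟨ ℚ.*-assoc x y (ℚ.1/ y) ⟨
  x ℚ.* y ℚ.* (ℚ.1/ y)   ≡⟨ ≡.cong (ℚ._* (ℚ.1/ y)) xy≡0 ⟩
  0ℚ ℚ.* (ℚ.1/ y)        ≡⟨ ℚ.*-zeroˡ (ℚ.1/ y) ⟩
  0ℚ                     ∎
  where
  open ≡.≡-Reasoning
  instance
    y-nonZero : ℚ.NonZero y
    y-nonZero = ℚ.≢-nonZero y≢0

module ℚ[q] = Polynomials ℚ.+-*-commutativeRing

private
  module Q[q] = CommutativeRing ℚ[q].polynomialRing
  module X^   = SemiringExp Q[q].semiring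
  module PSℚ  = PowerSeries ℚ.+-*-commutativeRing

  coeff₀ : ∀ {f g} → f Q[q].≈ g → ℚ[q].coeff f 0 ≡ ℚ[q].coeff g 0
  coeff₀ p = PSℚ.at (ℚ[q].coeff-≋ p) 0

nonZeroPolynomials : MultiplicativeSet ℚ[q].polynomialRing
nonZeroPolynomials = nonZero ℚ[q].polynomialRing
  (ℚ[q].no-zero-divisors-poly (ℚ._≟ 0ℚ) ℚ-no-zero-divisors)
  (λ 1≈0 → contradiction (coeff₀ 1≈0) λ ())

private
  q≉0 : ¬ ℚ[q].X Q[q].≈ Q[q].0#
  q≉0 q≈0 = contradiction (PSℚ.at (ℚ[q].coeff-≋ q≈0) 1) λ ()

  1-qⁱ⁺¹≉0 : ∀ i → ¬ Q[q].1# Q[q].- ℚ[q].X Q[q].* ℚ[q].X X^.^ i Q[q].≈ Q[q].0#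
  1-qⁱ⁺¹≉0 i p = contradiction (≡.trans (≡.sym lhs) (coeff₀ p)) λ ()
    where
    lhs : ℚ[q].coeff (Q[q].1# Q[q].- ℚ[q].X Q[q].* ℚ[q].X X^.^ i) 0 ≡ ℚ.1ℚ
    lhs = ≡.cong (λ r → ℚ.1ℚ ℚ.+ ℚ.- r)
      (≡.trans (ℚ.+-identityʳ _) (ℚ.*-zeroˡ (ℚ[q].coeff (ℚ[q].X X^.^ i) 0)))

  isUnit-2 : Units.IsUnit ℚ[q].polynomialRing (Q[q].1# Q[q].+ Q[q].1#)
  isUnit-2 = _⟶_.isUnit-1+1 ℚ[q].constHom (Units.mkUnit ℚ.+-*-commutativeRing {y = ½} ≡.refl)

-- ℚ(q) is the localization of ℚ[q] at its nonzero elements.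
module ℚ⟨q⟩ = Localization ℚ[q].polynomialRing nonZeroPolynomials

ℚ⟨q⟩-scalars : QScalars ℚ⟨q⟩.fractionRing
ℚ⟨q⟩-scalars = imageScalars ℚ⟨q⟩.embedHom ℚ[q].X (ℚ⟨q⟩.isUnit-embed q≉0)
  (_⟶_.isUnit ℚ⟨q⟩.embedHom isUnit-2) (λ i → ℚ⟨q⟩.isUnit-embed (1-qⁱ⁺¹≉0 i))

ℚ⟨q⟩[a,a⁻¹] : CoefficientRing
ℚ⟨q⟩[a,a⁻¹] = laurentCoefficients ℚ⟨q⟩.fractionRing ℚ⟨q⟩-scalars

open MixedMoments ℚ⟨q⟩[a,a⁻¹] public

{-# OPTIONS --safe #-}

-- Cut at its levels, the path sum is a product of transfer matrices.  The matrix of a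
-- level with weights α(i) qʲ has entries [n choose k]_q αₖ ⋯ αₙ₋₁ (the operator 𝓛 α
-- below), and by the q-binomial theorem the levels α and -y qⁱ α compose to the level
-- (1 - y qⁱ) α.  Hence the eight levels 8m+1, …, 8m+8 compose to one level with weights
-- (abcd q²ⁱ)ᵐ γᵢ, where γᵢ = -(1 - abqⁱ)(1 - acqⁱ)(1 - adqⁱ) / (2aqⁱ).  The matrix
-- D = [n choose k]_q γₖ ⋯ γₙ₋₁ / (abcdq²ᵏ;q)ₙ₋ₖ satisfies 𝓛 γ D′ = D, where D′ is D with
-- γᵢ replaced by abcd q²ⁱ γᵢ; iterating, D is the product of all the levels above the
-- bottom one, the error after 8l levels being divisible by dˡ.
--
-- On the other side, D expands the products Φₙ = (x - x₀) ⋯ (x - xₙ₋₁), with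
-- xⱼ = (aqʲ + a⁻¹q⁻ʲ)/2, into Askey–Wilson polynomials: this is an induction on n based
-- on the contiguous relation (x - x₀) pₖ(aq) = pₖ₊₁(a) + ρₖ pₖ(a), and the bottom level
-- expands xⁿ into the Φₖ.  Since the pₖ are linearly independent, the mixed moments
-- are the entries of the product of all levels.

module Submission where

open import Algebra.Bundles using (CommutativeRing; RawRing)
import Algebra.Properties.AbelianGroup as AbelianGroupProperties
import Algebra.Properties.CommutativeSemiring.Exp as CommutativeSemiringExp
import Algebra.Properties.Ring as RingProperties
import Algebra.Properties.Semiring.Exp as SemiringExp
import Algebra.Properties.Semiring.Mult.TCOptimised as SemiringMult
import Algebra.Properties.Semiring.Sum as SemiringSum
import Algebra.Solver.Ring as RingSolver
open import Algebra.Solver.Ring.AlmostCommutativeRing using (fromCommutativeRing; _-Raw-AlmostCommutative⟶_)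
import Algebra.Solver.Ring.NaturalCoefficients.Default as SemiringSolver
open import Data.Empty using (⊥)
open import Data.Fin.Base using (Fin; zero; suc; toℕ; inject₁; fromℕ)
open import Data.Fin.Patterns using (0F; 1F; 2F; 3F; 4F; 5F; 6F; 7F)
import Data.Fin.Properties as Fin
open import Data.Fin.Relation.Unary.Top using (view; ‵fromℕ; ‵inject₁; view-fromℕ; view-inject₁)
open import Data.Integer.Base using (+_; -[1+_])
import Data.Integer.Base as ℤ
open import Data.List.Base using (List; []; _∷_; _++_; map; foldr)
open import Data.List.Membership.Propositional using (_∈_)
open import Data.List.Membership.Propositional.Properties using (∈-map⁺; ∈-map⁻; ∈-++⁺ˡ; ∈-++⁺ʳ)
import Data.List.Membership.Setoid as Membership
open import Data.List.Relation.Unary.All using ([])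
open import Data.List.Relation.Unary.AllPairs using ([]; _∷_)
open import Data.List.Relation.Unary.Any as Any using (here)
import Data.List.Relation.Unary.Any.Properties as Any
import Data.List.Relation.Unary.Unique.Propositional as UniquePropositional
import Data.List.Relation.Unary.Unique.Propositional.Properties as Unique
import Data.List.Relation.Unary.Unique.Setoid as UniqueSetoid
import Data.List.Relation.Unary.Unique.Setoid.Properties as UniqueSetoid
open import Data.Maybe.Base using (Maybe; just; nothing)
open import Data.Nat.Base using (ℕ; zero; suc; z≤n; s≤s; _≤_)
import Data.Nat.Base as ℕ
open import Data.Nat.Divisibility using (n∣m*n)
open import Data.Nat.DivMod using (_/_; _mod_; +-distrib-/-∣ˡ; +-distrib-/-∣ʳ; m*n/n≡m; m<n⇒m/n≡0; [m+kn]%n≡m%n; m<n⇒m%n≡m; m%n<n)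
import Data.Nat.Properties as ℕ
open import Data.Product.Base using (∃; Σ; _×_; _,_; proj₁; proj₂)
open import Data.Sum.Base as Sum using (_⊎_; inj₁; inj₂)
open import Data.Vec.Base as Vec using (Vec; []; _∷_; lookup)
open import Function.Base using (_∘_)
open import Level using (0ℓ)
open import Relation.Binary.PropositionalEquality as ≡ using (_≡_; _≢_)
import Relation.Binary.Reasoning.Setoid as SetoidReasoning
open import Relation.Nullary.Decidable.Core using (yes; no)
open import Relation.Nullary.Negation.Core using (¬_; contradiction)
open import Defs using (Ring₀; _⟶_; mkHom; module Units; module PowerSeries; module Polynomials; module Localization; module LaurentPolynomials; module QSeries; AskeyWilsonParameters; mapParameters; module AskeyWilson; Vertex; vertex; column; level; index; v[_,_,_]; IsSouthStep; IsEastStep; SE; SE-setoid; module Weights; CoefficientRing; module MixedMoments; ℚ⟨q⟩[a,a⁻¹])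

-- The infinite sum is never formed. For a fixed monomial bⁱcʲdˡ the graph is cut l + 1 blocks of
-- eight levels above the bottom one: any east step higher up carries a factor dˡ⁺¹, so finitely
-- many paths decide the coefficient. The finite product of levels is applied to the boundary vector
-- `Ψ`, a column of the expected product of all remaining levels, and then equals a column of `D`
-- exactly; the truncation error appears only when `Ψ` is exchanged for a Kronecker delta. The
-- induction on n works because replacing a by aq drops the node x₀ and renumbers the others, so
-- Φₙ₊₁(a) = (x - x₀) Φₙ(aq). The numbers ρₖ are those for which the two hypergeometric series in
-- pₖ₊₁ + ρₖ pₖ cancel up to a series in aq. The coefficients form only a ring, so linear
-- independence is read off from leading coefficients in e^(iθ), which are powers of the unit 1/2.

-- The library's solver does not cancel x - x over an abstract ring, so it is
-- run with integer coefficients, (m , n) standing for m - n.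
module CommutativeRingSolver (R : Ring₀) where
  open CommutativeRing R hiding (zero)
  open SemiringMult semiring using () renaming (_×_ to _·_; ×-homo-+ to ·-homo-+; ×1-homo-* to ·1-homo-*)
  open RingProperties ring using (-‿distribˡ-*; -‿distribʳ-*; -0#≈0#; -‿involutive)
  open AbelianGroupProperties +-abelianGroup using (⁻¹-∙-comm)
  open SetoidReasoning setoid
  private
    module S = SemiringSolver commutativeSemiring

    differences : RawRing 0ℓ 0ℓ
    differences = record
      { Carrier = ℕ × ℕ
      ; _≈_     = _≡_
      ; _+_     = λ (m , n) (m′ , n′) → m ℕ.+ m′ , n ℕ.+ n′
      ; _*_     = λ (m , n) (m′ , n′) → m ℕ.* m′ ℕ.+ n ℕ.* n′ , m ℕ.* n′ ℕ.+ n ℕ.* m′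
      ; -_      = λ (m , n) → n , m
      ; 0#      = 0 , 0
      ; 1#      = 1 , 0
      }

    -- The separate case of a zero second component makes `(0 , 0)` and `(1 , 0)` evaluate to `0#`
    -- and `1#` by computation, so that solved equations contain no stray subtraction of zero.
    ⟦_⟧ : ℕ × ℕ → Carrier
    ⟦ m , zero ⟧  = m · 1#
    ⟦ m , suc n ⟧ = m · 1# - suc n · 1#

    ⟦⟧-difference : ∀ m n → ⟦ m , n ⟧ ≈ m · 1# - n · 1#
    ⟦⟧-difference m zero    = sym (trans (+-congˡ -0#≈0#) (+-identityʳ _))
    ⟦⟧-difference m (suc n) = refl

    +-homo : ∀ m n m′ n′ → ⟦ m ℕ.+ m′ , n ℕ.+ n′ ⟧ ≈ ⟦ m , n ⟧ + ⟦ m′ , n′ ⟧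
    +-homo m n m′ n′ = begin
      ⟦ m ℕ.+ m′ , n ℕ.+ n′ ⟧                            ≈⟨ ⟦⟧-difference (m ℕ.+ m′) (n ℕ.+ n′) ⟩
      (m ℕ.+ m′) · 1# - (n ℕ.+ n′) · 1#                  ≈⟨ +-cong (·-homo-+ 1# m m′) (-‿cong (·-homo-+ 1# n n′)) ⟩
      (m · 1# + m′ · 1#) - (n · 1# + n′ · 1#)            ≈⟨ +-congˡ (⁻¹-∙-comm _ _) ⟨
      (m · 1# + m′ · 1#) + (- (n · 1#) + - (n′ · 1#))    ≈⟨ S.solve 4 (λ x y z t →
          (x S.:+ y) S.:+ (z S.:+ t) S.:= (x S.:+ z) S.:+ (y S.:+ t)) refl _ _ _ _ ⟩
      (m · 1# - n · 1#) + (m′ · 1# - n′ · 1#)            ≈⟨ +-cong (⟦⟧-difference m n) (⟦⟧-difference m′ n′) ⟨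
      ⟦ m , n ⟧ + ⟦ m′ , n′ ⟧                            ∎

    *-homo : ∀ m n m′ n′ → ⟦ m ℕ.* m′ ℕ.+ n ℕ.* n′ , m ℕ.* n′ ℕ.+ n ℕ.* m′ ⟧ ≈ ⟦ m , n ⟧ * ⟦ m′ , n′ ⟧
    *-homo m n m′ n′ = begin
      ⟦ m ℕ.* m′ ℕ.+ n ℕ.* n′ , m ℕ.* n′ ℕ.+ n ℕ.* m′ ⟧
        ≈⟨ ⟦⟧-difference (m ℕ.* m′ ℕ.+ n ℕ.* n′) (m ℕ.* n′ ℕ.+ n ℕ.* m′) ⟩
      (m ℕ.* m′ ℕ.+ n ℕ.* n′) · 1# - (m ℕ.* n′ ℕ.+ n ℕ.* m′) · 1#
        ≈⟨ +-cong (homo m m′ n n′) (-‿cong (homo m n′ n m′)) ⟩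
      (x * x′ + y * y′) - (x * y′ + y * x′)
        ≈⟨ +-cong (+-congˡ -y*-y′) (sym (⁻¹-∙-comm _ _)) ⟩
      (x * x′ + - y * - y′) + (- (x * y′) + - (y * x′))
        ≈⟨ +-congˡ (+-cong (-‿distribʳ-* x y′) (-‿distribˡ-* y x′)) ⟩
      (x * x′ + - y * - y′) + (x * - y′ + - y * x′)
        ≈⟨ S.solve 4 (λ x x′ z z′ → (x S.:* x′ S.:+ z S.:* z′) S.:+ (x S.:* z′ S.:+ z S.:* x′)
             S.:= (x S.:+ z) S.:* (x′ S.:+ z′)) refl x x′ (- y) (- y′) ⟩
      (x - y) * (x′ - y′)
        ≈⟨ *-cong (⟦⟧-difference m n) (⟦⟧-difference m′ n′) ⟨
      ⟦ m , n ⟧ * ⟦ m′ , n′ ⟧ ∎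
      where
      x = m · 1#
      y = n · 1#
      x′ = m′ · 1#
      y′ = n′ · 1#
      homo : ∀ i j k l → (i ℕ.* j ℕ.+ k ℕ.* l) · 1# ≈ (i · 1#) * (j · 1#) + (k · 1#) * (l · 1#)
      homo i j k l = trans (·-homo-+ 1# (i ℕ.* j) (k ℕ.* l)) (+-cong (·1-homo-* i j) (·1-homo-* k l))
      -y*-y′ : y * y′ ≈ - y * - y′
      -y*-y′ = begin
        y * y′         ≈⟨ -‿involutive _ ⟨
        - - (y * y′)   ≈⟨ -‿cong (-‿distribˡ-* y y′) ⟩
        - (- y * y′)   ≈⟨ -‿distribʳ-* (- y) y′ ⟩
        - y * - y′     ∎

    -‿homo : ∀ m n → ⟦ n , m ⟧ ≈ - ⟦ m , n ⟧
    -‿homo m n = begin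
      ⟦ n , m ⟧                  ≈⟨ ⟦⟧-difference n m ⟩
      n · 1# - m · 1#            ≈⟨ +-comm _ _ ⟩
      - (m · 1#) + n · 1#        ≈⟨ +-congˡ (-‿involutive _) ⟨
      - (m · 1#) + - - (n · 1#)  ≈⟨ ⁻¹-∙-comm _ _ ⟩
      - (m · 1# - n · 1#)        ≈⟨ -‿cong (⟦⟧-difference m n) ⟨
      - ⟦ m , n ⟧                ∎

    homomorphism : differences -Raw-AlmostCommutative⟶ fromCommutativeRing R
    homomorphism = record
      { ⟦_⟧    = ⟦_⟧
      ; +-homo = λ (m , n) (m′ , n′) → +-homo m n m′ n′
      ; *-homo = λ (m , n) (m′ , n′) → *-homo m n m′ n′
      ; -‿homo = λ (m , n) → -‿homo m n
      ; 0-homo = refl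
      ; 1-homo = refl
      }

    _≟_ : ∀ x y → Maybe (⟦ x ⟧ ≈ ⟦ y ⟧)
    (m , n) ≟ (m′ , n′) with m ℕ.+ n′ ℕ.≟ m′ ℕ.+ n
    ... | no _  = nothing
    ... | yes p = just (begin
      ⟦ m , n ⟧                              ≈⟨ ⟦⟧-difference m n ⟩
      m · 1# - n · 1#                        ≈⟨ pad (m · 1#) (n′ · 1#) (n · 1#) ⟩
      (m · 1# + n′ · 1#) - n · 1# - n′ · 1#  ≈⟨ +-congʳ (+-congʳ (begin
        m · 1# + n′ · 1#    ≈⟨ ·-homo-+ 1# m n′ ⟨
        (m ℕ.+ n′) · 1#     ≡⟨ ≡.cong (_· 1#) p ⟩
        (m′ ℕ.+ n) · 1#     ≈⟨ ·-homo-+ 1# m′ n ⟩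
        m′ · 1# + n · 1#    ∎)) ⟩
      (m′ · 1# + n · 1#) - n · 1# - n′ · 1#  ≈⟨ S.solve 4 (λ x y z t → x S.:+ y S.:+ z S.:+ t
                                                  S.:= x S.:+ t S.:+ z S.:+ y) refl _ _ _ _ ⟩
      (m′ · 1# - n′ · 1#) - n · 1# + n · 1#  ≈⟨ +-assoc _ _ _ ⟩
      (m′ · 1# - n′ · 1#) + (- (n · 1#) + n · 1#) ≈⟨ +-congˡ (-‿inverseˡ _) ⟩
      (m′ · 1# - n′ · 1#) + 0#               ≈⟨ +-identityʳ _ ⟩
      m′ · 1# - n′ · 1#                      ≈⟨ ⟦⟧-difference m′ n′ ⟨
      ⟦ m′ , n′ ⟧                            ∎)
      where
      pad : ∀ x y z → x - z ≈ (x + y) - z - y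
      pad x y z = sym (begin
        (x + y) - z - y    ≈⟨ S.solve 4 (λ x y z t → x S.:+ y S.:+ z S.:+ t
                                 S.:= x S.:+ z S.:+ (y S.:+ t)) refl x y (- z) (- y) ⟩
        (x - z) + (y - y)  ≈⟨ +-congˡ (-‿inverseʳ y) ⟩
        (x - z) + 0#       ≈⟨ +-identityʳ _ ⟩
        x - z              ∎)

  open RingSolver differences (fromCommutativeRing R) homomorphism _≟_ public
    using (Polynomial; solve; con; _:+_; _:*_; _:-_; :-_; _:=_)

  :1 : ∀ {n} → Polynomial n
  :1 = con (1 , 0)

module KroneckerDelta (A : Ring₀) where
  open CommutativeRing A hiding (zero)

  δ : ℕ → ℕ → Carrier
  δ zero    zero    = 1#
  δ zero    (suc k) = 0#
  δ (suc n) zero    = 0#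
  δ (suc n) (suc k) = δ n k

  δ-diagonal : ∀ n → δ n n ≈ 1#
  δ-diagonal zero    = refl
  δ-diagonal (suc n) = δ-diagonal n

  δ-off-diagonal : ∀ m n → m ≢ n → δ m n ≈ 0#
  δ-off-diagonal zero    zero    m≢n = contradiction ≡.refl m≢n
  δ-off-diagonal zero    (suc n) m≢n = refl
  δ-off-diagonal (suc m) zero    m≢n = refl
  δ-off-diagonal (suc m) (suc n) m≢n = δ-off-diagonal m n (m≢n ∘ ≡.cong suc)

-- Transfer operators of a level and q-binomial identities

module QBinomialTransform (A : Ring₀) (q : CommutativeRing.Carrier A) where
  open CommutativeRing A hiding (zero)
  open SemiringExp semiring using (_^_; ^-homo-*)
  open SetoidReasoning setoid
  open CommutativeRingSolver A
  open KroneckerDelta A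

  Sequence : Set
  Sequence = ℕ → Carrier

  infix 4 _≐_
  _≐_ : Sequence → Sequence → Set
  F ≐ G = ∀ n → F n ≈ G n

  infixl 7 _⊙_
  infixl 6 _⊞_
  _⊙_ _⊞_ : Sequence → Sequence → Sequence
  (F ⊙ G) n = F n * G n
  (F ⊞ G) n = F n + G n

  infixr 7 _·_
  _·_ : Carrier → Sequence → Sequence
  (c · F) n = c * F n

  infix 9 _⁺
  _⁺ : Sequence → Sequence
  (F ⁺) n = F (suc n)

  q^ : Sequence
  q^ n = q ^ n

  -- 𝓛 γ F n = Σₘ [n choose m]_q γₘ γₘ₊₁ ⋯ γₙ₋₁ Fₘ
  𝓛 : Sequence → Sequence → Sequence
  𝓛 γ F zero    = F 0
  𝓛 γ F (suc n) = 𝓛 (q · γ ⁺) (F ⁺) n + γ n * 𝓛 γ F n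

  𝓛-cong : ∀ {γ γ′ F F′} → γ ≐ γ′ → F ≐ F′ → 𝓛 γ F ≐ 𝓛 γ′ F′
  𝓛-cong γ≐γ′ F≐F′ zero    = F≐F′ 0
  𝓛-cong γ≐γ′ F≐F′ (suc n) = +-cong (𝓛-cong (*-congˡ ∘ γ≐γ′ ∘ suc) (F≐F′ ∘ suc) n)
                                     (*-cong (γ≐γ′ n) (𝓛-cong γ≐γ′ F≐F′ n))

  𝓛-congʳ : ∀ {γ F F′} → F ≐ F′ → 𝓛 γ F ≐ 𝓛 γ F′
  𝓛-congʳ = 𝓛-cong (λ _ → refl)

  𝓛-⊞ : ∀ γ F G → 𝓛 γ (F ⊞ G) ≐ 𝓛 γ F ⊞ 𝓛 γ G
  𝓛-⊞ γ F G zero    = refl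
  𝓛-⊞ γ F G (suc n) = trans (+-cong (𝓛-⊞ (q · γ ⁺) (F ⁺) (G ⁺) n) (*-congˡ (𝓛-⊞ γ F G n)))
    (solve 5 (λ x y c z t → (x :+ y) :+ c :* (z :+ t) := (x :+ c :* z) :+ (y :+ c :* t)) refl _ _ _ _ _)

  𝓛-· : ∀ γ c F → 𝓛 γ (c · F) ≐ c · 𝓛 γ F
  𝓛-· γ c F zero    = refl
  𝓛-· γ c F (suc n) = trans (+-cong (𝓛-· (q · γ ⁺) c (F ⁺) n) (*-congˡ (𝓛-· γ c F n)))
    (solve 4 (λ c x g y → c :* x :+ g :* (c :* y) := c :* (x :+ g :* y)) refl c _ _ _)

  -- The defining recursion is the q-Pascal rule [n+1 choose m] = q^(n+1-m) [n choose m-1] +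
  -- [n choose m], with the power of q hidden in `q · γ ⁺`. This is the companion rule
  -- [n choose m-1] + qᵐ [n choose m], in which γ is shifted but not rescaled.
  𝓛-suc : ∀ γ F n → 𝓛 γ F (suc n) ≈ 𝓛 (γ ⁺) (F ⁺) n + γ n * 𝓛 γ (q^ ⊙ F) n
  𝓛-suc γ F zero    = +-congˡ (*-congˡ (sym (*-identityˡ (F 0))))
  𝓛-suc γ F (suc n) = begin
    𝓛 (q · γ ⁺) (F ⁺) (suc n) + γ (suc n) * 𝓛 γ F (suc n)
      ≈⟨ +-cong (𝓛-suc (q · γ ⁺) (F ⁺) n) (*-congˡ (𝓛-suc γ F n)) ⟩
    (x + q * γ (suc n) * y) + γ (suc n) * (z + γ n * t)
      ≈⟨ solve 7 (λ x q g y z h t → (x :+ q :* g :* y) :+ g :* (z :+ h :* t)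
           := (x :+ g :* z) :+ g :* (q :* y :+ h :* t)) refl x q (γ (suc n)) y z (γ n) t ⟩
    (x + γ (suc n) * z) + γ (suc n) * (q * y + γ n * t)
      ≈⟨ +-congˡ (*-congˡ (+-congʳ (trans (sym (𝓛-· (q · γ ⁺) q (q^ ⊙ F ⁺) n))
           (𝓛-congʳ (λ m → sym (*-assoc q (q ^ m) (F (suc m)))) n)))) ⟩
    𝓛 (γ ⁺) (F ⁺) (suc n) + γ (suc n) * 𝓛 γ (q^ ⊙ F) (suc n) ∎
    where
    x = 𝓛 (q · γ ⁺ ⁺) (F ⁺ ⁺) n
    y = 𝓛 (q · γ ⁺) (q^ ⊙ F ⁺) n
    z = 𝓛 (γ ⁺) (F ⁺) n
    t = 𝓛 γ (q^ ⊙ F) n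

  -- Both sides contain the product γₘ ⋯ γₙ: on the left γₘ comes from the argument, on the right γₙ
  -- stands in front.
  𝓛-⊙γ : ∀ γ F n → 𝓛 (γ ⁺) (γ ⊙ F) n ≈ γ n * 𝓛 γ F n
  𝓛-⊙γ γ F zero    = refl
  𝓛-⊙γ γ F (suc n) = begin
    𝓛 (γ ⁺) (γ ⊙ F) (suc n)
      ≈⟨ 𝓛-suc (γ ⁺) (γ ⊙ F) n ⟩
    𝓛 (γ ⁺ ⁺) (γ ⁺ ⊙ F ⁺) n + γ (suc n) * 𝓛 (γ ⁺) (q^ ⊙ (γ ⊙ F)) n
      ≈⟨ +-cong (𝓛-⊙γ (γ ⁺) (F ⁺) n) (*-congˡ (trans
           (𝓛-congʳ (λ m → solve 3 (λ x y z → x :* (y :* z) := y :* (x :* z)) refl (q ^ m) (γ m) (F m)) n)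
           (𝓛-⊙γ γ (q^ ⊙ F) n))) ⟩
    γ (suc n) * 𝓛 (γ ⁺) (F ⁺) n + γ (suc n) * (γ n * 𝓛 γ (q^ ⊙ F) n)
      ≈⟨ distribˡ _ _ _ ⟨
    γ (suc n) * (𝓛 (γ ⁺) (F ⁺) n + γ n * 𝓛 γ (q^ ⊙ F) n)
      ≈⟨ *-congˡ (𝓛-suc γ F n) ⟨
    γ (suc n) * 𝓛 γ F (suc n) ∎

  -- Write qⁿ = qⁿ⁻ᵐ qᵐ and give one q to each of the n - m factors of γₘ ⋯ γₙ₋₁.
  𝓛-q^ : ∀ γ F n → q ^ n * 𝓛 γ F n ≈ 𝓛 (q · γ) (q^ ⊙ F) n
  𝓛-q^ γ F zero    = refl
  𝓛-q^ γ F (suc n) = begin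
    q * q ^ n * (𝓛 (q · γ ⁺) (F ⁺) n + γ n * 𝓛 γ F n)
      ≈⟨ solve 5 (λ q p x g y → q :* p :* (x :+ g :* y) := q :* (p :* x) :+ q :* g :* (p :* y)) refl q (q ^ n) _ (γ n) _ ⟩
    q * (q ^ n * 𝓛 (q · γ ⁺) (F ⁺) n) + q * γ n * (q ^ n * 𝓛 γ F n)
      ≈⟨ +-cong (*-congˡ (𝓛-q^ (q · γ ⁺) (F ⁺) n)) (*-congˡ (𝓛-q^ γ F n)) ⟩
    q * 𝓛 (q · q · γ ⁺) (q^ ⊙ F ⁺) n + q * γ n * 𝓛 (q · γ) (q^ ⊙ F) n
      ≈⟨ +-congʳ (trans (sym (𝓛-· (q · q · γ ⁺) q (q^ ⊙ F ⁺) n))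
           (𝓛-congʳ (λ m → sym (*-assoc q (q ^ m) (F (suc m)))) n)) ⟩
    𝓛 (q · γ) (q^ ⊙ F) (suc n) ∎

  _^⟨1-_⟩ : Sequence → Carrier → Sequence
  (α ^⟨1- y ⟩) i = α i * (1# - y * q ^ i)

  -- On entries this is the q-binomial theorem for (1 - yqᵏ) ⋯ (1 - yqⁿ⁻¹). The induction avoids the
  -- double sum: `𝓛-q^` and `𝓛-⊙γ` pull the weight of the inner level out of the outer one, where
  -- -yqⁿαₙ joins αₙ to form αₙ(1 - yqⁿ); shifting all indices turns y into yq.
  𝓛-∘ : ∀ α β y F → (∀ i → β i ≈ - y * q ^ i * α i) → 𝓛 α (𝓛 β F) ≐ 𝓛 (α ^⟨1- y ⟩) F
  𝓛-∘ α β y F β≈ zero    = refl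
  𝓛-∘ α β y F β≈ (suc n) = begin
    𝓛 (q · α ⁺) (𝓛 (q · β ⁺) (F ⁺) ⊞ β ⊙ G) n + α n * 𝓛 α G n
      ≈⟨ +-congʳ (𝓛-⊞ (q · α ⁺) (𝓛 (q · β ⁺) (F ⁺)) (β ⊙ G) n) ⟩
    (𝓛 (q · α ⁺) (𝓛 (q · β ⁺) (F ⁺)) n + 𝓛 (q · α ⁺) (β ⊙ G) n) + α n * 𝓛 α G n
      ≈⟨ +-congʳ (+-cong ih second) ⟩
    (𝓛 (q · (α ^⟨1- y ⟩) ⁺) (F ⁺) n + - y * (q ^ n * (α n * 𝓛 α G n))) + α n * 𝓛 α G n
      ≈⟨ solve 5 (λ x y p a z → (x :+ (:- y) :* (p :* (a :* z))) :+ a :* z := x :+ (a :* (:1 :- y :* p)) :* z)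
           refl _ y (q ^ n) (α n) (𝓛 α G n) ⟩
    𝓛 (q · (α ^⟨1- y ⟩) ⁺) (F ⁺) n + (α n * (1# - y * q ^ n)) * 𝓛 α G n
      ≈⟨ +-congˡ (*-congˡ (𝓛-∘ α β y F β≈ n)) ⟩
    𝓛 (α ^⟨1- y ⟩) F (suc n) ∎
    where
    G = 𝓛 β F
    ih : 𝓛 (q · α ⁺) (𝓛 (q · β ⁺) (F ⁺)) n ≈ 𝓛 (q · (α ^⟨1- y ⟩) ⁺) (F ⁺) n
    ih = trans
      (𝓛-∘ (q · α ⁺) (q · β ⁺) (y * q) (F ⁺) (λ i → trans (*-congˡ (β≈ (suc i)))
        (solve 4 (λ q y p a → q :* ((:- y) :* (q :* p) :* a) := (:- (y :* q)) :* p :* (q :* a)) refl q y (q ^ i) (α (suc i)))) n)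
      (𝓛-cong (λ i → solve 4 (λ q y p a → (q :* a) :* (:1 :- y :* q :* p) := q :* (a :* (:1 :- y :* (q :* p))))
        refl q y (q ^ i) (α (suc i))) (λ _ → refl) n)
    second : 𝓛 (q · α ⁺) (β ⊙ G) n ≈ - y * (q ^ n * (α n * 𝓛 α G n))
    second = begin
      𝓛 (q · α ⁺) (β ⊙ G) n
        ≈⟨ 𝓛-congʳ (λ m → trans (*-congʳ (β≈ m))
             (solve 4 (λ y p a g → (:- y) :* p :* a :* g := (:- y) :* (p :* (a :* g))) refl y (q ^ m) (α m) (G m))) n ⟩
      𝓛 (q · α ⁺) (- y · (q^ ⊙ (α ⊙ G))) n
        ≈⟨ 𝓛-· (q · α ⁺) (- y) (q^ ⊙ (α ⊙ G)) n ⟩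
      - y * 𝓛 (q · α ⁺) (q^ ⊙ (α ⊙ G)) n
        ≈⟨ *-congˡ (trans (sym (𝓛-q^ (α ⁺) (α ⊙ G) n)) (*-congˡ (𝓛-⊙γ α G n))) ⟩
      - y * (q ^ n * (α n * 𝓛 α G n)) ∎

  -- D v γ n k = [n choose k]_q γₖ ⋯ γₙ₋₁ v₂ₖ ⋯ vₙ₊ₖ₋₁
  D : Sequence → Sequence → ℕ → ℕ → Carrier
  D v γ zero    zero    = 1#
  D v γ zero    (suc k) = 0#
  D v γ (suc n) zero    = γ n * v n * D v γ n 0
  D v γ (suc n) (suc k) = D (v ⁺ ⁺) (γ ⁺) n k + q ^ suc k * γ n * v (suc (n ℕ.+ k)) * D v γ n (suc k)

  D-cong : ∀ {v v′ γ γ′} → v ≐ v′ → γ ≐ γ′ → ∀ n k → D v γ n k ≈ D v′ γ′ n k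
  D-cong p r zero    zero    = refl
  D-cong p r zero    (suc k) = refl
  D-cong p r (suc n) zero    = *-cong (*-cong (r n) (p n)) (D-cong p r n 0)
  D-cong p r (suc n) (suc k) = +-cong (D-cong (λ i → p (suc (suc i))) (r ∘ suc) n k)
    (*-cong (*-cong (*-congˡ (r n)) (p (suc (n ℕ.+ k)))) (D-cong p r n (suc k)))

  D-above : ∀ v γ {n k} → n ℕ.< k → D v γ n k ≈ 0#
  D-above v γ {zero}  {suc k} _           = refl
  D-above v γ {suc n} {suc k} (ℕ.s≤s n<k) = trans
    (+-cong (D-above (v ⁺ ⁺) (γ ⁺) n<k) (trans (*-congˡ (D-above v γ (ℕ.m<n⇒m<1+n n<k))) (zeroʳ _)))
    (+-identityʳ 0#)

  D-diagonal : ∀ v γ n → D v γ n n ≈ 1#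
  D-diagonal v γ zero    = refl
  D-diagonal v γ (suc n) = trans
    (+-cong (D-diagonal (v ⁺ ⁺) (γ ⁺) n) (trans (*-congˡ (D-above v γ (ℕ.n<1+n n))) (zeroʳ _)))
    (+-identityʳ 1#)

  D-⊙γ : ∀ v γ n k → D v (γ ⁺) n k * γ k ≈ γ n * D v γ n k
  D-⊙γ v γ zero    zero    = *-comm _ _
  D-⊙γ v γ zero    (suc k) = trans (zeroˡ _) (sym (zeroʳ _))
  D-⊙γ v γ (suc n) zero    = trans
    (solve 4 (λ g v d h → g :* v :* d :* h := g :* v :* (d :* h)) refl (γ (suc n)) (v n) _ (γ 0))
    (trans (*-congˡ (D-⊙γ v γ n 0))
    (solve 4 (λ g v h d → g :* v :* (h :* d) := g :* (h :* v :* d)) refl (γ (suc n)) (v n) (γ n) _))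
  D-⊙γ v γ (suc n) (suc k) = begin
    (D (v ⁺ ⁺) (γ ⁺ ⁺) n k + q ^ suc k * γ (suc n) * v′ * D v (γ ⁺) n (suc k)) * γ (suc k)
      ≈⟨ solve 6 (λ x p g v y h → (x :+ p :* g :* v :* y) :* h := x :* h :+ p :* g :* v :* (y :* h)) refl
           _ (q ^ suc k) (γ (suc n)) v′ _ (γ (suc k)) ⟩
    D (v ⁺ ⁺) (γ ⁺ ⁺) n k * γ (suc k) + q ^ suc k * γ (suc n) * v′ * (D v (γ ⁺) n (suc k) * γ (suc k))
      ≈⟨ +-cong (D-⊙γ (v ⁺ ⁺) (γ ⁺) n k) (*-congˡ (D-⊙γ v γ n (suc k))) ⟩
    γ (suc n) * D (v ⁺ ⁺) (γ ⁺) n k + q ^ suc k * γ (suc n) * v′ * (γ n * D v γ n (suc k))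
      ≈⟨ solve 6 (λ g x p v h y → g :* x :+ p :* g :* v :* (h :* y) := g :* (x :+ p :* h :* v :* y)) refl
           (γ (suc n)) _ (q ^ suc k) v′ (γ n) _ ⟩
    γ (suc n) * D v γ (suc n) (suc k) ∎
    where v′ = v (suc (n ℕ.+ k))

  D-q^ : ∀ v γ n k → q ^ n * D v γ n k ≈ q ^ k * D v (q · γ) n k
  D-q^ v γ zero    zero    = refl
  D-q^ v γ zero    (suc k) = trans (zeroʳ _) (sym (zeroʳ _))
  D-q^ v γ (suc n) zero    = trans
    (solve 5 (λ q p g v d → q :* p :* (g :* v :* d) := q :* g :* v :* (p :* d)) refl q (q ^ n) (γ n) (v n) _)
    (trans (*-congˡ (D-q^ v γ n 0)) (solve 2 (λ x y → x :* (:1 :* y) := :1 :* (x :* y)) refl _ _))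
  D-q^ v γ (suc n) (suc k) = begin
    q * q ^ n * (D (v ⁺ ⁺) (γ ⁺) n k + q ^ suc k * γ n * v′ * D v γ n (suc k))
      ≈⟨ solve 7 (λ q p x r g v y → q :* p :* (x :+ r :* g :* v :* y) := q :* (p :* x) :+ r :* (q :* g) :* v :* (p :* y)) refl
           q (q ^ n) _ (q ^ suc k) (γ n) v′ _ ⟩
    q * (q ^ n * D (v ⁺ ⁺) (γ ⁺) n k) + q ^ suc k * (q * γ n) * v′ * (q ^ n * D v γ n (suc k))
      ≈⟨ +-cong (*-congˡ (D-q^ (v ⁺ ⁺) (γ ⁺) n k)) (*-congˡ (D-q^ v γ n (suc k))) ⟩
    q * (q ^ k * D (v ⁺ ⁺) (q · γ ⁺) n k) + q ^ suc k * (q * γ n) * v′ * (q ^ suc k * D v (q · γ) n (suc k))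
      ≈⟨ solve 6 (λ q p x g v y → q :* (p :* x) :+ q :* p :* g :* v :* (q :* p :* y)
           := q :* p :* (x :+ q :* p :* g :* v :* y)) refl
           q (q ^ k) _ (q * γ n) v′ _ ⟩
    q ^ suc k * D v (q · γ) (suc n) (suc k) ∎
    where v′ = v (suc (n ℕ.+ k))

  -- Both sides contain v₂ₖ ⋯ vₙ₊ₖ, with the last factor split off on the left and the first on the
  -- right.
  D-v⁺ : ∀ v γ n k → D v γ n k * v (n ℕ.+ k) ≈ v (k ℕ.+ k) * D (v ⁺) γ n k
  D-v⁺ v γ zero    zero    = *-comm _ _
  D-v⁺ v γ zero    (suc k) = trans (zeroˡ _) (sym (zeroʳ _))
  D-v⁺ v γ (suc n) zero    = begin
    γ n * v n * D v γ n 0 * v (suc (n ℕ.+ 0))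
      ≈⟨ *-cong (*-congʳ (*-congˡ (reflexive (≡.cong v (≡.sym n+0)))))
                (reflexive (≡.cong (v ∘ suc) n+0)) ⟩
    γ n * v (n ℕ.+ 0) * D v γ n 0 * v (suc n)
      ≈⟨ solve 4 (λ g v d w → g :* v :* d :* w := g :* w :* (d :* v)) refl (γ n) (v (n ℕ.+ 0)) _ (v (suc n)) ⟩
    γ n * v (suc n) * (D v γ n 0 * v (n ℕ.+ 0))
      ≈⟨ *-congˡ (D-v⁺ v γ n 0) ⟩
    γ n * v (suc n) * (v 0 * D (v ⁺) γ n 0)
      ≈⟨ solve 3 (λ x y z → x :* (y :* z) := y :* (x :* z)) refl _ (v 0) _ ⟩
    v 0 * (γ n * v (suc n) * D (v ⁺) γ n 0) ∎
    where n+0 = ℕ.+-identityʳ n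
  D-v⁺ v γ (suc n) (suc k) = begin
    (D (v ⁺ ⁺) (γ ⁺) n k + q ^ suc k * γ n * v (suc (n ℕ.+ k)) * D v γ n (suc k)) * v (suc (n ℕ.+ suc k))
      ≈⟨ *-cong (+-congˡ (*-congʳ (*-congˡ (reflexive (≡.cong v (≡.sym n+sk)))))) (reflexive (≡.cong (v ∘ suc) n+sk)) ⟩
    (D (v ⁺ ⁺) (γ ⁺) n k + q ^ suc k * γ n * v (n ℕ.+ suc k) * D v γ n (suc k)) * v (suc (suc (n ℕ.+ k)))
      ≈⟨ solve 6 (λ x p g v y w → (x :+ p :* g :* v :* y) :* w := x :* w :+ p :* g :* w :* (y :* v)) refl
           _ (q ^ suc k) (γ n) (v (n ℕ.+ suc k)) _ (v (suc (suc (n ℕ.+ k)))) ⟩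
    D (v ⁺ ⁺) (γ ⁺) n k * v (suc (suc (n ℕ.+ k))) + q ^ suc k * γ n * v (suc (suc (n ℕ.+ k))) * (D v γ n (suc k) * v (n ℕ.+ suc k))
      ≈⟨ +-cong (D-v⁺ (v ⁺ ⁺) (γ ⁺) n k) (*-congˡ (D-v⁺ v γ n (suc k))) ⟩
    v (suc (suc (k ℕ.+ k))) * D (v ⁺ ⁺ ⁺) (γ ⁺) n k + q ^ suc k * γ n * v (suc (suc (n ℕ.+ k))) * (v (suc (k ℕ.+ suc k)) * D (v ⁺) γ n (suc k))
      ≈⟨ +-congʳ (*-congʳ (reflexive (≡.cong (v ∘ suc) (≡.sym (ℕ.+-suc k k))))) ⟩
    v (suc (k ℕ.+ suc k)) * D (v ⁺ ⁺ ⁺) (γ ⁺) n k + q ^ suc k * γ n * v (suc (suc (n ℕ.+ k))) * (v (suc (k ℕ.+ suc k)) * D (v ⁺) γ n (suc k))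
      ≈⟨ solve 4 (λ v x y z → v :* x :+ y :* (v :* z) := v :* (x :+ y :* z)) refl (v (suc (k ℕ.+ suc k))) _ _ _ ⟩
    v (suc (k ℕ.+ suc k)) * D (v ⁺) γ (suc n) (suc k) ∎
    where n+sk = ℕ.+-suc n k

  -- The companion q-Pascal rule, with qⁿ⁻ᵏ on the first summand (carried by `q · γ ⁺`) instead of
  -- qᵏ⁺¹ on the second. `D-shift-suc` plays it off against the defining rule.
  D-suc : ∀ v γ n k → D v γ (suc n) (suc k) ≈ D (v ⁺ ⁺) (q · γ ⁺) n k + γ n * v (suc (n ℕ.+ k)) * D v γ n (suc k)
  D-suc v γ zero    zero    = +-congˡ (trans (zeroʳ _) (sym (zeroʳ _)))
  D-suc v γ zero    (suc k) = +-congˡ (trans (zeroʳ _) (sym (zeroʳ _)))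
  D-suc v γ (suc n) zero    = begin
    γ′ * v′ * x + q ^ 1 * γ′ * v″ * D v γ (suc n) 1
      ≈⟨ +-cong (*-congʳ (*-congˡ v′≈v″)) (*-congˡ (D-suc v γ n 0)) ⟩
    γ′ * v″ * x + q ^ 1 * γ′ * v″ * (y + γ n * v (suc (n ℕ.+ 0)) * z)
      ≈⟨ solve 8 (λ q g w x y h u z → g :* w :* x :+ q :* :1 :* g :* w :* (y :+ h :* u :* z)
           := q :* g :* w :* y :+ g :* w :* (x :+ q :* :1 :* h :* u :* z)) refl q γ′ v″ x y (γ n) (v (suc (n ℕ.+ 0))) z ⟩
    q * γ′ * v″ * y + γ′ * v″ * (x + q ^ 1 * γ n * v (suc (n ℕ.+ 0)) * z)
      ≈⟨ +-congʳ (*-congʳ (*-congˡ v′≈v″)) ⟨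
    q * γ′ * v′ * y + γ′ * v″ * D v γ (suc n) 1 ∎
    where
    γ′ = γ (suc n)
    v′ = v (suc (suc n))
    v″ = v (suc (suc (n ℕ.+ 0)))
    v′≈v″ : v′ ≈ v″
    v′≈v″ = reflexive (≡.cong (λ m → v (suc (suc m))) (≡.sym (ℕ.+-identityʳ n)))
    x = D (v ⁺ ⁺) (γ ⁺) n 0
    y = D (v ⁺ ⁺) (q · γ ⁺) n 0
    z = D v γ n 1
  D-suc v γ (suc n) (suc k) = begin
    D (v ⁺ ⁺) (γ ⁺) (suc n) (suc k) + q * r * γ′ * v″ * D v γ (suc n) (suc (suc k))
      ≈⟨ +-cong (D-suc (v ⁺ ⁺) (γ ⁺) n k) (*-congˡ (D-suc v γ n (suc k))) ⟩
    (x + γ′ * v′ * y) + q * r * γ′ * v″ * (z + γ n * u * t)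
      ≈⟨ +-congʳ (+-congˡ (*-congʳ (*-congˡ v′≈v″))) ⟩
    (x + γ′ * v″ * y) + q * r * γ′ * v″ * (z + γ n * u * t)
      ≈⟨ solve 10 (λ x g v y q r z h u t → (x :+ g :* v :* y) :+ q :* r :* g :* v :* (z :+ h :* u :* t)
           := (x :+ r :* (q :* g) :* v :* z) :+ g :* v :* (y :+ q :* r :* h :* u :* t)) refl x γ′ v″ y q r z (γ n) u t ⟩
    (x + r * (q * γ′) * v″ * z) + γ′ * v″ * (y + q * r * γ n * u * t)
      ≈⟨ +-congʳ (+-congˡ (*-congʳ (*-congˡ v′≈v″))) ⟨
    D (v ⁺ ⁺) (q · γ ⁺) (suc n) (suc k) + γ′ * v″ * D v γ (suc n) (suc (suc k)) ∎
    where
    γ′ = γ (suc n)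
    r = q ^ suc k
    u = v (suc (n ℕ.+ suc k))
    v′ = v (suc (suc (suc (n ℕ.+ k))))
    v″ = v (suc (suc (n ℕ.+ suc k)))
    v′≈v″ : v′ ≈ v″
    v′≈v″ = reflexive (≡.cong (λ m → v (suc (suc m))) (≡.sym (ℕ.+-suc n k)))
    x = D (v ⁺ ⁺ ⁺ ⁺) (q · γ ⁺ ⁺) n k
    y = D (v ⁺ ⁺) (γ ⁺) n (suc k)
    z = D (v ⁺ ⁺) (q · γ ⁺) n (suc k)
    t = D v γ n (suc (suc k))

  Inverts : Carrier → Sequence → Set
  Inverts E v = ∀ i → (1# - E * q ^ i) * v i ≈ 1#

  Inverts-⁺ : ∀ {E v} → Inverts E v → Inverts (E * q) (v ⁺)
  Inverts-⁺ {E} inv i = trans (*-congʳ (+-congˡ (-‿cong (*-assoc E q (q ^ i))))) (inv (suc i))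

  scale : Carrier → Sequence
  scale E i = E * (q ^ i * q ^ i)

  private
    -- With z = Eqᵐ⁺ᵏ and vₘ₊ₖ = 1/(1 - z), this is z vₘ₊ₖ + 1 = vₘ₊ₖ multiplied by qᵐ x.
    scale-pascal : ∀ {E v} → Inverts E v → ∀ m k x →
      q ^ k * scale E m * v (m ℕ.+ k) * x + q ^ m * x ≈ q ^ m * (v (m ℕ.+ k) * x)
    scale-pascal {E} {v} inv m k x = begin
      q ^ k * scale E m * v (m ℕ.+ k) * x + q ^ m * x
        ≈⟨ +-congˡ (*-congˡ (trans (sym (*-identityˡ x)) (*-congʳ (sym one)))) ⟩
      q ^ k * scale E m * v (m ℕ.+ k) * x + q ^ m * (((1# - E * (q ^ m * q ^ k)) * v (m ℕ.+ k)) * x)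
        ≈⟨ solve 5 (λ p r E v x → p :* (E :* (r :* r)) :* v :* x :+ r :* (((:1 :- E :* (r :* p)) :* v) :* x)
             := r :* (v :* x)) refl (q ^ k) (q ^ m) E (v (m ℕ.+ k)) x ⟩
      q ^ m * (v (m ℕ.+ k) * x) ∎
      where
      one : (1# - E * (q ^ m * q ^ k)) * v (m ℕ.+ k) ≈ 1#
      one = trans (*-congʳ (+-congˡ (-‿cong (*-congˡ (sym (^-homo-* q m k)))))) (inv (m ℕ.+ k))

  -- A terminating q-Chu–Vandermonde sum: with A = Eq²ᵏ and N = n - k it reads
  -- Σₗ [N choose l]_q Aˡ qˡ⁽ˡ⁻¹⁾ / (A;q)ₗ = 1 / (A;q)_N.
  𝓛-D : ∀ n k {E v} γ → Inverts E v → 𝓛 γ (λ m → D v (scale E ⊙ γ) m k) n ≈ D v γ n k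
  private
    -- The factor qᵐ vₘ₊ₖ turns E into Eq: `D-v⁺` advances v by one, and `D-q^` multiplies every
    -- factor of `scale E ⊙ γ` by q. So `𝓛-D` applies at the same n. The mutual recursion terminates
    -- because `𝓛-D` comes here only after lowering n.
    𝓛-D-v : ∀ n k {E v} γ → Inverts E v →
      𝓛 γ (λ m → q ^ m * (v (m ℕ.+ k) * D v (scale E ⊙ γ) m k)) n ≈ q ^ k * (v (n ℕ.+ k) * D v γ n k)
    𝓛-D-v n k {E} {v} γ inv = begin
      𝓛 γ (λ m → q ^ m * (v (m ℕ.+ k) * D v (scale E ⊙ γ) m k)) n
        ≈⟨ 𝓛-congʳ pointwise n ⟩
      𝓛 γ ((q ^ k * v (k ℕ.+ k)) · λ m → D (v ⁺) (scale (E * q) ⊙ γ) m k) n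
        ≈⟨ 𝓛-· γ _ _ n ⟩
      q ^ k * v (k ℕ.+ k) * 𝓛 γ (λ m → D (v ⁺) (scale (E * q) ⊙ γ) m k) n
        ≈⟨ *-congˡ (𝓛-D n k γ (Inverts-⁺ inv)) ⟩
      q ^ k * v (k ℕ.+ k) * D (v ⁺) γ n k
        ≈⟨ *-assoc _ _ _ ⟩
      q ^ k * (v (k ℕ.+ k) * D (v ⁺) γ n k)
        ≈⟨ *-congˡ (trans (*-comm _ _) (D-v⁺ v γ n k)) ⟨
      q ^ k * (v (n ℕ.+ k) * D v γ n k) ∎
      where
      pointwise : ∀ m → q ^ m * (v (m ℕ.+ k) * D v (scale E ⊙ γ) m k)
                        ≈ q ^ k * v (k ℕ.+ k) * D (v ⁺) (scale (E * q) ⊙ γ) m k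
      pointwise m = begin
        q ^ m * (v (m ℕ.+ k) * D v (scale E ⊙ γ) m k)
          ≈⟨ *-congˡ (trans (*-comm _ _) (D-v⁺ v (scale E ⊙ γ) m k)) ⟩
        q ^ m * (v (k ℕ.+ k) * D (v ⁺) (scale E ⊙ γ) m k)
          ≈⟨ solve 3 (λ x y z → x :* (y :* z) := y :* (x :* z)) refl _ _ _ ⟩
        v (k ℕ.+ k) * (q ^ m * D (v ⁺) (scale E ⊙ γ) m k)
          ≈⟨ *-congˡ (D-q^ (v ⁺) (scale E ⊙ γ) m k) ⟩
        v (k ℕ.+ k) * (q ^ k * D (v ⁺) (q · (scale E ⊙ γ)) m k)
          ≈⟨ *-congˡ (*-congˡ (D-cong (λ _ → refl) (λ i → solve 4 (λ q E p g → q :* (E :* (p :* p) :* g)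
               := E :* q :* (p :* p) :* g) refl q E (q ^ i) (γ i)) m k)) ⟩
        v (k ℕ.+ k) * (q ^ k * D (v ⁺) (scale (E * q) ⊙ γ) m k)
          ≈⟨ solve 3 (λ x y z → x :* (y :* z) := y :* x :* z) refl _ _ _ ⟩
        q ^ k * v (k ℕ.+ k) * D (v ⁺) (scale (E * q) ⊙ γ) m k ∎

    -- After `𝓛-suc`, the part of `G (suc m)` with a factor γₘ and the term with qᵐ `G m` combine by
    -- `scale-pascal` into the single argument handled by `𝓛-D-v`.
    𝓛-D-step : ∀ n k {E v} γ → Inverts E v → let G = λ m → D v (scale E ⊙ γ) m k in
      𝓛 (γ ⁺) (γ ⊙ λ m → q ^ k * scale E m * v (m ℕ.+ k) * G m) n + γ n * 𝓛 γ (q^ ⊙ G) n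
      ≈ γ n * (q ^ k * (v (n ℕ.+ k) * D v γ n k))
    𝓛-D-step n k {E} {v} γ inv = begin
      𝓛 (γ ⁺) (γ ⊙ F) n + γ n * 𝓛 γ (q^ ⊙ G) n
        ≈⟨ +-congʳ (𝓛-⊙γ γ F n) ⟩
      γ n * 𝓛 γ F n + γ n * 𝓛 γ (q^ ⊙ G) n
        ≈⟨ distribˡ _ _ _ ⟨
      γ n * (𝓛 γ F n + 𝓛 γ (q^ ⊙ G) n)
        ≈⟨ *-congˡ (trans (sym (𝓛-⊞ γ F (q^ ⊙ G) n)) (𝓛-congʳ (λ m → scale-pascal inv m k (G m)) n)) ⟩
      γ n * 𝓛 γ (λ m → q ^ m * (v (m ℕ.+ k) * G m)) n
        ≈⟨ *-congˡ (𝓛-D-v n k γ inv) ⟩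
      γ n * (q ^ k * (v (n ℕ.+ k) * D v γ n k)) ∎
      where
      G F : Sequence
      G m = D v (scale E ⊙ γ) m k
      F m = q ^ k * scale E m * v (m ℕ.+ k) * G m

  𝓛-D zero    zero    γ inv = refl
  𝓛-D zero    (suc k) γ inv = refl
  𝓛-D (suc n) zero {E} {v} γ inv = begin
    𝓛 γ G (suc n)
      ≈⟨ 𝓛-suc γ G n ⟩
    𝓛 (γ ⁺) (G ⁺) n + γ n * 𝓛 γ (q^ ⊙ G) n
      ≈⟨ +-congʳ (𝓛-congʳ (λ m → trans (*-congʳ (*-congˡ (reflexive (≡.cong v (≡.sym (ℕ.+-identityʳ m))))))
           (solve 4 (λ s g v x → s :* g :* v :* x := g :* (:1 :* s :* v :* x)) refl (scale E m) (γ m) (v (m ℕ.+ 0)) (G m))) n) ⟩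
    𝓛 (γ ⁺) (γ ⊙ λ m → q ^ 0 * scale E m * v (m ℕ.+ 0) * G m) n + γ n * 𝓛 γ (q^ ⊙ G) n
      ≈⟨ 𝓛-D-step n 0 γ inv ⟩
    γ n * (1# * (v (n ℕ.+ 0) * D v γ n 0))
      ≈⟨ solve 3 (λ g v d → g :* (:1 :* (v :* d)) := g :* v :* d) refl (γ n) (v (n ℕ.+ 0)) _ ⟩
    γ n * v (n ℕ.+ 0) * D v γ n 0
      ≈⟨ *-congʳ (*-congˡ (reflexive (≡.cong v (ℕ.+-identityʳ n)))) ⟩
    γ n * v n * D v γ n 0 ∎
    where
    G : Sequence
    G m = D v (scale E ⊙ γ) m 0
  𝓛-D (suc n) (suc k) {E} {v} γ inv = begin
    𝓛 γ G (suc n)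
      ≈⟨ 𝓛-suc γ G n ⟩
    𝓛 (γ ⁺) (G ⁺) n + γ n * 𝓛 γ (q^ ⊙ G) n
      ≈⟨ +-congʳ (trans (𝓛-congʳ split n) (𝓛-⊞ (γ ⁺) _ (γ ⊙ F) n)) ⟩
    (𝓛 (γ ⁺) (λ m → D (v ⁺ ⁺) (scale (E * q * q) ⊙ γ ⁺) m k) n + 𝓛 (γ ⁺) (γ ⊙ F) n) + γ n * 𝓛 γ (q^ ⊙ G) n
      ≈⟨ +-assoc _ _ _ ⟩
    𝓛 (γ ⁺) (λ m → D (v ⁺ ⁺) (scale (E * q * q) ⊙ γ ⁺) m k) n + (𝓛 (γ ⁺) (γ ⊙ F) n + γ n * 𝓛 γ (q^ ⊙ G) n)
      ≈⟨ +-cong (𝓛-D n k (γ ⁺) (Inverts-⁺ (Inverts-⁺ inv))) (𝓛-D-step n (suc k) γ inv) ⟩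
    D (v ⁺ ⁺) (γ ⁺) n k + γ n * (q ^ suc k * (v (n ℕ.+ suc k) * D v γ n (suc k)))
      ≈⟨ +-congˡ (trans (solve 4 (λ g p v d → g :* (p :* (v :* d)) := p :* g :* v :* d) refl (γ n) (q ^ suc k) (v (n ℕ.+ suc k)) _)
           (*-congʳ (*-congˡ (reflexive (≡.cong v (ℕ.+-suc n k)))))) ⟩
    D v γ (suc n) (suc k) ∎
    where
    G F : Sequence
    G m = D v (scale E ⊙ γ) m (suc k)
    F m = q ^ suc k * scale E m * v (m ℕ.+ suc k) * G m
    split : ∀ m → G (suc m) ≈ D (v ⁺ ⁺) (scale (E * q * q) ⊙ γ ⁺) m k + γ m * F m
    split m = +-cong
      (D-cong (λ _ → refl) (λ i → solve 4 (λ E q p g → E :* (q :* p :* (q :* p)) :* g := E :* q :* q :* (p :* p) :* g)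
        refl E q (q ^ i) (γ (suc i))) m k)
      (trans (*-congʳ (*-congˡ (reflexive (≡.cong v (≡.sym (ℕ.+-suc m k))))))
        (solve 5 (λ p s g v x → p :* (s :* g) :* v :* x := g :* (p :* s :* v :* x)) refl
          (q ^ suc k) (scale E m) (γ m) (v (m ℕ.+ suc k)) (G m)))

  -- The coefficients ρ k of the Christoffel transform, where e k stands for
  -- Eqᵏ⁻¹ and u k for its reciprocal 1 / (1 - Eqᵏ⁻¹).
  ρ : Sequence → Sequence → Sequence → Sequence
  ρ e u γ k = γ k * q ^ k * (1# - e k) * (u (k ℕ.+ k) * u (suc (k ℕ.+ k)))

  geometric : ∀ {e : Sequence} → (∀ n → e (suc n) ≈ e n * q) → ∀ m n → e (m ℕ.+ n) ≈ q ^ m * e n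
  geometric     e-suc zero    n = sym (*-identityˡ _)
  geometric {e} e-suc (suc m) n = trans (e-suc (m ℕ.+ n)) (trans (*-congʳ (geometric {e} e-suc m n))
    (solve 3 (λ p x q → p :* x :* q := q :* p :* x) refl (q ^ m) (e n) q))

  module _ (e u γ : Sequence) (e-suc : ∀ n → e (suc n) ≈ e n * q) (u-inv : ∀ n → (1# - e n) * u n ≈ 1#) where

    -- For the Askey-Wilson data, `D (u ⁺ ⁺) (γ ⁺)` is the matrix for aq in place of a. This and
    -- `D-shift-suc` are what comparing coefficients in Φₙ₊₁(a) = (x - x₀) Φₙ(aq) demands once (x -
    -- x₀) pₖ(aq) is replaced by pₖ₊₁ + ρₖ pₖ; at p₀ only the ρ term contributes.
    D-shift-zero : ∀ n → D (u ⁺) γ (suc n) 0 ≈ ρ e u γ 0 * D (u ⁺ ⁺) (γ ⁺) n 0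
    D-shift-zero n = begin
      γ n * u (suc n) * D (u ⁺) γ n 0
        ≈⟨ solve 3 (λ g v d → g :* v :* d := g :* (d :* v)) refl (γ n) (u (suc n)) _ ⟩
      γ n * (D (u ⁺) γ n 0 * u (suc n))
        ≈⟨ *-congˡ (trans (*-congˡ (reflexive (≡.cong (u ∘ suc) (≡.sym (ℕ.+-identityʳ n))))) (D-v⁺ (u ⁺) γ n 0)) ⟩
      γ n * (u 1 * D (u ⁺ ⁺) γ n 0)
        ≈⟨ solve 3 (λ g v d → g :* (v :* d) := v :* (g :* d)) refl (γ n) (u 1) _ ⟩
      u 1 * (γ n * D (u ⁺ ⁺) γ n 0)
        ≈⟨ *-congˡ (sym (D-⊙γ (u ⁺ ⁺) γ n 0)) ⟩
      u 1 * (D (u ⁺ ⁺) (γ ⁺) n 0 * γ 0)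
        ≈⟨ solve 3 (λ v d g → v :* (d :* g) := :1 :* (g :* v :* d)) refl (u 1) _ (γ 0) ⟩
      1# * (γ 0 * u 1 * D (u ⁺ ⁺) (γ ⁺) n 0)
        ≈⟨ *-congʳ (sym (u-inv 0)) ⟩
      (1# - e 0) * u 0 * (γ 0 * u 1 * D (u ⁺ ⁺) (γ ⁺) n 0)
        ≈⟨ solve 5 (λ y v g w d → y :* v :* (g :* w :* d) := g :* :1 :* y :* (v :* w) :* d) refl (1# - e 0) (u 0) (γ 0) (u 1) _ ⟩
      ρ e u γ 0 * D (u ⁺ ⁺) (γ ⁺) n 0 ∎

    -- Both Pascal rules express L, the entry at (n+1, k+1), through the same
    -- two numbers W and V; in the combination (1 - e (2k+2)) L of the two rules
    -- the denominators match.
    D-shift-suc : ∀ n k → D (u ⁺) γ (suc n) (suc k)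
                          ≈ D (u ⁺ ⁺) (γ ⁺) n k + ρ e u γ (suc k) * D (u ⁺ ⁺) (γ ⁺) n (suc k)
    D-shift-suc n k = begin
      L
        ≈⟨ *-identityˡ L ⟨
      1# * L
        ≈⟨ *-congʳ (sym (u-inv (suc k ℕ.+ suc k))) ⟩
      (1# - e (suc k ℕ.+ suc k)) * u₁ * L
        ≈⟨ *-congʳ (*-congʳ (+-congˡ (-‿cong e₁≈))) ⟩
      (1# - q ^ k * e₂) * u₁ * L
        ≈⟨ solve 4 (λ p e u l → (:1 :- p :* e) :* u :* l := u :* (l :- e :* (p :* l))) refl (q ^ k) e₂ u₁ L ⟩
      u₁ * (L - e₂ * (q ^ k * L))
        ≈⟨ *-congˡ (+-cong pascal₁ (-‿cong (*-cong (e-suc (suc k)) pascal₂))) ⟩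
      u₁ * ((W + q ^ suc k * V) - e (suc k) * q * (q ^ n * W + q ^ k * V))
        ≈⟨ solve 7 (λ u w q p v e r → u :* ((w :+ q :* p :* v) :- e :* q :* (r :* w :+ p :* v))
             := u :* w :* (:1 :- r :* (e :* q)) :+ q :* p :* (:1 :- e) :* u :* v) refl u₁ W q (q ^ k) V (e (suc k)) (q ^ n) ⟩
      u₁ * W * (1# - q ^ n * (e (suc k) * q)) + q ^ suc k * (1# - e (suc k)) * u₁ * V
        ≈⟨ +-cong (*-cong (sym W≈) (+-congˡ (-‿cong (trans (*-congˡ (sym (e-suc (suc k)))) (sym eₙ≈))))) (*-congˡ V≈) ⟩
      X * uₙ * (1# - e (suc (suc (n ℕ.+ k)))) + q ^ suc k * (1# - e (suc k)) * u₁ * (u₂ * (Y * γ (suc k)))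
        ≈⟨ +-congʳ (trans (*-assoc _ _ _) (trans (*-congˡ (trans (*-comm _ _) (u-inv _))) (*-identityʳ X))) ⟩
      X + q ^ suc k * (1# - e (suc k)) * u₁ * (u₂ * (Y * γ (suc k)))
        ≈⟨ +-congˡ (solve 6 (λ p e u w y g → p :* (:1 :- e) :* u :* (w :* (y :* g)) := g :* p :* (:1 :- e) :* (u :* w) :* y)
             refl (q ^ suc k) (e (suc k)) u₁ u₂ Y (γ (suc k))) ⟩
      X + ρ e u γ (suc k) * Y ∎
      where
      L = D (u ⁺) γ (suc n) (suc k)
      X = D (u ⁺ ⁺) (γ ⁺) n k
      Y = D (u ⁺ ⁺) (γ ⁺) n (suc k)
      W = D (u ⁺ ⁺ ⁺) (γ ⁺) n k
      V = γ n * u (suc (suc (n ℕ.+ k))) * D (u ⁺) γ n (suc k)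
      e₂ = e (suc (suc k))
      u₁ = u (suc k ℕ.+ suc k)
      u₂ = u (suc (suc k ℕ.+ suc k))
      uₙ = u (suc (suc (n ℕ.+ k)))
      e₁≈ : e (suc k ℕ.+ suc k) ≈ q ^ k * e₂
      e₁≈ = trans (reflexive (≡.cong e (≡.sym (ℕ.+-suc k (suc k))))) (geometric {e} e-suc k (suc (suc k)))
      eₙ≈ : e (suc (suc (n ℕ.+ k))) ≈ q ^ n * e₂
      eₙ≈ = trans (reflexive (≡.cong e (≡.trans (≡.cong suc (≡.sym (ℕ.+-suc n k))) (≡.sym (ℕ.+-suc n (suc k)))))) (geometric {e} e-suc n (suc (suc k)))
      pascal₁ : L ≈ W + q ^ suc k * V
      pascal₁ = +-congˡ (solve 4 (λ p g v d → p :* g :* v :* d := p :* (g :* v :* d)) refl (q ^ suc k) (γ n) _ _)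
      pascal₂ : q ^ k * L ≈ q ^ n * W + q ^ k * V
      pascal₂ = trans (*-congˡ (D-suc (u ⁺) γ n k)) (trans (distribˡ _ _ _) (+-congʳ (sym (D-q^ (u ⁺ ⁺ ⁺) (γ ⁺) n k))))
      W≈ : X * uₙ ≈ u₁ * W
      W≈ = trans (D-v⁺ (u ⁺ ⁺) (γ ⁺) n k) (*-congʳ (reflexive (≡.cong (u ∘ suc) (≡.sym (ℕ.+-suc k k)))))
      V≈ : V ≈ u₂ * (Y * γ (suc k))
      V≈ = begin
        γ n * u (suc (suc (n ℕ.+ k))) * D (u ⁺) γ n (suc k)
          ≈⟨ *-congʳ (*-congˡ (reflexive (≡.cong (u ∘ suc) (≡.sym (ℕ.+-suc n k))))) ⟩
        γ n * u (suc (n ℕ.+ suc k)) * D (u ⁺) γ n (suc k)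
          ≈⟨ solve 3 (λ g v d → g :* v :* d := g :* (d :* v)) refl (γ n) _ _ ⟩
        γ n * (D (u ⁺) γ n (suc k) * u (suc (n ℕ.+ suc k)))
          ≈⟨ *-congˡ (D-v⁺ (u ⁺) γ n (suc k)) ⟩
        γ n * (u₂ * D (u ⁺ ⁺) γ n (suc k))
          ≈⟨ solve 3 (λ g v d → g :* (v :* d) := v :* (g :* d)) refl (γ n) _ _ ⟩
        u₂ * (γ n * D (u ⁺ ⁺) γ n (suc k))
          ≈⟨ *-congˡ (D-⊙γ (u ⁺ ⁺) γ n (suc k)) ⟨
        u₂ * (Y * γ (suc k)) ∎

  -- Below the diagonal every entry contains at least one γ, hence a factor c. With c = dˡ this
  -- controls the truncation error.
  D≡δ : ∀ {c} v (γ g : Sequence) → (∀ i → γ i ≈ c * g i) → ∀ n k → ∃ λ z → D v γ n k ≈ δ n k + c * z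
  D≡δ {c} v γ g γ≈ zero    zero    = 0# , sym (trans (+-congˡ (zeroʳ c)) (+-identityʳ _))
  D≡δ {c} v γ g γ≈ zero    (suc k) = 0# , sym (trans (+-congˡ (zeroʳ c)) (+-identityʳ _))
  D≡δ {c} v γ g γ≈ (suc n) zero    = g n * v n * D v γ n 0 ,
    trans (*-congʳ (*-congʳ (γ≈ n)))
      (solve 4 (λ c g v d → c :* g :* v :* d := con (0 , 0) :+ c :* (g :* v :* d)) refl c (g n) (v n) _)
  D≡δ {c} v γ g γ≈ (suc n) (suc k) with D≡δ (v ⁺ ⁺) (γ ⁺) (g ⁺) (γ≈ ∘ suc) n k
  ... | z , eq = z + q ^ suc k * g n * v′ * D v γ n (suc k) ,
    trans (+-cong eq (*-congʳ (*-congʳ (*-congˡ (γ≈ n)))))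
      (solve 7 (λ x c z p g v y → (x :+ c :* z) :+ p :* (c :* g) :* v :* y
         := x :+ c :* (z :+ p :* g :* v :* y)) refl (δ n k) c z (q ^ suc k) (g n) v′ _)
    where v′ = v (suc (n ℕ.+ k))

-- Finite sums and products

module FiniteSums (A : Ring₀) where
  open CommutativeRing A hiding (zero)
  open SemiringSum semiring

  Σ< : ℕ → (ℕ → Carrier) → Carrier
  Σ< n F = ∑[ i < n ] F (toℕ i)

  Σ<-cong : ∀ n {F G} → (∀ i → F i ≈ G i) → Σ< n F ≈ Σ< n G
  Σ<-cong n F≈G = sum-cong-≋ {n} (λ i → F≈G (toℕ i))

  Σ<-+ : ∀ n F G → Σ< n (λ i → F i + G i) ≈ Σ< n F + Σ< n G
  Σ<-+ n F G = ∑-distrib-+ {n} (λ i → F (toℕ i)) (λ i → G (toℕ i))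

  Σ<-* : ∀ n c F → Σ< n (λ i → c * F i) ≈ c * Σ< n F
  Σ<-* n c F = sym (*-distribˡ-sum {n} c (λ i → F (toℕ i)))

  Σ<-last : ∀ n F → Σ< (suc n) F ≈ Σ< n F + F n
  Σ<-last zero    F = +-comm _ _
  Σ<-last (suc n) F = trans (+-congˡ (Σ<-last n (F ∘ suc))) (sym (+-assoc _ _ _))

  Σ<-zero : ∀ n {F} → (∀ i → F i ≈ 0#) → Σ< n F ≈ 0#
  Σ<-zero n F≈0 = trans (Σ<-cong n F≈0) (sum-replicate-zero n)

module FiniteProducts (A : Ring₀) where
  open CommutativeRing A hiding (zero)
  open SetoidReasoning setoid
  open SemiringExp semiring using (_^_)
  open Units A
  open QSeries A
  open CommutativeRingSolver A

  Π< : ℕ → (ℕ → Carrier) → Carrier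
  Π< zero    F = 1#
  Π< (suc n) F = Π< n F * F n

  Π<-cong : ∀ n {F G} → (∀ i → F i ≈ G i) → Π< n F ≈ Π< n G
  Π<-cong zero    F≈G = refl
  Π<-cong (suc n) F≈G = *-cong (Π<-cong n F≈G) (F≈G n)

  Π<-head : ∀ n F → Π< (suc n) F ≈ F 0 * Π< n (F ∘ suc)
  Π<-head zero    F = *-comm _ _
  Π<-head (suc n) F = trans (*-congʳ (Π<-head n F)) (*-assoc _ _ _)

  qPoch≡Π< : ∀ z q n → qPoch z q n ≡ Π< n (λ i → 1# - z * q ^ i)
  qPoch≡Π< z q zero    = ≡.refl
  qPoch≡Π< z q (suc n) = ≡.cong (_* (1# - z * q ^ n)) (qPoch≡Π< z q n)

  isUnit-qPoch≡Π< : ∀ {z q} (u : ∀ i → IsUnit (1# - z * q ^ i)) n →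
                    proj₁ (isUnit-qPoch u n) ≡ Π< n (λ i → proj₁ (u i))
  isUnit-qPoch≡Π< u zero    = ≡.refl
  isUnit-qPoch≡Π< u (suc n) = ≡.cong (_* proj₁ (u n)) (isUnit-qPoch≡Π< u n)

  isUnit-^≡ : ∀ {x} (u : IsUnit x) n → proj₁ (isUnit-^ u n) ≡ proj₁ u ^ n
  isUnit-^≡ u zero    = ≡.refl
  isUnit-^≡ u (suc n) = ≡.cong (proj₁ u *_) (isUnit-^≡ u n)

  inverse-unique : ∀ {x x′ y y′} → x ≈ x′ → x * y ≈ 1# → x′ * y′ ≈ 1# → y ≈ y′
  inverse-unique {x} {x′} {y} {y′} x≈x′ xy≈1 x′y′≈1 = begin
    y               ≈⟨ *-identityʳ y ⟨
    y * 1#          ≈⟨ *-congˡ (trans (*-congʳ x≈x′) x′y′≈1) ⟨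
    y * (x * y′)    ≈⟨ solve 3 (λ x y z → y :* (x :* z) := x :* y :* z) refl x y y′ ⟩
    x * y * y′      ≈⟨ *-congʳ xy≈1 ⟩
    1# * y′         ≈⟨ *-identityˡ y′ ⟩
    y′              ∎

  ^-inverse : ∀ {x y} → x * y ≈ 1# → ∀ n → x ^ n * y ^ n ≈ 1#
  ^-inverse xy≈1 zero    = *-identityˡ 1#
  ^-inverse {x} {y} xy≈1 (suc n) = trans
    (solve 4 (λ x p y r → x :* p :* (y :* r) := (x :* y) :* (p :* r)) refl x (x ^ n) y (y ^ n))
    (trans (*-cong xy≈1 (^-inverse xy≈1 n)) (*-identityˡ 1#))

  -- Lets the ring solver use a relation s ≈ 1, with cofactor z.
  reduce-by : ∀ {x y z s} → s ≈ 1# → x ≈ y + z * (1# - s) → x ≈ y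
  reduce-by {x} {y} {z} {s} s≈1 eq = trans eq (trans
    (+-congˡ (*-congˡ (trans (+-congˡ (-‿cong s≈1)) (-‿inverseʳ 1#))))
    (trans (+-congˡ (zeroʳ z)) (+-identityʳ y)))

-- Askey-Wilson parameters and the terms of the hypergeometric series

module AskeyWilsonCoefficients {A : Ring₀} (P : AskeyWilsonParameters A) where
  open CommutativeRing A hiding (zero)
  open SetoidReasoning setoid
  open SemiringExp semiring using (_^_)
  open Units A
  open AskeyWilsonParameters P public
  open FiniteProducts A
  open QBinomialTransform A q
  open CommutativeRingSolver A

  a⁻¹ q⁻¹ ½ : Carrier
  a⁻¹ = proj₁ (proj₂ aᵘ)
  q⁻¹ = proj₁ (proj₂ qᵘ)
  ½   = proj₁ isUnit-2

  aa⁻¹ : a * a⁻¹ ≈ 1#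
  aa⁻¹ = proj₂ (proj₂ (proj₂ aᵘ))

  qq⁻¹ : q * q⁻¹ ≈ 1#
  qq⁻¹ = proj₂ (proj₂ (proj₂ qᵘ))

  -- The sequence `e` starts at abcd q⁻¹, so it is `u ⁺`, not `u`, whose terms are 1/(1 - abcd qⁱ).
  e u : ℕ → Carrier
  e n = abcdqⁿ⁻¹ n
  u n = proj₁ (isUnit-abcdqⁿ⁻¹ n 0)

  e-suc : ∀ n → e (suc n) ≈ e n * q
  e-suc zero          = begin
    a * b * c * d * 1#                ≈⟨ *-congˡ (trans (*-congʳ (*-identityʳ q⁻¹)) (trans (*-comm _ _) qq⁻¹)) ⟨
    a * b * c * d * (q⁻¹ * 1# * q)    ≈⟨ *-assoc _ _ _ ⟨
    a * b * c * d * (q⁻¹ * 1#) * q    ∎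
  e-suc (suc n) = trans (*-congˡ (*-comm q (q ^ n))) (sym (*-assoc _ _ _))

  u-inverse : ∀ n → (1# - e n) * u n ≈ 1#
  u-inverse n = trans (*-congʳ (+-congˡ (-‿cong (sym (*-identityʳ (e n)))))) (proj₂ (proj₂ (isUnit-abcdqⁿ⁻¹ n 0)))

  γ : ℕ → Carrier
  γ i = - (a⁻¹ * q⁻¹ ^ i * ½) * (1# - a * b * q ^ i) * (1# - a * c * q ^ i) * (1# - a * d * q ^ i)

  node : ℕ → Carrier
  node i = (a * q ^ i + a⁻¹ * q⁻¹ ^ i) * ½

  q⁻ⁿ : ∀ n → qᵘ ^ᶻ (ℤ.- + n) ≡ q⁻¹ ^ n
  q⁻ⁿ zero    = ≡.refl
  q⁻ⁿ (suc n) = ≡.refl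

  U : ℕ → ℕ → Carrier
  U n i = proj₁ (isUnit-abcdqⁿ⁻¹ n i)

  U≈u : ∀ n i → U n i ≈ u (i ℕ.+ n)
  U≈u n i = inverse-unique
    (+-congˡ (-‿cong (trans (*-comm (e n) (q ^ i)) (sym (geometric {e} e-suc i n)))))
    (proj₂ (proj₂ (isUnit-abcdqⁿ⁻¹ n i))) (u-inverse (i ℕ.+ n))

  [_] : Carrier → ℕ → Carrier
  [ z ] j = 1# - z * q ^ j

  -- Replacing a by aq raises the index in every denominator involving a by one, so the required
  -- units are already available.
  shifted : AskeyWilsonParameters A
  shifted = record
    { aᵘ = a * q , isUnit-* (proj₂ aᵘ) (proj₂ qᵘ)
    ; qᵘ = qᵘ
    ; b  = b
    ; c  = c
    ; d  = d
    ; isUnit-2        = isUnit-2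
    ; isUnit-q        = isUnit-q
    ; isUnit-ab       = λ i → isUnit-resp (aq≈ b i) (isUnit-ab (suc i))
    ; isUnit-ac       = λ i → isUnit-resp (aq≈ c i) (isUnit-ac (suc i))
    ; isUnit-ad       = λ i → isUnit-resp (aq≈ d i) (isUnit-ad (suc i))
    ; isUnit-abcdqⁿ⁻¹ = λ n i → isUnit-resp (+-congˡ (-‿cong
        (solve 7 (λ a b c d q r p → a :* b :* c :* d :* r :* (q :* p) := a :* q :* b :* c :* d :* r :* p)
          refl a b c d q (qᵘ ^ᶻ (+ n ℤ.- + 1)) (q ^ i)))) (isUnit-abcdqⁿ⁻¹ n (suc i))
    }
    where
    aq≈ : ∀ z i → [ a * z ] (suc i) ≈ [ a * q * z ] i
    aq≈ z i = solve 4 (λ a z q p → :1 :- a :* z :* (q :* p) := :1 :- a :* q :* z :* p) refl a z q (q ^ i)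

module AskeyWilsonTerms {A : Ring₀} (P : AskeyWilsonParameters A) (eⁱᶿ : Units.Unit A) where
  open CommutativeRing A hiding (zero)
  open SetoidReasoning setoid
  open SemiringExp semiring using (_^_)
  open Units A
  open QSeries A
  open AskeyWilsonCoefficients P public
  open AskeyWilson P eⁱᶿ public using (x; p)
  open FiniteSums A
  open FiniteProducts A
  open QBinomialTransform A q
  open CommutativeRingSolver A

  Φ : ℕ → Carrier
  Φ n = Π< n (λ i → x - node i)

  -- The length N is independent of n, the terms with n < k being zero, because several Φⱼ are later
  -- combined over one common range.
  HasExpansion : ℕ → ℕ → Set
  HasExpansion n N = Φ n ≈ Σ< N (λ k → D (u ⁺) γ n k * p k)

  private
    E E⁻¹ : Carrier
    E = proj₁ eⁱᶿ
    E⁻¹ = proj₁ (proj₂ eⁱᶿ)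

  prefactor : ℕ → Carrier
  prefactor k = (Π< k [ a * b ] * (Π< k [ a * c ] * Π< k [ a * d ])) * (½ ^ k * a⁻¹ ^ k * Π< k (U k))

  upper : ℕ → ℕ → Carrier
  upper k j = Π< j [ q⁻¹ ^ k ] * Π< j [ e k ]

  basis : ℕ → Carrier
  basis j = Π< j [ a * E ] * Π< j [ a * E⁻¹ ]

  rest : ℕ → Carrier
  rest j = basis j * (Π< j (λ i → proj₁ (isUnit-q i)) * (Π< j (λ i → proj₁ (isUnit-ab i)) *
    (Π< j (λ i → proj₁ (isUnit-ac i)) * Π< j (λ i → proj₁ (isUnit-ad i))))) * q ^ j

  -- The factorisation isolates `upper`, the only part of a summand that depends on both k and j. As
  -- `rest j` is common to all pₖ, contiguous relations reduce to identities for `prefactor` and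
  -- `upper`.
  p-expansion : ∀ k → p k ≈ prefactor k * Σ< (suc k) (λ j → upper k j * rest j)
  p-expansion k = *-cong
    (*-cong
      (trans (*-congˡ (*-congˡ (*-identityʳ _)))
        (reflexive (≡.cong₂ _*_ (poch (a * b) k) (≡.cong₂ _*_ (poch (a * c) k) (poch (a * d) k)))))
      (reflexive (≡.cong₂ _*_ (≡.cong₂ _*_ (isUnit-^≡ isUnit-2 k) (isUnit-^≡ (proj₂ aᵘ) k))
        (isUnit-qPoch≡Π< (isUnit-abcdqⁿ⁻¹ k) k))))
    (Σ<-cong (suc k) summand)
    where
    poch : ∀ z n → qPoch z q n ≡ Π< n [ z ]
    poch z n = qPoch≡Π< z q n
    lower : ∀ {z} (u : ∀ i → IsUnit ([ z ] i)) n → proj₁ (isUnit-qPoch u n) ≡ Π< n (λ i → proj₁ (u i))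
    lower = isUnit-qPoch≡Π<
    summand : ∀ j →
      qPochs (qᵘ ^ᶻ (ℤ.- + k) ∷ e k ∷ a * E ∷ a * (E⁻¹ * 1#) ∷ []) q j
        * (proj₁ (isUnit-qPoch isUnit-q j) * (proj₁ (isUnit-qPoch isUnit-ab j)
          * (proj₁ (isUnit-qPoch isUnit-ac j) * (proj₁ (isUnit-qPoch isUnit-ad j) * 1#)))) * q ^ j
      ≈ upper k j * rest j
    summand j = begin
      qPochs (qᵘ ^ᶻ (ℤ.- + k) ∷ e k ∷ a * E ∷ a * (E⁻¹ * 1#) ∷ []) q j
        * (proj₁ (isUnit-qPoch isUnit-q j) * (proj₁ (isUnit-qPoch isUnit-ab j)
          * (proj₁ (isUnit-qPoch isUnit-ac j) * (proj₁ (isUnit-qPoch isUnit-ad j) * 1#)))) * q ^ j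
        ≈⟨ *-congʳ (*-cong
             (*-cong (reflexive (≡.trans (≡.cong (λ z → qPoch z q j) (q⁻ⁿ k)) (poch (q⁻¹ ^ k) j)))
               (*-cong (reflexive (poch (e k) j)) (*-cong (reflexive (poch (a * E) j)) (*-congʳ
                 (trans (reflexive (poch (a * (E⁻¹ * 1#)) j))
                   (Π<-cong j (λ i → +-congˡ (-‿cong (*-congʳ (*-congˡ (*-identityʳ E⁻¹)))))))))))
             (*-cong (reflexive (lower isUnit-q j)) (*-cong (reflexive (lower isUnit-ab j))
               (*-cong (reflexive (lower isUnit-ac j)) (*-congʳ (reflexive (lower isUnit-ad j))))))) ⟩
      Π< j [ q⁻¹ ^ k ] * (Π< j [ e k ] * (Π< j [ a * E ] * (Π< j [ a * E⁻¹ ] * 1#)))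
        * (Iq * (Iab * (Iac * (Iad * 1#)))) * q ^ j
        ≈⟨ solve 9 (λ a b c d x y z t q → a :* (b :* (c :* (d :* :1))) :* (x :* (y :* (z :* (t :* :1)))) :* q
             := (a :* b) :* ((c :* d) :* (x :* (y :* (z :* t))) :* q)) refl
             (Π< j [ q⁻¹ ^ k ]) (Π< j [ e k ]) (Π< j [ a * E ]) (Π< j [ a * E⁻¹ ]) Iq Iab Iac Iad (q ^ j) ⟩
      upper k j * rest j ∎
      where
      Iq = Π< j (λ i → proj₁ (isUnit-q i))
      Iab = Π< j (λ i → proj₁ (isUnit-ab i))
      Iac = Π< j (λ i → proj₁ (isUnit-ac i))
      Iad = Π< j (λ i → proj₁ (isUnit-ad i))

  p-0 : p 0 ≈ 1#
  p-0 = trans (p-expansion 0)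
    (solve 0 ((:1 :* (:1 :* :1)) :* (:1 :* :1 :* :1) :* ((:1 :* :1) :* ((:1 :* :1) :* (:1 :* (:1 :* (:1 :* :1))) :* :1) :+ con (0 , 0)) := :1) refl)

-- The contiguous relation between the parameters a and aq

module ChristoffelTransform {A : Ring₀} (P : AskeyWilsonParameters A) (eⁱᶿ : Units.Unit A) where
  open CommutativeRing A hiding (zero)
  open SetoidReasoning setoid
  open SemiringExp semiring using (_^_)
  open CommutativeSemiringExp commutativeSemiring using (^-distrib-*)
  open Units A
  open FiniteSums A
  open FiniteProducts A
  open AskeyWilsonTerms P eⁱᶿ
  open QBinomialTransform A q
  open CommutativeRingSolver A
  module S = AskeyWilsonTerms shifted eⁱᶿ

  private
    E E⁻¹ : Carrier
    E = proj₁ eⁱᶿ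
    E⁻¹ = proj₁ (proj₂ eⁱᶿ)

    EE⁻¹ : E * E⁻¹ ≈ 1#
    EE⁻¹ = proj₂ (proj₂ (proj₂ eⁱᶿ))

  e-shifted : ∀ n → S.e n ≈ e (suc n)
  e-shifted n = trans
    (solve 6 (λ a b c d q r → a :* q :* b :* c :* d :* r := a :* b :* c :* d :* r :* q) refl a b c d q (qᵘ ^ᶻ (+ n ℤ.- + 1)))
    (sym (e-suc n))

  u-shifted : ∀ n → S.u n ≈ u (suc n)
  u-shifted n = inverse-unique (+-congˡ (-‿cong (e-shifted n))) (S.u-inverse n) (u-inverse (suc n))

  node-shifted : ∀ i → S.node i ≈ node (suc i)
  node-shifted i = solve 7 (λ a q p a′ q′ p′ h → (a :* q :* p :+ a′ :* q′ :* p′) :* h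
    := (a :* (q :* p) :+ a′ :* (q′ :* p′)) :* h) refl a q (q ^ i) a⁻¹ q⁻¹ (q⁻¹ ^ i) ½

  γ-shifted : ∀ i → S.γ i ≈ γ (suc i)
  γ-shifted i = solve 10 (λ a q p a′ q′ p′ h b c d →
      (:- (a′ :* q′ :* p′ :* h)) :* (:1 :- a :* q :* b :* p) :* (:1 :- a :* q :* c :* p) :* (:1 :- a :* q :* d :* p)
    := (:- (a′ :* (q′ :* p′) :* h)) :* (:1 :- a :* b :* (q :* p)) :* (:1 :- a :* c :* (q :* p)) :* (:1 :- a :* d :* (q :* p)))
    refl a q (q ^ i) a⁻¹ q⁻¹ (q⁻¹ ^ i) ½ b c d

  Φ-shifted : ∀ n → Φ (suc n) ≈ (x - node 0) * S.Φ n
  Φ-shifted n = trans (Π<-head n (λ i → x - node i))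
    (*-congˡ (Π<-cong n (λ i → +-congˡ (-‿cong (sym (node-shifted i))))))

  private
    [aq] : ∀ z i → [ a * z ] (suc i) ≈ S.[ a * q * z ] i
    [aq] z i = solve 4 (λ a z q p → :1 :- a :* z :* (q :* p) := :1 :- a :* q :* z :* p) refl a z q (q ^ i)

    Π<-shifted : ∀ z n → Π< (suc n) [ a * z ] ≈ [ a * z ] 0 * Π< n S.[ a * q * z ]
    Π<-shifted z n = trans (Π<-head n [ a * z ]) (*-congˡ (Π<-cong n ([aq] z)))

    iab iac iad : Carrier
    iab = proj₁ (isUnit-ab 0)
    iac = proj₁ (isUnit-ac 0)
    iad = proj₁ (isUnit-ad 0)

    ratio : Carrier
    ratio = [ a * E ] 0 * [ a * E⁻¹ ] 0 * (iab * (iac * iad)) * q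

    rest-suc : ∀ j → rest (suc j) ≈ ratio * proj₁ (isUnit-q j) * S.rest j
    rest-suc j = trans
      (*-congʳ (*-cong (*-cong (Π<-shifted E j) (Π<-shifted E⁻¹ j))
        (*-congˡ (*-cong (Π<-head j _) (*-cong (Π<-head j _) (Π<-head j _))))))
      (solve 14 (λ z w Z W iq Iq b B c C d D q p →
           ((z :* Z) :* (w :* W)) :* ((Iq :* iq) :* ((b :* B) :* ((c :* C) :* (d :* D)))) :* (q :* p)
        := (z :* w :* (b :* (c :* d)) :* q) :* iq :* ((Z :* W) :* (Iq :* (B :* (C :* D))) :* p)) refl
        ([ a * E ] 0) ([ a * E⁻¹ ] 0) (Π< j S.[ a * q * E ]) (Π< j S.[ a * q * E⁻¹ ])
        (proj₁ (isUnit-q j)) (Π< j (λ i → proj₁ (isUnit-q i)))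
        iab (Π< j (λ i → proj₁ (isUnit-ab (suc i)))) iac (Π< j (λ i → proj₁ (isUnit-ac (suc i))))
        iad (Π< j (λ i → proj₁ (isUnit-ad (suc i)))) q (q ^ j))

    e₂ₖ₊₁ : ∀ k → e (k ℕ.+ suc k) ≈ e k * q * q ^ k
    e₂ₖ₊₁ k = trans (geometric {e} e-suc k (suc k)) (trans (*-comm _ _) (*-congʳ (e-suc k)))

    step : ℕ → Carrier
    step k = q⁻¹ ^ suc k * (1# - e (k ℕ.+ suc k))

    -- Apart from the common factor (q⁻ᵏ, eₖ₊₁; q)ⱼ it is the identity (1 - q⁻ᵏ⁻¹)(1 - eₖqʲ⁺¹) = (1
    -- - qʲ⁻ᵏ)(1 - eₖ) - (1 - qʲ⁺¹) q⁻ᵏ⁻¹ (1 - eₖqᵏ⁺¹). The factor 1 - qʲ⁺¹ will cancel the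
    -- denominator gained in `rest-suc`.
    upper-suc : ∀ k j → upper (suc k) (suc j) ≈ upper k (suc j) - [ q ] j * step k * S.upper k j
    upper-suc k j = begin
      Π< (suc j) [ q⁻¹ ^ suc k ] * Π< (suc j) [ e (suc k) ]
        ≈⟨ *-cong (trans (Π<-head j [ q⁻¹ ^ suc k ]) (*-congˡ (Π<-cong j lowered))) (*-congʳ (Π<-cong j esuc)) ⟩
      ([ q⁻¹ ^ suc k ] 0 * Q) * (F * [ e (suc k) ] j)
        ≈⟨ *-congˡ (*-congˡ (+-congˡ (-‿cong (*-congʳ (e-suc k))))) ⟩
      ([ q⁻¹ ^ suc k ] 0 * Q) * (F * (1# - e k * q * q ^ j))
        ≈⟨ reduce-by (trans (*-comm _ _) qq⁻¹) (reduce-by (^-inverse (trans (*-comm _ _) qq⁻¹) k)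
             (solve 8 (λ q′ r Q F E q p g →
                  ((:1 :- q′ :* r :* :1) :* Q) :* (F :* (:1 :- E :* q :* p))
               := ((Q :* (:1 :- r :* p)) :* ((:1 :- E :* :1) :* F)
                    :- (:1 :- q :* p) :* (q′ :* r :* (:1 :- E :* q :* g)) :* (Q :* F)
                    :+ ((r :* p :- r :* p :* E) :+ (E :- E :* q :* p) :* (r :* g)) :* (Q :* F) :* (:1 :- q′ :* q))
                    :+ (E :- E :* q :* p) :* (Q :* F) :* (:1 :- r :* g))
               refl q⁻¹ (q⁻¹ ^ k) Q F (e k) q (q ^ j) (q ^ k))) ⟩
      (Q * [ q⁻¹ ^ k ] j) * ([ e k ] 0 * F) - [ q ] j * (q⁻¹ ^ suc k * (1# - e k * q * q ^ k)) * (Q * F)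
        ≈⟨ +-cong (*-congˡ (sym (trans (Π<-head j [ e k ]) (*-congˡ (Π<-cong j e≈)))))
             (-‿cong (*-congʳ (*-congˡ (*-congˡ (+-congˡ (-‿cong (sym (e₂ₖ₊₁ k)))))))) ⟩
      upper k (suc j) - [ q ] j * step k * S.upper k j ∎
      where
      Q F : Carrier
      Q = Π< j [ q⁻¹ ^ k ]
      F = Π< j [ S.e k ]
      lowered : ∀ i → [ q⁻¹ ^ suc k ] (suc i) ≈ [ q⁻¹ ^ k ] i
      lowered i = reduce-by {z = q⁻¹ ^ k * q ^ i} qq⁻¹ (solve 4 (λ q′ r q p → :1 :- q′ :* r :* (q :* p)
        := :1 :- r :* p :+ r :* p :* (:1 :- q :* q′)) refl q⁻¹ (q⁻¹ ^ k) q (q ^ i))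
      esuc : ∀ i → [ e (suc k) ] i ≈ [ S.e k ] i
      esuc i = +-congˡ (-‿cong (*-congʳ (sym (e-shifted k))))
      e≈ : ∀ i → [ e k ] (suc i) ≈ [ S.e k ] i
      e≈ i = +-congˡ (-‿cong (trans (sym (*-assoc _ _ _)) (*-congʳ (trans (sym (e-suc k)) (sym (e-shifted k))))))

    upper-vanishes : ∀ k → upper k (suc k) ≈ 0#
    upper-vanishes k = trans (*-congʳ (trans
      (*-congˡ (trans (+-congˡ (-‿cong (^-inverse (trans (*-comm _ _) qq⁻¹) k))) (-‿inverseʳ 1#))) (zeroʳ _))) (zeroˡ _)

    -- The product on the left is uₖ₊₁ ⋯ u₂ₖ₊₁, the one for k is uₖ ⋯ u₂ₖ₋₁; inserting (1 - eₖ) uₖ =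
    -- 1 lets them overlap.
    Π<U-suc : ∀ k → Π< (suc k) (U (suc k)) ≈ (1# - e k) * (u (k ℕ.+ k) * u (suc (k ℕ.+ k))) * Π< k (U k)
    Π<U-suc k = begin
      Π< k (U (suc k)) * U (suc k) k
        ≈⟨ *-cong (sym (*-identityˡ _)) (trans (U≈u (suc k) k) (reflexive (≡.cong u (ℕ.+-suc k k)))) ⟩
      1# * Π< k (U (suc k)) * u (suc (k ℕ.+ k))
        ≈⟨ *-congʳ (*-cong (sym (u-inverse k)) (Π<-cong k (λ i → trans (U≈u (suc k) i) (reflexive (≡.cong u (ℕ.+-suc i k)))))) ⟩
      (1# - e k) * u k * Π< k (λ i → u (suc (i ℕ.+ k))) * u (suc (k ℕ.+ k))
        ≈⟨ *-congʳ (trans (*-assoc _ _ _) (*-congˡ (sym (Π<-head k (λ i → u (i ℕ.+ k)))))) ⟩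
      (1# - e k) * (Π< k (λ i → u (i ℕ.+ k)) * u (k ℕ.+ k)) * u (suc (k ℕ.+ k))
        ≈⟨ *-congʳ (*-congˡ (*-congʳ (Π<-cong k (λ i → sym (U≈u k i))))) ⟩
      (1# - e k) * (Π< k (U k) * u (k ℕ.+ k)) * u (suc (k ℕ.+ k))
        ≈⟨ solve 4 (λ e p v w → e :* (p :* v) :* w := e :* (v :* w) :* p) refl _ _ _ _ ⟩
      (1# - e k) * (u (k ℕ.+ k) * u (suc (k ℕ.+ k))) * Π< k (U k) ∎

    -- This ratio is where ρₖ comes from: it makes the common parts of the two series in
    -- `christoffel` cancel.
    prefactor-suc : ∀ k → prefactor (suc k) ≈ - (ρ e u γ k * prefactor k)
    prefactor-suc k = trans (*-congˡ (*-congˡ (Π<U-suc k)))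
      (reduce-by (^-inverse qq⁻¹ k) (solve 15 (λ B b C c D d h H a′ A v v′ w r p →
           (B :* b :* (C :* c :* (D :* d))) :* (h :* H :* (a′ :* A) :* (v :* v′ :* w))
        := (:- ((:- (a′ :* r :* h)) :* b :* c :* d :* p :* v :* v′ :* (B :* (C :* D) :* (H :* A :* w))))
           :+ (B :* b :* (C :* c :* (D :* d))) :* (h :* H :* (a′ :* A) :* (v :* v′ :* w)) :* (:1 :- p :* r)) refl
        (Π< k [ a * b ]) ([ a * b ] k) (Π< k [ a * c ]) ([ a * c ] k) (Π< k [ a * d ]) ([ a * d ] k)
        ½ (½ ^ k) a⁻¹ (a⁻¹ ^ k) (1# - e k) (u (k ℕ.+ k) * u (suc (k ℕ.+ k))) (Π< k (U k)) (q⁻¹ ^ k) (q ^ k)))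

    -- The first factors of (ae^(iθ); q) and (ae^(-iθ); q) multiply to x - x₀ up to a constant. They
    -- are contained in `ratio`, which is how x - x₀ comes out of the series.
    x-node-0 : x - node 0 ≈ - ([ a * E ] 0 * [ a * E⁻¹ ] 0 * (½ * a⁻¹))
    x-node-0 = reduce-by aa⁻¹ (reduce-by EE⁻¹
      (solve 5 (λ E E′ a a′ h →
           (E :+ E′ :* :1) :* h :- (a :* :1 :+ a′ :* :1) :* h
        := (:- ((:1 :- a :* E :* :1) :* (:1 :- a :* E′ :* :1) :* (h :* a′)) :+ ((E :+ E′) :* h :- a :* h) :* (:1 :- a :* a′))
             :+ (:- (a :* h :* (a :* a′))) :* (:1 :- E :* E′)) refl E E⁻¹ a a⁻¹ ½))

    κ : ℕ → Carrier
    κ k = - (ratio * step k)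

    prefactor-κ : ∀ k → prefactor (suc k) * κ k ≈ (x - node 0) * S.prefactor k
    prefactor-κ k = begin
      prefactor (suc k) * κ k
        ≈⟨ *-congʳ (*-cong (*-cong (Π<-shifted b k) (*-cong (Π<-shifted c k) (Π<-shifted d k)))
             (*-congˡ (*-cong (Π<-cong k (λ i → sym (inverse-unique (U-eq i) (proj₂ (proj₂ (S.isUnit-abcdqⁿ⁻¹ k i))) (proj₂ (proj₂ (isUnit-abcdqⁿ⁻¹ (suc k) i))))))
               (U≈u (suc k) k)))) ⟩
      tb * B * (tc * C * (td * D′)) * (½ * ½ ^ k * (a⁻¹ * a⁻¹ ^ k) * (V * u (k ℕ.+ suc k))) * κ k
        ≈⟨ solve 21 (λ tb B tc C td D h H a′ A V w z z′ ib ic id q q′ r f →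
               tb :* B :* (tc :* C :* (td :* D)) :* (h :* H :* (a′ :* A) :* (V :* w))
                 :* (:- (z :* z′ :* (ib :* (ic :* id)) :* q :* (q′ :* r :* f)))
            := (:- (z :* z′ :* (h :* a′)) :* (B :* (C :* D) :* (H :* (A :* r) :* V)))
                 :* ((tb :* ib) :* ((tc :* ic) :* ((td :* id) :* ((q :* q′) :* (f :* w)))))) refl
             tb B tc C td D′ ½ (½ ^ k) a⁻¹ (a⁻¹ ^ k) V (u (k ℕ.+ suc k)) ([ a * E ] 0) ([ a * E⁻¹ ] 0)
             iab iac iad q q⁻¹ (q⁻¹ ^ k) (1# - e (k ℕ.+ suc k)) ⟩
      (- ([ a * E ] 0 * [ a * E⁻¹ ] 0 * (½ * a⁻¹)) * (B * (C * D′) * (½ ^ k * (a⁻¹ ^ k * q⁻¹ ^ k) * V)))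
        * ((tb * iab) * ((tc * iac) * ((td * iad) * ((q * q⁻¹) * ((1# - e (k ℕ.+ suc k)) * u (k ℕ.+ suc k))))))
        ≈⟨ trans (*-congˡ units) (*-identityʳ _) ⟩
      - ([ a * E ] 0 * [ a * E⁻¹ ] 0 * (½ * a⁻¹)) * (B * (C * D′) * (½ ^ k * (a⁻¹ ^ k * q⁻¹ ^ k) * V))
        ≈⟨ *-cong (sym x-node-0) (*-congˡ (*-congʳ (*-congˡ (sym (^-distrib-* a⁻¹ q⁻¹ k))))) ⟩
      (x - node 0) * S.prefactor k ∎
      where
      tb = [ a * b ] 0
      tc = [ a * c ] 0
      td = [ a * d ] 0
      B = Π< k S.[ a * q * b ]
      C = Π< k S.[ a * q * c ]
      D′ = Π< k S.[ a * q * d ]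
      V = Π< k (S.U k)
      U-eq : ∀ i → S.[ S.e k ] i ≈ [ e (suc k) ] i
      U-eq i = +-congˡ (-‿cong (*-congʳ (e-shifted k)))
      infixr 5 _×₁_
      _×₁_ : ∀ {y z} → y ≈ 1# → z ≈ 1# → y * z ≈ 1#
      p ×₁ q = trans (*-cong p q) (*-identityˡ 1#)
      units : (tb * iab) * ((tc * iac) * ((td * iad) * ((q * q⁻¹) * ((1# - e (k ℕ.+ suc k)) * u (k ℕ.+ suc k))))) ≈ 1#
      units = proj₂ (proj₂ (isUnit-ab 0)) ×₁ proj₂ (proj₂ (isUnit-ac 0)) ×₁ proj₂ (proj₂ (isUnit-ad 0))
        ×₁ qq⁻¹ ×₁ u-inverse (k ℕ.+ suc k)

  -- By `upper-suc` the series of pₖ₊₁ splits into the series of pₖ and a remainder with the index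
  -- lowered by one. The former cancels against ρₖ pₖ by `prefactor-suc`; the latter is the series
  -- for aq, and `prefactor-κ` supplies its constant.
  christoffel : ∀ k → (x - node 0) * S.p k ≈ p (suc k) + ρ e u γ k * p k
  christoffel k = sym (begin
    p (suc k) + ρ e u γ k * p k
      ≈⟨ +-cong (p-expansion (suc k)) (*-congˡ (p-expansion k)) ⟩
    prefactor (suc k) * (upper (suc k) 0 * rest 0 + Σ< (suc k) (λ j → upper (suc k) (suc j) * rest (suc j)))
      + ρ e u γ k * (prefactor k * Σ< (suc k) (λ j → upper k j * rest j))
      ≈⟨ +-cong (*-congˡ (+-congˡ (trans (Σ<-cong (suc k) summand) (Σ<-+ (suc k) (λ j → upper k (suc j) * rest (suc j)) (λ j → κ k * (S.upper k j * S.rest j))))))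
           (trans (sym (*-assoc _ _ _)) (*-congˡ (sym extend))) ⟩
    prefactor (suc k) * (upper k 0 * rest 0 + (T + Σ< (suc k) (λ j → κ k * (S.upper k j * S.rest j))))
      + ρ e u γ k * prefactor k * (upper k 0 * rest 0 + T)
      ≈⟨ solve 5 (λ f x y z r → f :* (x :+ (y :+ z)) :+ r :* (x :+ y) := f :* z :+ (f :+ r) :* (x :+ y)) refl
           (prefactor (suc k)) (upper k 0 * rest 0) T _ (ρ e u γ k * prefactor k) ⟩
    prefactor (suc k) * Σ< (suc k) (λ j → κ k * (S.upper k j * S.rest j))
      + (prefactor (suc k) + ρ e u γ k * prefactor k) * (upper k 0 * rest 0 + T)
      ≈⟨ +-cong (*-congˡ (Σ<-* (suc k) (κ k) (λ j → S.upper k j * S.rest j)))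
           (trans (*-congʳ (trans (+-congʳ (prefactor-suc k)) (-‿inverseˡ _))) (zeroˡ _)) ⟩
    prefactor (suc k) * (κ k * Σ< (suc k) (λ j → S.upper k j * S.rest j)) + 0#
      ≈⟨ trans (+-identityʳ _) (trans (sym (*-assoc _ _ _)) (*-congʳ (prefactor-κ k))) ⟩
    (x - node 0) * S.prefactor k * Σ< (suc k) (λ j → S.upper k j * S.rest j)
      ≈⟨ trans (*-assoc _ _ _) (*-congˡ (sym (S.p-expansion k))) ⟩
    (x - node 0) * S.p k ∎)
    where
    T = Σ< (suc k) (λ j → upper k (suc j) * rest (suc j))
    -- The sum for pₖ is one term shorter than that for pₖ₊₁; it is lengthened by a term containing
    -- (q⁻ᵏ; q)ₖ₊₁ = 0.
    extend : upper k 0 * rest 0 + T ≈ Σ< (suc k) (λ j → upper k j * rest j)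
    extend = trans (Σ<-last (suc k) (λ j → upper k j * rest j))
      (trans (+-congˡ (trans (*-congʳ (upper-vanishes k)) (zeroˡ _))) (+-identityʳ _))
    summand : ∀ j → upper (suc k) (suc j) * rest (suc j)
              ≈ upper k (suc j) * rest (suc j) + κ k * (S.upper k j * S.rest j)
    summand j = begin
      upper (suc k) (suc j) * rest (suc j)
        ≈⟨ *-congʳ (upper-suc k j) ⟩
      (upper k (suc j) - [ q ] j * step k * S.upper k j) * rest (suc j)
        ≈⟨ trans (distribʳ _ _ _) (+-congˡ (*-congˡ (rest-suc j))) ⟩
      upper k (suc j) * rest (suc j) + - ([ q ] j * step k * S.upper k j) * (ratio * proj₁ (isUnit-q j) * S.rest j)
        ≈⟨ +-congˡ (reduce-by (proj₂ (proj₂ (isUnit-q j)))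
             (solve 6 (λ f s u r i R → (:- (f :* s :* u)) :* (r :* i :* R)
               := (:- (r :* s)) :* (u :* R) :+ r :* s :* (u :* R) :* (:1 :- f :* i)) refl
               ([ q ] j) (step k) (S.upper k j) ratio (proj₁ (isUnit-q j)) (S.rest j))) ⟩
      upper k (suc j) * rest (suc j) + κ k * (S.upper k j * S.rest j) ∎

-- Expansion of the products Φₙ into Askey-Wilson polynomials

module AskeyWilsonExpansion {A : Ring₀} (eⁱᶿ : Units.Unit A) where
  open CommutativeRing A hiding (zero)
  open SetoidReasoning setoid
  open FiniteSums A
  open CommutativeRingSolver A

  expansion : ∀ (P : AskeyWilsonParameters A) n N → n ℕ.< N → AskeyWilsonTerms.HasExpansion {A} P eⁱᶿ n N
  expansion P zero (suc N) _ = sym (begin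
    1# * p 0 + Σ< N (λ k → 0# * p (suc k))   ≈⟨ +-cong (trans (*-identityˡ _) p-0) (Σ<-zero N (λ k → zeroˡ (p (suc k)))) ⟩
    1# + 0#                                  ≈⟨ +-identityʳ 1# ⟩
    1#                                       ∎)
    where open AskeyWilsonTerms {A} P eⁱᶿ
  expansion P (suc n) (suc N) (ℕ.s≤s n<N) = begin
    Φ (suc n)
      ≈⟨ Φ-shifted n ⟩
    (x - node 0) * S.Φ n
      ≈⟨ *-congˡ (expansion shifted n N n<N) ⟩
    (x - node 0) * Σ< N (λ k → D (S.u ⁺) S.γ n k * S.p k)
      ≈⟨ Σ<-* N (x - node 0) (λ k → D (S.u ⁺) S.γ n k * S.p k) ⟨
    Σ< N (λ k → (x - node 0) * (D (S.u ⁺) S.γ n k * S.p k))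
      ≈⟨ Σ<-cong N (λ k → trans (solve 3 (λ x y z → x :* (y :* z) := y :* (x :* z)) refl (x - node 0) _ (S.p k))
           (*-cong (D-cong (λ i → u-shifted (suc i)) γ-shifted n k) (christoffel k))) ⟩
    Σ< N (λ k → d⁺ k * (p (suc k) + r k * p k))
      ≈⟨ Σ<-cong N (λ k → solve 4 (λ d x r y → d :* (x :+ r :* y) := d :* x :+ r :* d :* y) refl (d⁺ k) (p (suc k)) (r k) (p k)) ⟩
    Σ< N (λ k → d⁺ k * p (suc k) + r k * d⁺ k * p k)
      ≈⟨ Σ<-+ N (λ k → d⁺ k * p (suc k)) (λ k → r k * d⁺ k * p k) ⟩
    Σ< N (λ k → d⁺ k * p (suc k)) + Σ< N (λ k → r k * d⁺ k * p k)
      -- The term k = N, zero because n < N, is added so that splitting off k = 0 leaves two sums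
      -- over the same pₖ₊₁.
      ≈⟨ +-congˡ (trans (Σ<-last N (λ k → r k * d⁺ k * p k)) (trans (+-congˡ above) (+-identityʳ _))) ⟨
    Σ< N (λ k → d⁺ k * p (suc k)) + (r 0 * d⁺ 0 * p 0 + Σ< N (λ k → r (suc k) * d⁺ (suc k) * p (suc k)))
      ≈⟨ solve 3 (λ x y z → x :+ (y :+ z) := y :+ (x :+ z)) refl _ _ _ ⟩
    r 0 * d⁺ 0 * p 0 + (Σ< N (λ k → d⁺ k * p (suc k)) + Σ< N (λ k → r (suc k) * d⁺ (suc k) * p (suc k)))
      ≈⟨ +-cong (*-congʳ (D-shift-zero e u γ e-suc u-inverse n))
           (trans (Σ<-cong N (λ k → trans (*-congʳ (D-shift-suc e u γ e-suc u-inverse n k)) (distribʳ (p (suc k)) (d⁺ k) _)))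
             (Σ<-+ N (λ k → d⁺ k * p (suc k)) (λ k → r (suc k) * d⁺ (suc k) * p (suc k)))) ⟨
    Σ< (suc N) (λ k → D (u ⁺) γ (suc n) k * p k) ∎
    where
    open AskeyWilsonTerms {A} P eⁱᶿ
    open ChristoffelTransform P eⁱᶿ
    open QBinomialTransform A q
    d⁺ r : ℕ → Carrier
    d⁺ k = D (u ⁺ ⁺) (γ ⁺) n k
    r = ρ e u γ
    above : r N * d⁺ N * p N ≈ 0#
    above = trans (*-congʳ (trans (*-congˡ (D-above (u ⁺ ⁺) (γ ⁺) n<N)) (zeroʳ _))) (zeroˡ _)

-- Transfer matrices of the lecture hall graph

[r+8m]/8≡m : ∀ (r : Fin 8) m → (toℕ r ℕ.+ m ℕ.* 8) / 8 ≡ m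
[r+8m]/8≡m r m = ≡.trans (+-distrib-/-∣ʳ (toℕ r) (n∣m*n m))
  (≡.cong₂ ℕ._+_ (m<n⇒m/n≡0 (Fin.toℕ<n r)) (m*n/n≡m m 8))

[r+8m]mod8≡r : ∀ (r : Fin 8) m → (toℕ r ℕ.+ m ℕ.* 8) mod 8 ≡ r
[r+8m]mod8≡r r m = Fin.toℕ-injective (≡.trans (Fin.toℕ-fromℕ< (m%n<n (toℕ r ℕ.+ m ℕ.* 8) 8))
  (≡.trans ([m+kn]%n≡m%n (toℕ r) m 8) (m<n⇒m%n≡m (Fin.toℕ<n r))))

-- Z w s t j r F sums w(path) F(m) over all paths from (m , t+s+1) down to the
-- vertex with level t and index j in column r + j.
module LatticeWalks (A : Ring₀) where
  open CommutativeRing A hiding (zero)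
  open CommutativeRingSolver A

  Z : (ℕ → ℕ → ℕ → Carrier) → (s t j r : ℕ) → (ℕ → Carrier) → Carrier
  Z w s       t j (suc r) F = Z w s t (suc j) r F + w t (r ℕ.+ j) j * Z w s t j r F
  Z w zero    t j zero    F = F j
  Z w (suc s) t j zero    F = Z w s (suc t) 0 j F

  Z-affine : ∀ w s t j r {F G} c H → (∀ m → F m ≈ G m + c * H m) →
             Z w s t j r F ≈ Z w s t j r G + c * Z w s t j r H
  Z-affine w s       t j (suc r) c H F≈ = trans
    (+-cong (Z-affine w s t (suc j) r c H F≈) (*-congˡ (Z-affine w s t j r c H F≈)))
    (solve 6 (λ x c y w z u → (x :+ c :* y) :+ w :* (z :+ c :* u) := (x :+ w :* z) :+ c :* (y :+ w :* u))
      refl _ c _ _ _ _)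
  Z-affine w zero    t j zero    c H F≈ = F≈ j
  Z-affine w (suc s) t j zero    c H F≈ = Z-affine w s (suc t) 0 j c H F≈

module LectureHallTransfer {A : Ring₀} (P : AskeyWilsonParameters A) where
  open CommutativeRing A hiding (zero)
  open SetoidReasoning setoid
  open SemiringExp semiring using (_^_; ^-congˡ; ^-congʳ; ^-homo-*)
  open Units A
  open AskeyWilsonCoefficients P
  open QBinomialTransform A q
  open FiniteProducts A
  open CommutativeSemiringExp commutativeSemiring using (^-distrib-*)
  open CommutativeRingSolver A
  open LatticeWalks A
  open KroneckerDelta A

  s : ℕ → Carrier
  s i = a * b * c * d * q ^ (2 ℕ.* i)

  cases : ℕ → Vec Carrier 8
  cases i = - (a⁻¹ * q⁻¹ ^ i) ∷ d ∷ c ∷ - (a * c * d * q ^ i) ∷ b ∷ - (a * b * d * q ^ i) ∷ - (a * b * c * q ^ i)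
    ∷ a ^ 2 * b * c * d * q ^ (2 ℕ.* i) ∷ []

  α : ℕ → Sequence
  α t i = s i ^ (t / 8) * lookup (cases i) (t mod 8) * ½

  β : ℕ → Fin 8 → Sequence
  β m r i = s i ^ m * lookup (cases i) r * ½

  α≐β : ∀ m r → α (toℕ r ℕ.+ m ℕ.* 8) ≐ β m r
  α≐β m r i = reflexive (≡.cong₂ (λ m r → s i ^ m * lookup (cases i) r * ½) ([r+8m]/8≡m r m) ([r+8m]mod8≡r r m))

  γ[_] : ℕ → Sequence
  γ[ m ] i = s i ^ m * γ i

  q²ⁱ : ∀ i → q ^ (2 ℕ.* i) ≈ q ^ i * q ^ i
  q²ⁱ i = trans (^-homo-* q i (i ℕ.+ 0)) (*-congˡ (^-congʳ q (ℕ.+-identityʳ i)))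

  -- Case r is case 0 multiplied by -adqⁱ, -acqⁱ, -abqⁱ according to the binary digits 1, 2, 4 of r.
  -- So `𝓛-∘` merges neighbours with y = ad, then pairs with y = ac, then the two halves with y =
  -- ab; the power of `s i` is common to all.
  eight-levels : ∀ m F → 𝓛 (β m 0F) (𝓛 (β m 1F) (𝓛 (β m 2F) (𝓛 (β m 3F) (𝓛 (β m 4F) (𝓛 (β m 5F) (𝓛 (β m 6F) (𝓛 (β m 7F) F)))))))
                         ≐ 𝓛 γ[ m ] F
  eight-levels m F n = begin
    𝓛 (β m 0F) (𝓛 (β m 1F) (𝓛 (β m 2F) (𝓛 (β m 3F) (𝓛 (β m 4F) (𝓛 (β m 5F) (𝓛 (β m 6F) (𝓛 (β m 7F) F))))))) n
      ≈⟨ 𝓛-∘ (β m 0F) (β m 1F) (a * d) _ rel₀₁ n ⟩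
    𝓛 β₀ (𝓛 (β m 2F) (𝓛 (β m 3F) (𝓛 (β m 4F) (𝓛 (β m 5F) (𝓛 (β m 6F) (𝓛 (β m 7F) F)))))) n
      ≈⟨ 𝓛-congʳ (λ n → trans (𝓛-∘ (β m 2F) (β m 3F) (a * d) _ rel₂₃ n)
           (𝓛-congʳ (λ n → trans (𝓛-∘ (β m 4F) (β m 5F) (a * d) _ rel₄₅ n)
             (𝓛-congʳ (𝓛-∘ (β m 6F) (β m 7F) (a * d) F rel₆₇) n)) n)) n ⟩
    𝓛 β₀ (𝓛 β₂ (𝓛 β₄ (𝓛 β₆ F))) n
      ≈⟨ 𝓛-∘ β₀ β₂ (a * c) _ rel₀₂ n ⟩
    𝓛 (β₀ ^⟨1- a * c ⟩) (𝓛 β₄ (𝓛 β₆ F)) n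
      ≈⟨ 𝓛-congʳ (𝓛-∘ β₄ β₆ (a * c) F rel₄₆) n ⟩
    𝓛 (β₀ ^⟨1- a * c ⟩) (𝓛 (β₄ ^⟨1- a * c ⟩) F) n
      ≈⟨ 𝓛-∘ (β₀ ^⟨1- a * c ⟩) (β₄ ^⟨1- a * c ⟩) (a * b) F rel₀₄ n ⟩
    𝓛 ((β₀ ^⟨1- a * c ⟩) ^⟨1- a * b ⟩) F n
      ≈⟨ 𝓛-cong (λ i → solve 8 (λ S p h a b c d q →
           S :* (:- p) :* h :* (:1 :- a :* d :* q) :* (:1 :- a :* c :* q) :* (:1 :- a :* b :* q)
             := S :* ((:- (p :* h)) :* (:1 :- a :* b :* q) :* (:1 :- a :* c :* q) :* (:1 :- a :* d :* q)))
           refl (s i ^ m) (a⁻¹ * q⁻¹ ^ i) ½ a b c d (q ^ i)) (λ _ → refl) n ⟩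
    𝓛 γ[ m ] F n ∎
    where
    β₀ = β m 0F ^⟨1- a * d ⟩
    β₂ = β m 2F ^⟨1- a * d ⟩
    β₄ = β m 4F ^⟨1- a * d ⟩
    β₆ = β m 6F ^⟨1- a * d ⟩

    aa⁻¹qⁱq⁻ⁱ : ∀ i → a * a⁻¹ * (q ^ i * q⁻¹ ^ i) ≈ 1#
    aa⁻¹qⁱq⁻ⁱ i = trans (*-cong aa⁻¹ (^-inverse qq⁻¹ i)) (*-identityˡ 1#)

    rel₀ : ∀ y i → y ≈ - (a * y) * q ^ i * - (a⁻¹ * q⁻¹ ^ i)
    rel₀ y i = reduce-by (aa⁻¹qⁱq⁻ⁱ i) (solve 5 (λ y a q a′ q′ →
      y := (:- (a :* y)) :* q :* (:- (a′ :* q′)) :+ y :* (:1 :- a :* a′ :* (q :* q′))) refl y a (q ^ i) a⁻¹ (q⁻¹ ^ i))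

    scaled : ∀ S {x y z} → x ≈ y * z → S * x * ½ ≈ y * (S * z * ½)
    scaled S {x} {y} {z} x≈ = trans (*-congʳ (*-congˡ x≈))
      (solve 4 (λ S y z h → S :* (y :* z) :* h := y :* (S :* z :* h)) refl S y z ½)

    rel₀₁ : ∀ i → β m 1F i ≈ - (a * d) * q ^ i * β m 0F i
    rel₀₁ i = scaled (s i ^ m) (rel₀ d i)

    rel₂₃ : ∀ i → β m 3F i ≈ - (a * d) * q ^ i * β m 2F i
    rel₂₃ i = scaled (s i ^ m) (solve 4 (λ a c d q → :- (a :* c :* d :* q) := (:- (a :* d)) :* q :* c) refl a c d (q ^ i))

    rel₄₅ : ∀ i → β m 5F i ≈ - (a * d) * q ^ i * β m 4F i
    rel₄₅ i = scaled (s i ^ m) (solve 4 (λ a c d q → :- (a :* c :* d :* q) := (:- (a :* d)) :* q :* c) refl a b d (q ^ i))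

    rel₆₇ : ∀ i → β m 7F i ≈ - (a * d) * q ^ i * β m 6F i
    rel₆₇ i = scaled (s i ^ m) (trans (*-congˡ (q²ⁱ i)) (solve 5 (λ a b c d q →
      a :* (a :* :1) :* b :* c :* d :* (q :* q) := (:- (a :* d)) :* q :* (:- (a :* b :* c :* q))) refl a b c d (q ^ i)))

    rel₀₂ : ∀ i → β₂ i ≈ - (a * c) * q ^ i * β₀ i
    rel₀₂ i = trans (*-congʳ (scaled (s i ^ m) (rel₀ c i))) (*-assoc _ _ _)

    rel₄₆ : ∀ i → β₆ i ≈ - (a * c) * q ^ i * β₄ i
    rel₄₆ i = trans (*-congʳ (scaled (s i ^ m) (solve 4 (λ a b c q → :- (a :* b :* c :* q) := (:- (a :* c)) :* q :* b)
      refl a b c (q ^ i)))) (*-assoc _ _ _)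

    rel₀₄ : ∀ i → (β₄ ^⟨1- a * c ⟩) i ≈ - (a * b) * q ^ i * (β₀ ^⟨1- a * c ⟩) i
    rel₀₄ i = trans (*-congʳ (*-congʳ (scaled (s i ^ m) (rel₀ b i))))
      (solve 4 (λ x y z t → x :* y :* z :* t := x :* (y :* z :* t)) refl _ _ _ _)

  G : (n t : ℕ) → Sequence → Sequence
  G zero    t F = F
  G (suc n) t F = 𝓛 (α t) (G n (suc t) F)

  G-eight : ∀ n m F → G (8 ℕ.+ n) (m ℕ.* 8) F ≐ 𝓛 γ[ m ] (G n (suc m ℕ.* 8) F)
  G-eight n m F i = trans
    (𝓛-cong (α≐β m 0F) (𝓛-cong (α≐β m 1F) (𝓛-cong (α≐β m 2F) (𝓛-cong (α≐β m 3F)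
      (𝓛-cong (α≐β m 4F) (𝓛-cong (α≐β m 5F) (𝓛-cong (α≐β m 6F) (𝓛-cong (α≐β m 7F) (λ _ → refl)))))))) i)
    (eight-levels m (G n (suc m ℕ.* 8) F) i)

  u-inverts : Inverts (a * b * c * d) (u ⁺)
  u-inverts i = u-inverse (suc i)

  -- Column k of the expected product of all the levels `α t` with t ≥ 8m. As boundary data it lets
  -- finitely many levels telescope without error.
  Ψ : ℕ → ℕ → Sequence
  Ψ m k n = D (u ⁺) γ[ m ] n k

  -- Passing from m to m + 1 multiplies the weights by abcdq²ⁱ, that is by `scale E` with E = abcd,
  -- and leaves the denominators alone; hence `𝓛-D`.
  𝓛-Ψ : ∀ m k → 𝓛 γ[ m ] (Ψ (suc m) k) ≐ Ψ m k
  𝓛-Ψ m k n = trans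
    (𝓛-congʳ (λ i → D-cong (λ _ → refl) (λ j → trans
      (*-assoc _ _ _) (*-congʳ (*-congˡ (q²ⁱ j)))) i k) n)
    (𝓛-D n k γ[ m ] u-inverts)

  G-Ψ : ∀ l m k → G (l ℕ.* 8) (m ℕ.* 8) (Ψ (l ℕ.+ m) k) ≐ Ψ m k
  G-Ψ zero    m k n = refl
  G-Ψ (suc l) m k n = begin
    G (8 ℕ.+ l ℕ.* 8) (m ℕ.* 8) (Ψ (suc l ℕ.+ m) k) n
      ≈⟨ G-eight (l ℕ.* 8) m (Ψ (suc l ℕ.+ m) k) n ⟩
    𝓛 γ[ m ] (G (l ℕ.* 8) (suc m ℕ.* 8) (Ψ (suc l ℕ.+ m) k)) n
      ≡⟨ ≡.cong (λ h → 𝓛 γ[ m ] (G (l ℕ.* 8) (suc m ℕ.* 8) (Ψ h k)) n) (≡.sym (ℕ.+-suc l m)) ⟩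
    𝓛 γ[ m ] (G (l ℕ.* 8) (suc m ℕ.* 8) (Ψ (l ℕ.+ suc m) k)) n
      ≈⟨ 𝓛-congʳ (G-Ψ l (suc m) k) n ⟩
    𝓛 γ[ m ] (Ψ (suc m) k) n
      ≈⟨ 𝓛-Ψ m k n ⟩
    Ψ m k n ∎

  s^ : ∀ l i → s i ^ l ≈ d ^ l * (a * b * c * q ^ (2 ℕ.* i)) ^ l
  s^ l i = trans
    (^-congˡ l (solve 5 (λ a b c d p → a :* b :* c :* d :* p := d :* (a :* b :* c :* p)) refl a b c d (q ^ (2 ℕ.* i))))
    (^-distrib-* d (a * b * c * q ^ (2 ℕ.* i)) l)

  Ψ≡δ : ∀ l k n → ∃ λ z → Ψ l k n ≈ δ n k + d ^ l * z
  Ψ≡δ l k n = D≡δ (u ⁺) γ[ l ] (λ i → (a * b * c * q ^ (2 ℕ.* i)) ^ l * γ i)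
    (λ i → trans (*-congʳ (s^ l i)) (*-assoc _ _ _)) n k

  α-high : ∀ l t i → ∃ λ z → α (l ℕ.* 8 ℕ.+ t) i ≈ d ^ l * z
  α-high l t i = _ , trans
    (*-congʳ (*-congʳ (trans (^-congʳ (s i) [l*8+t]/8) (trans (^-homo-* (s i) l (t / 8)) (*-congʳ (s^ l i))))))
    (solve 5 (λ x y z w h → x :* y :* z :* w :* h := x :* (y :* z :* w :* h)) refl _ _ _ _ _)
    where
    [l*8+t]/8 : (l ℕ.* 8 ℕ.+ t) / 8 ≡ l ℕ.+ t / 8
    [l*8+t]/8 = ≡.trans (+-distrib-/-∣ˡ t (n∣m*n l)) (≡.cong (ℕ._+ t / 8) (m*n/n≡m l 8))

  BottomWeights UpperWeights : ((t i : ℕ) → Fin (suc i) → Carrier) → Set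
  BottomWeights w = ∀ i j → w 0 i j ≈ node (toℕ j)
  UpperWeights  w = ∀ t i j → w (suc t) i j ≈ q ^ toℕ j * α t i

  BottomFormula : Units.Unit A → Set
  BottomFormula 2ᵘ = ∀ (i : ℕ) (j : Fin (suc i)) →
    (a * q ^ toℕ j + aᵘ ^ᶻ -[1+ 0 ] * qᵘ ^ᶻ (ℤ.- + toℕ j)) ÷ 2ᵘ ≈ node (toℕ j)

  bottom-formula : ∀ 2ᵘ → proj₁ (proj₂ 2ᵘ) ≈ ½ → BottomFormula 2ᵘ
  bottom-formula 2ᵘ 2⁻¹≈½ i j = *-cong (+-congˡ (*-cong (*-identityʳ a⁻¹) (reflexive (q⁻ⁿ (toℕ j))))) 2⁻¹≈½

  -- In MixedMoments.w̃ the function lookup occurs with an unfolded type argument;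
  -- taking it as a parameter makes this formula literally equal to that of w̃.
  UpperFormula : Units.Unit A → (∀ {n} → Vec Carrier n → Fin n → Carrier) → Set
  UpperFormula 2ᵘ look = ∀ t i (j : Fin (suc i)) → (a * b * c * d * q ^ (2 ℕ.* i)) ^ (t / 8) * q ^ toℕ j * look
    ( - (aᵘ ^ᶻ -[1+ 0 ] * qᵘ ^ᶻ (ℤ.- + i))
    ∷ d
    ∷ c
    ∷ - (a * c * d * q ^ i)
    ∷ b
    ∷ - (a * b * d * q ^ i)
    ∷ - (a * b * c * q ^ i)
    ∷ a ^ 2 * b * c * d * q ^ (2 ℕ.* i)
    ∷ []) (t mod 8) ÷ 2ᵘ ≈ q ^ toℕ j * α t i

  upper-formula : ∀ 2ᵘ → proj₁ (proj₂ 2ᵘ) ≈ ½ → ∀ (look : ∀ {n} → Vec Carrier n → Fin n → Carrier) →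
    (∀ {n} (xs : Vec Carrier n) r → look xs r ≡ lookup xs r) → UpperFormula 2ᵘ look
  upper-formula 2ᵘ 2⁻¹≈½ look look≡ t i j = trans
    (*-cong (*-congˡ (trans (reflexive (look≡ _ (t mod 8))) (lookup≈ (t mod 8)))) 2⁻¹≈½)
    (solve 4 (λ x y z h → x :* y :* z :* h := y :* (x :* z :* h)) refl _ (q ^ toℕ j) _ ½)
    where
    lookup≈ : ∀ r → lookup (- (aᵘ ^ᶻ -[1+ 0 ] * qᵘ ^ᶻ (ℤ.- + i)) ∷ Vec.tail (cases i)) r ≈ lookup (cases i) r
    lookup≈ zero    = -‿cong (*-cong (*-identityʳ a⁻¹) (reflexive (q⁻ⁿ i)))
    lookup≈ (suc r) = refl

  module _ (w : ℕ → ℕ → ℕ → Carrier) (w≈ : ∀ t r j → w (suc t) (r ℕ.+ j) j ≈ q ^ j * α t (r ℕ.+ j)) where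

    -- Along index j the weights in column i + j are qʲ αᵢ₊ⱼ, and raising j by one changes this
    -- sequence into `q · γ ⁺`. So the choice between going up and going west is exactly the
    -- recursion of 𝓛.
    Z-𝓛 : ∀ n t j r F → Z w n (suc t) j r F
          ≈ 𝓛 (λ i → q ^ j * α t (i ℕ.+ j)) (λ i → G n (suc t) F (i ℕ.+ j)) r
    Z-𝓛 zero    t j zero    F = refl
    Z-𝓛 (suc n) t j zero    F = trans (Z-𝓛 n (suc t) 0 j F)
      (𝓛-cong (λ i → trans (*-identityˡ _) (reflexive (≡.cong (α (suc t)) (ℕ.+-identityʳ i))))
        (λ i → reflexive (≡.cong (G n (suc (suc t)) F) (ℕ.+-identityʳ i))) j)
    Z-𝓛 n       t j (suc r) F = +-cong
      (trans (Z-𝓛 n t (suc j) r F) (𝓛-cong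
        (λ i → trans (*-congˡ (reflexive (≡.cong (α t) (ℕ.+-suc i j)))) (*-assoc _ _ _))
        (λ i → reflexive (≡.cong (G n (suc t) F) (ℕ.+-suc i j))) r))
      (*-cong (w≈ t r j) (Z-𝓛 n t j r F))

    Z-bottom : ∀ n j F → Z w n 0 j 0 F ≈ G n 0 F j
    Z-bottom zero    j F = refl
    Z-bottom (suc n) j F = trans (Z-𝓛 n 0 0 j F)
      (𝓛-cong (λ i → trans (*-identityˡ _) (reflexive (≡.cong (α 0) (ℕ.+-identityʳ i))))
        (λ i → reflexive (≡.cong (G n 1 F) (ℕ.+-identityʳ i))) j)

    Z-Ψ : ∀ l k j → Z w (l ℕ.* 8) 0 j 0 (Ψ l k) ≈ D (u ⁺) γ j k
    Z-Ψ l k j = begin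
      Z w (l ℕ.* 8) 0 j 0 (Ψ l k)           ≈⟨ Z-bottom (l ℕ.* 8) j (Ψ l k) ⟩
      G (l ℕ.* 8) 0 (Ψ l k) j               ≡⟨ ≡.cong (λ h → G (l ℕ.* 8) 0 (Ψ h k) j) (≡.sym (ℕ.+-identityʳ l)) ⟩
      G (l ℕ.* 8) 0 (Ψ (l ℕ.+ 0) k) j       ≈⟨ G-Ψ l 0 k j ⟩
      Ψ 0 k j                               ≈⟨ D-cong (λ _ → refl) (λ i → *-identityˡ (γ i)) j k ⟩
      D (u ⁺) γ j k                         ∎

    Z-Ψ≡Z-δ : ∀ l k n → ∃ λ z → Z w (l ℕ.* 8) 0 0 n (Ψ l k) ≈ Z w (l ℕ.* 8) 0 0 n (λ m → δ m k) + d ^ l * z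
    Z-Ψ≡Z-δ l k n = _ , Z-affine w (l ℕ.* 8) 0 0 n (d ^ l) (λ m → proj₁ (Ψ≡δ l k m)) (λ m → proj₂ (Ψ≡δ l k m))

-- Infinite paths and their finite descriptions

module LectureHallPaths where

  -- Being total, it spares every vertex a proof of j ≤ i; in `V (r ℕ.+ j) t j` the bound always
  -- holds.
  clamp : (i j : ℕ) → Fin (suc i)
  clamp i       zero    = zero
  clamp zero    (suc j) = zero
  clamp (suc i) (suc j) = suc (clamp i j)

  -- v^t_{i,j}; a junk value for j > i.
  V : (i t j : ℕ) → Vertex
  V i t j = vertex i t (clamp i j)

  toℕ-clamp : ∀ r j → toℕ (clamp (r ℕ.+ j) j) ≡ j
  toℕ-clamp r zero    = ≡.refl
  toℕ-clamp r (suc j) = ≡.trans (≡.cong (λ i → toℕ (clamp i (suc j))) (ℕ.+-suc r j)) (≡.cong suc (toℕ-clamp r j))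

  clamp-inject₁ : ∀ r j → clamp (suc (r ℕ.+ j)) j ≡ inject₁ (clamp (r ℕ.+ j) j)
  clamp-inject₁ r zero    = ≡.refl
  clamp-inject₁ r (suc j) = ≡.subst (λ i → clamp (suc i) (suc j) ≡ inject₁ (clamp i (suc j))) (≡.sym (ℕ.+-suc r j))
    (≡.cong suc (clamp-inject₁ r j))

  clamp-top : ∀ j → clamp j j ≡ fromℕ j
  clamp-top zero    = ≡.refl
  clamp-top (suc j) = ≡.cong suc (clamp-top j)

  above east : Vertex → Vertex
  above v = v[ level v , column v , suc (index v) ]
  east u = vertex (suc (column u)) (level u) (inject₁ (index u))

  v-fromℕ : ∀ t i → v[ t , i , fromℕ (suc i) ] ≡ vertex i (suc t) zero
  v-fromℕ t i rewrite view-fromℕ (suc i) = ≡.refl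

  v-inject₁ : ∀ t i j → v[ t , i , inject₁ j ] ≡ vertex i t j
  v-inject₁ t i j rewrite view-inject₁ j = ≡.refl

  above-top : ∀ t j → above (V j t j) ≡ V (j ℕ.+ 0) (suc t) 0
  above-top t j = ≡.trans (≡.cong (λ f → v[ t , j , suc f ]) (clamp-top j))
    (≡.trans (v-fromℕ t j) (≡.cong (λ i → V i (suc t) 0) (≡.sym (ℕ.+-identityʳ j))))

  above-V : ∀ t r j → above (V (suc (r ℕ.+ j)) t j) ≡ V (r ℕ.+ suc j) t (suc j)
  above-V t r j = ≡.trans (≡.cong (λ f → v[ t , suc (r ℕ.+ j) , suc f ]) (clamp-inject₁ r j))
    (≡.trans (v-inject₁ t (suc (r ℕ.+ j)) (suc (clamp (r ℕ.+ j) j)))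
      (≡.cong (λ i → V i t (suc j)) (≡.sym (ℕ.+-suc r j))))

  east-V : ∀ t r j → V (suc (r ℕ.+ j)) t j ≡ east (V (r ℕ.+ j) t j)
  east-V t r j = ≡.cong (vertex (suc (r ℕ.+ j)) t) (clamp-inject₁ r j)

  westOf : Vertex → Vertex
  westOf (vertex zero    t j) = vertex zero t j
  westOf (vertex (suc i) t j) with view j
  ... | ‵fromℕ      = vertex (suc i) t j
  ... | ‵inject₁ j′ = vertex i t j′

  westOf-east : ∀ u → westOf (east u) ≡ u
  westOf-east u rewrite view-inject₁ (index u) = ≡.refl

  east-injective : ∀ {u u′} → east u ≡ east u′ → u ≡ u′
  east-injective {u} {u′} eq = ≡.trans (≡.sym (westOf-east u)) (≡.trans (≡.cong westOf eq) (westOf-east u′))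

  -- An east step keeps the index and enlarges the column, so it never ends where index and column
  -- agree. Read upwards, a path can leave the top of a level only vertically.
  V-top≢east : ∀ t j u → V j t j ≢ east u
  V-top≢east t j u eq = ℕ.<-irrefl index≡ (ℕ.<-≤-trans (≡.subst (ℕ._< suc (column u)) (≡.sym (Fin.toℕ-inject₁ (index u)))
      (Fin.toℕ<n (index u))) (ℕ.≤-reflexive (≡.sym (≡.cong column eq))))
    where
    index≡ : toℕ (inject₁ (index u)) ≡ j
    index≡ = ≡.trans (≡.sym (≡.cong (λ v → toℕ (index v)) eq)) (toℕ-clamp 0 j)

  column-v : ∀ t i j → column v[ t , i , j ] ≡ i
  column-v t i j with view j
  ... | ‵fromℕ     = ≡.refl
  ... | ‵inject₁ _ = ≡.refl

  column-above : ∀ v → column (above v) ≡ column v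
  column-above v = column-v (level v) (column v) (suc (index v))

  level-v : ∀ t i j → t ℕ.≤ level v[ t , i , j ]
  level-v t i j with view j
  ... | ‵fromℕ     = ℕ.n≤1+n t
  ... | ‵inject₁ _ = ℕ.≤-refl

  -- In column i the height t + j/(i+1) is scaled by i+1.
  height : Vertex → ℕ
  height v = level v ℕ.* suc (column v) ℕ.+ toℕ (index v)

  height-v : ∀ t i j → height v[ t , i , j ] ≡ t ℕ.* suc i ℕ.+ toℕ j
  height-v t i j with view j
  ... | ‵fromℕ      = ≡.trans (ℕ.+-identityʳ _) (≡.trans (ℕ.+-comm (suc i) (t ℕ.* suc i))
    (≡.cong (t ℕ.* suc i ℕ.+_) (≡.sym (Fin.toℕ-fromℕ (suc i)))))
  ... | ‵inject₁ j′ = ≡.cong (t ℕ.* suc i ℕ.+_) (≡.sym (Fin.toℕ-inject₁ j′))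

  ascend : ℕ → Vertex → Vertex
  ascend zero    v = v
  ascend (suc m) v = above (ascend m v)

  column-ascend : ∀ m v → column (ascend m v) ≡ column v
  column-ascend zero    v = ≡.refl
  column-ascend (suc m) v = ≡.trans (column-above (ascend m v)) (column-ascend m v)

  height-ascend : ∀ m v → m ℕ.≤ height (ascend m v)
  height-ascend zero    v = z≤n
  height-ascend (suc m) v = ℕ.≤-trans (s≤s (height-ascend m v)) (ℕ.≤-reflexive (≡.sym (≡.trans
    (height-v (level u) (column u) (suc (index u))) (ℕ.+-suc _ _))))
    where u = ascend m v

  level-ascend : ∀ H m v → H ℕ.* suc (column v) ℕ.≤ m → H ℕ.≤ level (ascend m v)
  level-ascend H m v le = ℕ.≤-pred (ℕ.*-cancelʳ-< (suc i) H (suc (level u)) (begin-strict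
    H ℕ.* suc i                                  ≤⟨ ≡.subst (λ i → H ℕ.* suc i ℕ.≤ m) (≡.sym (column-ascend m v)) le ⟩
    m                                            ≤⟨ height-ascend m v ⟩
    level u ℕ.* suc i ℕ.+ toℕ (index u)          <⟨ ℕ.+-monoʳ-< (level u ℕ.* suc i) (Fin.toℕ<n (index u)) ⟩
    level u ℕ.* suc i ℕ.+ suc i                  ≡⟨ ℕ.+-comm (level u ℕ.* suc i) (suc i) ⟩
    suc (level u) ℕ.* suc i                      ∎))
    where
    open ℕ.≤-Reasoning
    u = ascend m v
    i = column u

  Step : Vertex → Vertex → Set
  Step u v = IsSouthStep u v ⊎ IsEastStep u v

  -- The finite data of a path to the vertex (r + j, t, j), read upwards, that
  -- has no east steps above level t + s and then stays in column k.
  data Walk (k : ℕ) : (s t j r : ℕ) → Set where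
    top   : ∀ {t} → Walk k zero t k zero
    climb : ∀ {s t j} → Walk k s (suc t) 0 j → Walk k (suc s) t j zero
    up    : ∀ {s t j r} → Walk k s t (suc j) r → Walk k s t j (suc r)
    west  : ∀ {s t j r} → Walk k s t j r → Walk k s t j (suc r)

  module _ {k : ℕ} where

    at : ∀ {s t j r} → Walk k s t j r → ℕ → Vertex
    at {t = t} top            m       = ascend m (V k t k)
    at {t = t} {j} (climb ω)  zero    = V j t j
    at (climb ω)              (suc m) = at ω m
    at {t = t} {j} {r} (up ω) zero    = V (r ℕ.+ j) t j
    at (up ω)                 (suc m) = at ω m
    at {t = t} {j} {r} (west ω) zero  = V (r ℕ.+ j) t j
    at (west ω)               (suc m) = at ω m

    at-0 : ∀ {s t j r} (ω : Walk k s t j r) → at ω 0 ≡ V (r ℕ.+ j) t j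
    at-0 top       = ≡.refl
    at-0 (climb ω) = ≡.refl
    at-0 (up ω)    = ≡.refl
    at-0 (west ω)  = ≡.refl

    step : ∀ {s t j r} (ω : Walk k s t j r) m → Step (at ω (suc m)) (at ω m)
    step top                        m       = inj₁ ≡.refl
    step {t = t} {j} (climb ω)      zero    = inj₁ (≡.trans (at-0 ω) (≡.sym (above-top t j)))
    step (climb ω)                  (suc m) = step ω m
    step {t = t} {j} {suc r} (up ω) zero    = inj₁ (≡.trans (at-0 ω) (≡.sym (above-V t r j)))
    step (up ω)                     (suc m) = step ω m
    step {t = t} {j} {suc r} (west ω) zero  = inj₂ (≡.trans (east-V t r j) (≡.cong east (≡.sym (at-0 ω))))
    step (west ω)                   (suc m) = step ω m

    length : ∀ {s t j r} → Walk k s t j r → ℕ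
    length top       = zero
    length (climb ω) = suc (length ω)
    length (up ω)    = suc (length ω)
    length (west ω)  = suc (length ω)

    column-limit : ∀ {s t j r} (ω : Walk k s t j r) m → length ω ℕ.≤ m → column (at ω m) ≡ k
    column-limit {t = t} top m       _         = column-ascend m (V k t k)
    column-limit (climb ω)   (suc m) (s≤s le)  = column-limit ω m le
    column-limit (up ω)      (suc m) (s≤s le)  = column-limit ω m le
    column-limit (west ω)    (suc m) (s≤s le)  = column-limit ω m le

    delay : {P : ℕ → Set} → (∃ λ M → ∀ m → M ℕ.≤ m → P m) → {Q : ℕ → Set} → (∀ m → P m → Q (suc m)) →
            ∃ λ M → ∀ m → M ℕ.≤ m → Q m
    delay (M , p) f = suc M , λ { (suc m) (s≤s le) → f m (p m le) }

    height-limit : ∀ {s t j r} (ω : Walk k s t j r) H → ∃ λ M → ∀ m → M ℕ.≤ m → H ℕ.≤ level (at ω m)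
    height-limit {t = t} top H = H ℕ.* suc k , λ m → level-ascend H m (V k t k)
    height-limit (climb ω)   H = delay (height-limit ω H) (λ _ p → p)
    height-limit (up ω)      H = delay (height-limit ω H) (λ _ p → p)
    height-limit (west ω)    H = delay (height-limit ω H) (λ _ p → p)

    toPath : ∀ {s n} → Walk k s 0 0 n → SE k n
    toPath {n = n} ω = record
      { at           = at ω
      ; end          = ≡.trans (at-0 ω) (≡.cong (λ i → V i 0 0) (ℕ.+-identityʳ n))
      ; step         = step ω
      ; column-limit = length ω , column-limit ω
      ; height-limit = height-limit ω
      }

    -- Only `up` and `west` compete at the same indices, and they lead to different columns. This
    -- makes the paths in the final list distinct.
    at-injective : ∀ {s t j r} (ω ω′ : Walk k s t j r) → (∀ m → at ω m ≡ at ω′ m) → ω ≡ ω′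
    at-injective top       top        eq = ≡.refl
    at-injective (climb ω) (climb ω′) eq = ≡.cong climb (at-injective ω ω′ (λ m → eq (suc m)))
    at-injective (up ω)    (up ω′)    eq = ≡.cong up (at-injective ω ω′ (λ m → eq (suc m)))
    at-injective (west ω)  (west ω′)  eq = ≡.cong west (at-injective ω ω′ (λ m → eq (suc m)))
    at-injective {j = j} {suc r} (up ω) (west ω′) eq = contradiction
      (≡.trans (≡.sym (ℕ.+-suc r j)) (≡.cong column (≡.trans (≡.sym (at-0 ω)) (≡.trans (eq 1) (at-0 ω′)))))
      ℕ.1+n≢n
    at-injective {j = j} {suc r} (west ω) (up ω′) eq = contradiction
      (≡.trans (≡.sym (ℕ.+-suc r j)) (≡.cong column (≡.trans (≡.sym (at-0 ω′)) (≡.trans (≡.sym (eq 1)) (at-0 ω)))))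
      ℕ.1+n≢n

    walks : ∀ s t j r → List (Walk k s t j r)
    walks s       t j (suc r) = map up (walks s t (suc j) r) ++ map west (walks s t j r)
    walks zero    t j zero with j ℕ.≟ k
    ... | yes ≡.refl = top ∷ []
    ... | no  _      = []
    walks (suc s) t j zero    = map climb (walks s (suc t) 0 j)

    walks-complete : ∀ {s t j r} (ω : Walk k s t j r) → ω ∈ walks s t j r
    walks-complete top with k ℕ.≟ k
    ... | yes ≡.refl = here ≡.refl
    ... | no  k≢k    = contradiction ≡.refl k≢k
    walks-complete (climb ω) = ∈-map⁺ climb (walks-complete ω)
    walks-complete (up ω)    = ∈-++⁺ˡ (∈-map⁺ up (walks-complete ω))
    walks-complete (west {s} {t} {j} {r} ω) = ∈-++⁺ʳ (map up (walks s t (suc j) r)) (∈-map⁺ west (walks-complete ω))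

    walks-unique : ∀ s t j r → UniquePropositional.Unique (walks s t j r)
    walks-unique zero    t j zero with j ℕ.≟ k
    ... | yes ≡.refl = [] ∷ []
    ... | no  _      = []
    walks-unique (suc s) t j zero    = Unique.map⁺ (λ { ≡.refl → ≡.refl }) (walks-unique s (suc t) 0 j)
    walks-unique s       t j (suc r) = Unique.++⁺ (Unique.map⁺ (λ { ≡.refl → ≡.refl }) (walks-unique s t (suc j) r))
      (Unique.map⁺ (λ { ≡.refl → ≡.refl }) (walks-unique s t j r)) up≢west
      where
      up≢west : ∀ {ω} → ω ∈ map up (walks s t (suc j) r) × ω ∈ map west (walks s t j r) → ⊥
      up≢west (p , q) with ∈-map⁻ up p | ∈-map⁻ west q
      ... | _ , _ , ≡.refl | _ , _ , ()

    module _ {n : ℕ} (p : SE k n) where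
      private
        module p = SE p
        M : ℕ
        M = proj₁ p.column-limit

      column-step : ∀ m → column (p.at (suc m)) ℕ.≤ column (p.at m)
      column-step m with p.step m
      ... | inj₁ south = ℕ.≤-reflexive (≡.trans (≡.cong column south) (column-above (p.at m)))
      ... | inj₂ east  = ℕ.≤-trans (ℕ.n≤1+n _) (ℕ.≤-reflexive (≡.sym (≡.cong column east)))

      column-≥ : ∀ d m → M ℕ.≤ d ℕ.+ m → k ℕ.≤ column (p.at m)
      column-≥ zero    m le = ℕ.≤-reflexive (≡.sym (proj₂ p.column-limit m le))
      column-≥ (suc d) m le = ℕ.≤-trans (column-≥ d (suc m) (≡.subst (M ℕ.≤_) (≡.sym (ℕ.+-suc d m)) le)) (column-step m)

      -- A further east step, read upwards, would lead to a column below k, whereas columns never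
      -- increase upwards and end at k.
      stays : ∀ {m₀} → column (p.at m₀) ≡ k → ∀ m → p.at (m ℕ.+ m₀) ≡ ascend m (p.at m₀)
      stays             column≡k zero    = ≡.refl
      stays {m₀ = m₀} column≡k (suc m) with stays column≡k m | p.step (m ℕ.+ m₀)
      ... | ih | inj₁ south = ≡.trans south (≡.cong above ih)
      ... | ih | inj₂ east  = contradiction (column-≥ M (suc (m ℕ.+ m₀)) (ℕ.m≤m+n M _)) (ℕ.<⇒≱ (ℕ.≤-reflexive (≡.trans
        (≡.sym (≡.cong column east)) (≡.trans (≡.cong column ih) (≡.trans (column-ascend m (p.at m₀)) column≡k)))))

      -- The bound m < M makes the step one of the factors of `weight`. The equation for `p.step m`
      -- is recorded because `stepWeight` branches on that proof, not on the vertices.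
      HighEastStep : ℕ → Set
      HighEastStep L = ∃ λ m → m ℕ.< M × L ℕ.≤ level (p.at (suc m)) × ∃ λ e → p.step m ≡ inj₂ e

      -- Column k must still be reached, which takes an east step, and levels do not decrease
      -- upwards. The number d bounds the distance to M and serves as the induction variable.
      leaves : ∀ L d m → M ℕ.≤ d ℕ.+ m → column (p.at m) ≢ k → L ℕ.≤ level (p.at m) → HighEastStep L
      leaves L zero    m M≤m column≢k L≤ = contradiction (proj₂ p.column-limit m M≤m) column≢k
      leaves L (suc d) m M≤  column≢k L≤ with p.step m in eq
      ... | inj₁ south = leaves L d (suc m) (≡.subst (M ℕ.≤_) (≡.sym (ℕ.+-suc d m)) M≤)
        (λ column≡k → column≢k (≡.trans (≡.sym (≡.trans (≡.cong column south) (column-above (p.at m)))) column≡k))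
        (ℕ.≤-trans L≤ (ℕ.≤-trans (level-v _ _ (suc (index (p.at m)))) (ℕ.≤-reflexive (≡.sym (≡.cong level south)))))
      ... | inj₂ east = m , ℕ.≰⇒> (λ M≤m → column≢k (proj₂ p.column-limit m M≤m)) ,
        ℕ.≤-trans L≤ (ℕ.≤-reflexive (≡.cong level east)) , east , eq

      Follows : (s t j r m₀ : ℕ) → Set
      Follows s t j r m₀ = Σ (Walk k s t j r) λ ω → ∀ m → p.at (m ℕ.+ m₀) ≡ at ω m

      prepend : ∀ {s t j r s′ t′ j′ r′ m₀} (f : Walk k s t j r → Walk k s′ t′ j′ r′) →
                (∀ ω → p.at m₀ ≡ at (f ω) 0) → (∀ ω m → at (f ω) (suc m) ≡ at ω m) →
                Follows s t j r (suc m₀) → Follows s′ t′ j′ r′ m₀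
      prepend {m₀ = m₀} f f-0 f-suc (ω , ω≡) = f ω , λ
        { zero    → f-0 ω
        ; (suc m) → ≡.trans (≡.cong p.at (≡.sym (ℕ.+-suc m m₀))) (≡.trans (ω≡ m) (≡.sym (f-suc ω m)))
        }

      follow : ∀ s t j r m₀ → p.at m₀ ≡ V (r ℕ.+ j) t j → Follows s t j r m₀ ⊎ HighEastStep (suc (t ℕ.+ s))
      follow s t j (suc r) m₀ eq with p.step m₀
      ... | inj₁ south = Sum.map₁ (prepend up (λ _ → eq) (λ _ _ → ≡.refl))
        (follow s t (suc j) r (suc m₀) (≡.trans south (≡.trans (≡.cong above eq) (above-V t r j))))
      ... | inj₂ east′ = Sum.map₁ (prepend west (λ _ → eq) (λ _ _ → ≡.refl))
        (follow s t j r (suc m₀) (east-injective (≡.trans (≡.sym east′) (≡.trans eq (east-V t r j)))))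
      follow zero t j zero m₀ eq with j ℕ.≟ k | p.step m₀
      ... | yes ≡.refl | _          = inj₁ (top , λ m → ≡.trans (stays (≡.cong column eq) m) (≡.cong (ascend m) eq))
      ... | no  j≢k    | inj₂ east  = contradiction (≡.trans (≡.sym eq) east) (V-top≢east t j _)
      ... | no  j≢k    | inj₁ south = inj₂ (leaves _ M (suc m₀) (ℕ.m≤m+n M _)
        (λ column≡k → j≢k (≡.trans (≡.sym (ℕ.+-identityʳ j)) (≡.trans (≡.sym (≡.cong column eq′)) column≡k)))
        (ℕ.≤-reflexive (≡.trans (≡.cong suc (ℕ.+-identityʳ t)) (≡.sym (≡.cong level eq′)))))
        where
        eq′ : p.at (suc m₀) ≡ V (j ℕ.+ 0) (suc t) 0
        eq′ = ≡.trans south (≡.trans (≡.cong above eq) (above-top t j))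
      follow (suc s) t j zero m₀ eq with p.step m₀
      ... | inj₂ east  = contradiction (≡.trans (≡.sym eq) east) (V-top≢east t j _)
      ... | inj₁ south = Sum.map (prepend climb (λ _ → eq) (λ _ _ → ≡.refl))
        (≡.subst (λ L → HighEastStep (suc L)) (≡.sym (ℕ.+-suc t s)))
        (follow s (suc t) 0 j (suc m₀) (≡.trans south (≡.trans (≡.cong above eq) (above-top t j))))

      walk-or-high : ∀ s → (Σ (Walk k s 0 0 n) λ ω → ∀ m → p.at m ≡ at ω m) ⊎ HighEastStep (suc s)
      walk-or-high s = Sum.map₁
        (λ (ω , ω≡) → ω , λ m → ≡.trans (≡.cong p.at (≡.sym (ℕ.+-identityʳ m))) (ω≡ m))
        (follow s 0 0 n 0 (≡.trans p.end (≡.cong (λ i → V i 0 0) (≡.sym (ℕ.+-identityʳ n)))))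

-- Weighted sums over paths

module PathWeights (R : Ring₀) (w : Weights.WeightSystem R) where
  open CommutativeRing R hiding (zero)
  open Weights R
  open FiniteProducts R
  open LatticeWalks R
  open LectureHallPaths
  open KroneckerDelta R

  private
    product-unique : ∀ (f : ℕ → Carrier) (g : ℕ → Carrier) → g 0 ≡ 1# → (∀ m → g (suc m) ≡ g m * f m) → ∀ m → g m ≡ Π< m f
    product-unique f g g-0 g-suc zero    = g-0
    product-unique f g g-0 g-suc (suc m) = ≡.trans (g-suc m) (≡.cong (_* f m) (product-unique f g g-0 g-suc m))

    -- The recursion inside Defs.Weights.weight has no name; unification supplies it.
    mutual
      partial : ∀ {k n} → SE k n → ℕ → Carrier
      partial p = _

      weight≡ : ∀ {k n} (p : SE k n) → weight w p ≡ Π< (proj₁ (SE.column-limit p)) (λ m → stepWeight w (SE.step p m))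
      weight≡ p with proj₁ (SE.column-limit p)
      ... | M = product-unique _ (partial p) ≡.refl (λ _ → ≡.refl) M

  vertexWeight : Vertex → Carrier
  vertexWeight u = w (level u) (column u) (index u)

  wt : ℕ → ℕ → ℕ → Carrier
  wt t i j = vertexWeight (V i t j)

  Σ[_] : {I : Set} → List I → (I → Carrier) → Carrier
  Σ[ is ] f = foldr _+_ 0# (map f is)

  Σ-map : ∀ {I J : Set} (g : I → J) {f : J → Carrier} {f′ : I → Carrier} → (∀ i → f (g i) ≈ f′ i) →
          ∀ is → Σ[ map g is ] f ≈ Σ[ is ] f′
  Σ-map g f≈ []       = refl
  Σ-map g f≈ (i ∷ is) = +-cong (f≈ i) (Σ-map g f≈ is)

  Σ-++ : ∀ {I : Set} (f : I → Carrier) is js → Σ[ is ++ js ] f ≈ Σ[ is ] f + Σ[ js ] f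
  Σ-++ f []       js = sym (+-identityˡ _)
  Σ-++ f (i ∷ is) js = trans (+-congˡ (Σ-++ f is js)) (sym (+-assoc _ _ _))

  Σ-* : ∀ {I : Set} x (f : I → Carrier) is → Σ[ is ] (λ i → x * f i) ≈ x * Σ[ is ] f
  Σ-* x f []       = sym (zeroʳ x)
  Σ-* x f (i ∷ is) = trans (+-congˡ (Σ-* x f is)) (sym (distribˡ _ _ _))

  module _ {k : ℕ} where

    walkWeight : ∀ {s t j r} → Walk k s t j r → Carrier
    walkWeight ω = Π< (length ω) (λ m → stepWeight w (step ω m))

    walkWeight-climb : ∀ {s t j} (ω : Walk k s (suc t) 0 j) → walkWeight (climb ω) ≈ walkWeight ω
    walkWeight-climb ω = trans (Π<-head (length ω) (λ m → stepWeight w (step (climb ω) m))) (*-identityˡ _)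

    walkWeight-up : ∀ {s t j r} (ω : Walk k s t (suc j) r) → walkWeight (up ω) ≈ walkWeight ω
    walkWeight-up ω = trans (Π<-head (length ω) (λ m → stepWeight w (step (up ω) m))) (*-identityˡ _)

    walkWeight-west : ∀ {s t j r} (ω : Walk k s t j r) → walkWeight (west ω) ≈ wt t (r ℕ.+ j) j * walkWeight ω
    walkWeight-west ω = trans (Π<-head (length ω) (λ m → stepWeight w (step (west ω) m)))
      (*-congʳ (reflexive (≡.cong vertexWeight (at-0 ω))))

    Σ-walks : ∀ s t j r → Σ[ walks s t j r ] walkWeight ≈ Z wt s t j r (λ m → δ m k)
    Σ-walks s t j (suc r) = trans
      (Σ-++ walkWeight (map up (walks s t (suc j) r)) (map west (walks s t j r)))
      (+-cong (trans (Σ-map up walkWeight-up (walks s t (suc j) r)) (Σ-walks s t (suc j) r))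
              (trans (Σ-map west walkWeight-west (walks s t j r)) (trans (Σ-* (wt t (r ℕ.+ j) j) walkWeight (walks s t j r))
                (*-congˡ (Σ-walks s t j r)))))
    Σ-walks zero    t j zero with j ℕ.≟ k
    ... | yes ≡.refl = trans (+-identityʳ 1#) (sym (δ-diagonal k))
    ... | no  j≢k    = sym (δ-off-diagonal j k j≢k)
    Σ-walks (suc s) t j zero = trans (Σ-map climb walkWeight-climb (walks s (suc t) 0 j)) (Σ-walks s (suc t) 0 j)

  Π<-factor : ∀ f {m n} → m ℕ.< n → ∃ λ z → Π< n f ≈ f m * z
  Π<-factor f {m} {suc n} (s≤s m≤n) with ℕ.m≤n⇒m<n∨m≡n m≤n
  ... | inj₂ ≡.refl = _ , *-comm _ _
  ... | inj₁ m<n    with Π<-factor f m<n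
  ...   | z , eq = z * f n , trans (*-congʳ eq) (*-assoc _ _ _)

  module _ (K : Ring₀) where
    private module K = CommutativeRing K

    module _ (c : Carrier → K.Carrier)
             (c-cong : ∀ {x y} → x ≈ y → c x K.≈ c y) (c-+ : ∀ x y → c (x + y) K.≈ c x K.+ c y)
             (dˡ : Carrier) (c-dˡ : ∀ z → c (dˡ * z) K.≈ K.0#)
             (s : ℕ) (w-high : ∀ t i j → ∃ λ z → w (suc (s ℕ.+ t)) i j ≈ dˡ * z)
             (k n : ℕ) where

      -- The list holds the paths without east steps above level s, whose weights sum to the finite
      -- transfer sum `Z`. Any other path has an east step of weight divisible by `dˡ`, so c kills
      -- its weight.
      coefficients-sum : ∀ σ z → σ ≈ Z wt s 0 0 n (λ m → δ m k) + dˡ * z →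
        Σ (List (SE k n)) λ ps →
            UniqueSetoid.Unique (SE-setoid k n) ps
          × (∀ p → ¬ Membership._∈_ (SE-setoid k n) p ps → c (weight w p) K.≈ K.0#)
          × c σ K.≈ foldr K._+_ K.0# (map (λ p → c (weight w p)) ps)
      coefficients-sum σ z σ≈ = map toPath (walks s 0 0 n) ,
        UniqueSetoid.map⁺ (≡.setoid _) (SE-setoid k n) (λ {ω} {ω′} eq → at-injective ω ω′ eq) (walks-unique s 0 0 n) ,
        outside , c-σ
        where
        outside : ∀ p → ¬ Membership._∈_ (SE-setoid k n) p (map toPath (walks s 0 0 n)) → c (weight w p) K.≈ K.0#
        outside p p∉ with walk-or-high p s
        ... | inj₁ (ω , at≡) = contradiction (Any.map⁺ (Any.map
          (λ ω≡ω′ m → ≡.trans (at≡ m) (≡.cong (λ ω → at ω m) ω≡ω′)) (walks-complete ω))) p∉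
        ... | inj₂ (m , m<M , s<level , e , step≡) = K.trans (c-cong divisible) (c-dˡ _)
          where
          u : Vertex
          u = SE.at p (suc m)
          high : ∃ λ z → vertexWeight u ≈ dˡ * z
          high = ≡.subst (λ l → ∃ λ z → w l (column u) (index u) ≈ dˡ * z) (ℕ.m+[n∸m]≡n s<level)
            (w-high (level u ℕ.∸ suc s) (column u) (index u))
          rest : ∃ λ z → Π< (proj₁ (SE.column-limit p)) (λ m → stepWeight w (SE.step p m)) ≈ stepWeight w (SE.step p m) * z
          rest = Π<-factor (λ m → stepWeight w (SE.step p m)) m<M
          divisible : weight w p ≈ dˡ * (proj₁ high * proj₁ rest)
          divisible = trans (reflexive (weight≡ p)) (trans (proj₂ rest) (trans
            (*-congʳ (trans (reflexive (≡.cong (stepWeight w) step≡)) (proj₂ high))) (*-assoc _ _ _)))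

        c-Σ : ∀ (ωs : List (Walk k s 0 0 n)) →
              c (Σ[ ωs ] walkWeight) K.≈ foldr K._+_ K.0# (map (λ p → c (weight w p)) (map toPath ωs))
        -- c sends 0 to 0 because 0 is itself a multiple of `dˡ`.
        c-Σ []       = K.trans (c-cong (sym (zeroʳ dˡ))) (c-dˡ 0#)
        c-Σ (ω ∷ ωs) = K.trans (c-+ (walkWeight ω) (Σ[ ωs ] walkWeight)) (K.+-cong (c-cong (reflexive (≡.sym (weight≡ (toPath ω))))) (c-Σ ωs))

        c-σ : c σ K.≈ foldr K._+_ K.0# (map (λ p → c (weight w p)) (map toPath (walks s 0 0 n)))
        c-σ = K.trans (c-cong σ≈) (K.trans (c-+ _ _) (K.trans (K.+-congˡ (c-dˡ z)) (K.trans (K.+-identityʳ _)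
          (K.trans (c-cong (sym (Σ-walks s 0 0 n))) (c-Σ (walks s 0 0 n))))))

-- Mixed moments modulo powers of d

module LinearIndependence {R T : Ring₀} (f : R ⟶ T) where
  private
    module R = CommutativeRing R
  open CommutativeRing T hiding (zero)
  open FiniteSums T

  LinearlyIndependent : (ℕ → Carrier) → Set
  LinearlyIndependent F = ∀ N (C : ℕ → R.Carrier) → Σ< N (λ k → _⟶_.to f (C k) * F k) ≈ 0# → ∀ k → k ℕ.< N → C k R.≈ R.0#

-- MixedMoments.IsMixedMoments with a variable ring T, over which conversion checking
-- does not unfold equations into fractions of polynomials.
module MixedMomentsOver {R T : Ring₀} (f : R ⟶ T) (P : AskeyWilsonParameters R) (eⁱᶿ : Units.Unit T) where
  private
    module R = CommutativeRing R
    module T = CommutativeRing T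
    module AW = AskeyWilson (mapParameters f P) eⁱᶿ
  open SemiringExp T.semiring using () renaming (_^_ to _^ᵀ_)
  open SemiringSum T.semiring using (sum-syntax)

  IsMixedMoments : (ℕ → ℕ → R.Carrier) → Set
  IsMixedMoments σ = ∀ n → AW.x ^ᵀ n T.≈ ∑[ k < suc n ] (_⟶_.to f (σ n (toℕ k)) T.* AW.p (toℕ k))

module MixedMomentsModulo {R T : Ring₀} (f : R ⟶ T) (P : AskeyWilsonParameters R) (eⁱᶿ : Units.Unit T) where
  private
    module R = CommutativeRing R
    module f = _⟶_ f
    module RC = AskeyWilsonCoefficients P
    module RQ = QBinomialTransform R RC.q
  open CommutativeRing T hiding (zero)
  open SetoidReasoning setoid
  open SemiringExp semiring using (_^_)
  open SemiringExp R.semiring using () renaming (_^_ to _^ᴿ_)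
  open FiniteSums T
  open AskeyWilsonTerms (mapParameters f P) eⁱᶿ
  open AskeyWilsonExpansion {T} eⁱᶿ using (expansion)
  open QBinomialTransform T q
  open CommutativeRingSolver T
  open LatticeWalks R
  open LectureHallTransfer P using (Ψ; Z-Ψ; Z-Ψ≡Z-δ; α)
  open LinearIndependence f

  D-homo : ∀ v g n k → f.to (RQ.D v g n k) ≈ D (f.to ∘ v) (f.to ∘ g) n k
  D-homo v g zero    zero    = f.1#-homo
  D-homo v g zero    (suc k) = f.0#-homo
  D-homo v g (suc n) zero    = trans (f.*-homo _ _) (*-cong (f.*-homo _ _) (D-homo v g n 0))
  D-homo v g (suc n) (suc k) = trans (f.+-homo _ _) (+-cong (D-homo _ _ n k)
    (trans (f.*-homo _ _) (*-cong (trans (f.*-homo _ _) (*-congʳ (trans (f.*-homo _ _)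
      (*-congʳ (f.^-homo RC.q (suc k)))))) (D-homo v g n (suc k)))))

  γ-homo : ∀ i → f.to (RC.γ i) ≈ γ i
  γ-homo i = trans (f.*-homo _ _) (*-cong (trans (f.*-homo _ _) (*-cong (trans (f.*-homo _ _) (*-cong
      (trans (f.-‿homo _) (-‿cong (trans (f.*-homo _ _) (*-congʳ (trans (f.*-homo _ _) (*-congˡ (f.^-homo RC.q⁻¹ i)))))))
      (factor RC.b))) (factor RC.c))) (factor RC.d))
    where
    factor : ∀ z → f.to (R.1# R.- RC.a R.* z R.* RC.q ^ᴿ i) ≈ 1# - a * f.to z * q ^ i
    factor z = trans (f.1-homo (RC.a R.* z) RC.q i) (+-congˡ (-‿cong (*-congʳ (f.*-homo RC.a z))))

  node-homo : ∀ i → f.to (RC.node i) ≈ node i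
  node-homo i = trans (f.*-homo _ _) (*-congʳ (trans (f.+-homo _ _) (+-cong
    (trans (f.*-homo _ _) (*-congˡ (f.^-homo RC.q i))) (trans (f.*-homo _ _) (*-congˡ (f.^-homo RC.q⁻¹ i))))))

  module _ (w : ℕ → ℕ → ℕ → R.Carrier)
           (w₀ : ∀ r j → w 0 (r ℕ.+ j) j R.≈ RC.node j)
           (w₊ : ∀ t r j → w (suc t) (r ℕ.+ j) j R.≈ RC.q ^ᴿ j R.* α t (r ℕ.+ j)) where

    -- In the bottom level the weight xⱼ depends on j alone, so the recursion of `Z` becomes x ·
    -- xʳΦⱼ = xʳΦⱼ₊₁ + xⱼ xʳΦⱼ. At r = 0 all levels above contribute the expansion of Φⱼ.
    bottom-level : ∀ l N j r → r ℕ.+ j ℕ.< N →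
      Σ< N (λ k → f.to (Z w (l ℕ.* 8) 0 j r (Ψ l k)) * p k) ≈ x ^ r * Φ j
    bottom-level l N j zero    j<N = begin
      Σ< N (λ k → f.to (Z w (l ℕ.* 8) 0 j 0 (Ψ l k)) * p k)
        ≈⟨ Σ<-cong N (λ k → *-congʳ {p k} (trans (f.⟦⟧-cong (Z-Ψ w w₊ l k j))
             (trans (D-homo _ _ j k) (D-cong (λ _ → refl) γ-homo j k)))) ⟩
      Σ< N (λ k → D (u ⁺) γ j k * p k)
        ≈⟨ expansion (mapParameters f P) j N j<N ⟨
      Φ j
        ≈⟨ *-identityˡ (Φ j) ⟨
      1# * Φ j ∎
    bottom-level l N j (suc r) r+j<N = begin
      Σ< N (λ k → f.to (Z w (l ℕ.* 8) 0 j (suc r) (Ψ l k)) * p k)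
        ≈⟨ Σ<-cong N split ⟩
      Σ< N (λ k → f.to (Z w (l ℕ.* 8) 0 (suc j) r (Ψ l k)) * p k + node j * (f.to (Z w (l ℕ.* 8) 0 j r (Ψ l k)) * p k))
        ≈⟨ trans (Σ<-+ N (λ k → f.to (Z w (l ℕ.* 8) 0 (suc j) r (Ψ l k)) * p k) 
             (λ k → node j * (f.to (Z w (l ℕ.* 8) 0 j r (Ψ l k)) * p k))) (+-congˡ (Σ<-* N (node j) (λ k → f.to (Z w (l ℕ.* 8) 0 j r (Ψ l k)) * p k))) ⟩
      Σ< N (λ k → f.to (Z w (l ℕ.* 8) 0 (suc j) r (Ψ l k)) * p k)
        + node j * Σ< N (λ k → f.to (Z w (l ℕ.* 8) 0 j r (Ψ l k)) * p k)
        ≈⟨ +-cong (bottom-level l N (suc j) r (≡.subst (ℕ._< N) (≡.sym (ℕ.+-suc r j)) r+j<N))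
             (*-congˡ (bottom-level l N j r (ℕ.<-trans (ℕ.n<1+n _) r+j<N))) ⟩
      x ^ r * (Φ j * (x - node j)) + node j * (x ^ r * Φ j)
        ≈⟨ solve 4 (λ p F x m → p :* (F :* (x :- m)) :+ m :* (p :* F) := x :* p :* F) refl (x ^ r) (Φ j) x (node j) ⟩
      x ^ suc r * Φ j ∎
      where
      split : ∀ k → f.to (Z w (l ℕ.* 8) 0 j (suc r) (Ψ l k)) * p k
        ≈ f.to (Z w (l ℕ.* 8) 0 (suc j) r (Ψ l k)) * p k + node j * (f.to (Z w (l ℕ.* 8) 0 j r (Ψ l k)) * p k)
      split k = trans
        (*-congʳ (trans (f.+-homo _ _)
          (+-congˡ (trans (f.*-homo _ _) (*-congʳ (trans (f.⟦⟧-cong (w₀ r j)) (node-homo j)))))))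
        (solve 4 (λ x y z t → (x :+ y :* z) :* t := x :* t :+ y :* (z :* t)) refl _ (node j) _ (p k))

    -- The σ n k and the transfer sums with boundary data `Ψ l` both expand xⁿ in the pₖ, so they
    -- agree exactly; the multiple of dˡ arises only from replacing `Ψ l` by δ.
    mixed-moments : LinearlyIndependent p → (σ : ℕ → ℕ → R.Carrier) →
      MixedMomentsOver.IsMixedMoments f P eⁱᶿ σ →
      ∀ l n k → k ℕ.≤ n → ∃ λ z → σ n k R.≈ Z w (l ℕ.* 8) 0 0 n (λ m → KroneckerDelta.δ R m k) R.+ RC.d ^ᴿ l R.* z
    mixed-moments independent σ xⁿ≈ l n k k≤n = _ , R.trans (x∙y⁻¹≈ε⇒x≈y _ _ (independent (suc n)
        (λ k → σ n k R.- Z w (l ℕ.* 8) 0 0 n (Ψ l k)) difference k (ℕ.s≤s k≤n)))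
      (proj₂ (Z-Ψ≡Z-δ w w₊ l k n))
      where
      open RingProperties R.ring using (x∙y⁻¹≈ε⇒x≈y)
      s t : ℕ → Carrier
      s k = f.to (σ n k)
      t k = f.to (Z w (l ℕ.* 8) 0 0 n (Ψ l k))
      difference : Σ< (suc n) (λ k → f.to (σ n k R.- Z w (l ℕ.* 8) 0 0 n (Ψ l k)) * p k) ≈ 0#
      difference = begin
        Σ< (suc n) (λ k → f.to (σ n k R.- Z w (l ℕ.* 8) 0 0 n (Ψ l k)) * p k)
          ≈⟨ Σ<-cong (suc n) (λ k → trans (*-congʳ (trans (f.+-homo _ _) (+-congˡ (f.-‿homo _))))
               (solve 3 (λ s t p → (s :- t) :* p := s :* p :+ (:- :1) :* (t :* p)) refl (s k) (t k) (p k))) ⟩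
        Σ< (suc n) (λ k → s k * p k + - 1# * (t k * p k))
          ≈⟨ trans (Σ<-+ (suc n) (λ k → s k * p k) (λ k → - 1# * (t k * p k))) (+-congˡ (Σ<-* (suc n) (- 1#) (λ k → t k * p k))) ⟩
        Σ< (suc n) (λ k → s k * p k) + - 1# * Σ< (suc n) (λ k → t k * p k)
          ≈⟨ +-cong (sym (xⁿ≈ n)) (*-congˡ (bottom-level l (suc n) 0 n
               (ℕ.s≤s (ℕ.≤-reflexive (ℕ.+-identityʳ n))))) ⟩
        x ^ n + - 1# * (x ^ n * 1#)
          ≈⟨ solve 1 (λ y → y :+ (:- :1) :* (y :* :1) := con (0 , 0)) refl (x ^ n) ⟩
        0# ∎

-- Linear independence through leading coefficients in e^(iθ)

module LeadingCoefficients {R S T : Ring₀} (f : R ⟶ T) (eⁱᶿ : Units.Unit T)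
  (const : R ⟶ S) (embed : S ⟶ T) (head : S ⟶ R) (X : CommutativeRing.Carrier S)
  (f≈ : ∀ r → CommutativeRing._≈_ T (_⟶_.to f r) (_⟶_.to embed (_⟶_.to const r)))
  (eⁱᶿ≈ : CommutativeRing._≈_ T (proj₁ eⁱᶿ) (_⟶_.to embed X))
  (head-const : ∀ r → CommutativeRing._≈_ R (_⟶_.to head (_⟶_.to const r)) r)
  (head-X : CommutativeRing._≈_ R (_⟶_.to head X) (CommutativeRing.0# R))
  (embed-injective : ∀ g → CommutativeRing._≈_ T (_⟶_.to embed g) (CommutativeRing.0# T) →
                     CommutativeRing._≈_ S g (CommutativeRing.0# S))
  where
  private
    module R = CommutativeRing R
    module S = CommutativeRing S
    module const = _⟶_ const
    module embed = _⟶_ embed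
    module head = _⟶_ head
    module f = _⟶_ f
  open CommutativeRing T hiding (zero)
  open SetoidReasoning setoid
  open SemiringExp semiring using (_^_; ^-homo-*)
  open SemiringExp R.semiring using () renaming (_^_ to _^ᴿ_)
  open CommutativeRingSolver T
  open FiniteSums T
  open LinearIndependence f

  -- eⁱⁿᶿ y is a polynomial in eⁱᶿ with constant term r; as x is symmetric in e^{±iθ},
  -- for a polynomial y of degree n in x this r is 2⁻ⁿ times its top coefficient.
  record Leading (n : ℕ) (y : Carrier) (r : R.Carrier) : Set where
    constructor leading
    field
      numerator   : S.Carrier
      is-quotient : proj₁ eⁱᶿ ^ n * y ≈ embed.to numerator
      coefficient : head.to numerator R.≈ r

  Leading-resp : ∀ {n y z r s} → y ≈ z → r R.≈ s → Leading n y r → Leading n z s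
  Leading-resp y≈z r≈s (leading g eq c) = leading g (trans (*-congˡ (sym y≈z)) eq) (R.trans c r≈s)

  Leading-const : ∀ r → Leading 0 (f.to r) r
  Leading-const r = leading (const.to r) (trans (*-identityˡ _) (f≈ r)) (head-const r)

  Leading-+ : ∀ {n y z r s} → Leading n y r → Leading n z s → Leading n (y + z) (r R.+ s)
  Leading-+ (leading g eq c) (leading h eq′ c′) = leading (g S.+ h)
    (trans (distribˡ _ _ _) (trans (+-cong eq eq′) (sym (embed.+-homo g h))))
    (R.trans (head.+-homo g h) (R.+-cong c c′))

  Leading-* : ∀ {m n y z r s} → Leading m y r → Leading n z s → Leading (m ℕ.+ n) (y * z) (r R.* s)
  Leading-* {m} {n} {y} {z} (leading g eq c) (leading h eq′ c′) = leading (g S.* h)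
    (begin
      proj₁ eⁱᶿ ^ (m ℕ.+ n) * (y * z)               ≈⟨ *-congʳ (^-homo-* (proj₁ eⁱᶿ) m n) ⟩
      proj₁ eⁱᶿ ^ m * proj₁ eⁱᶿ ^ n * (y * z)      ≈⟨ solve 4 (λ a b y z → a :* b :* (y :* z) := a :* y :* (b :* z)) refl _ _ y z ⟩
      proj₁ eⁱᶿ ^ m * y * (proj₁ eⁱᶿ ^ n * z)      ≈⟨ *-cong eq eq′ ⟩
      embed.to g * embed.to h                        ≈⟨ embed.*-homo g h ⟨
      embed.to (g S.* h)                             ∎)
    (R.trans (head.*-homo g h) (R.*-cong c c′))

  -- One more factor e^(iθ) has constant term 0, which expresses that y has too small a degree to
  -- contribute at n + 1.
  Leading-suc : ∀ {n y r} → Leading n y r → Leading (suc n) y R.0#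
  Leading-suc (leading g eq c) = leading (X S.* g)
    (trans (*-assoc _ _ _) (trans (*-cong eⁱᶿ≈ eq) (sym (embed.*-homo X g))))
    (R.trans (head.*-homo X g) (R.trans (R.*-congʳ head-X) (R.zeroˡ _)))

  Leading-0 : ∀ {n y r} → Leading n y r → y ≈ 0# → r R.≈ R.0#
  Leading-0 (leading g eq c) y≈0 = R.trans (R.sym c) (R.trans (head.⟦⟧-cong
    (embed-injective g (trans (sym eq) (trans (*-congˡ y≈0) (zeroʳ _))))) head.0#-homo)

  Leading-eⁱᶿ+e⁻ⁱᶿ : Leading 1 (proj₁ eⁱᶿ + proj₁ (proj₂ eⁱᶿ) * 1#) R.1#
  Leading-eⁱᶿ+e⁻ⁱᶿ = leading (X S.* X S.+ S.1#)
    (begin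
      proj₁ eⁱᶿ * 1# * (proj₁ eⁱᶿ + proj₁ (proj₂ eⁱᶿ) * 1#)
        ≈⟨ solve 2 (λ x y → x :* :1 :* (x :+ y :* :1) := x :* x :+ x :* y) refl (proj₁ eⁱᶿ) (proj₁ (proj₂ eⁱᶿ)) ⟩
      proj₁ eⁱᶿ * proj₁ eⁱᶿ + proj₁ eⁱᶿ * proj₁ (proj₂ eⁱᶿ)
        ≈⟨ +-cong (trans (*-cong eⁱᶿ≈ eⁱᶿ≈) (sym (embed.*-homo X X))) (trans (proj₂ (proj₂ (proj₂ eⁱᶿ))) (sym embed.1#-homo)) ⟩
      embed.to (X S.* X) + embed.to S.1#
        ≈⟨ embed.+-homo _ _ ⟨
      embed.to (X S.* X S.+ S.1#) ∎)
    (R.trans (head.+-homo _ _) (R.trans (R.+-cong (R.trans (head.*-homo X X) (R.trans (R.*-congʳ head-X) (R.zeroˡ _)))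
      head.1#-homo) (R.+-identityˡ R.1#)))

  Leading-Σ< : ∀ n (F : ℕ → Carrier) {r : ℕ → R.Carrier} → (∀ k → k ℕ.< n → Leading k (F k) (r k)) →
               ∀ (C : ℕ → R.Carrier) → Leading n (Σ< n (λ k → f.to (C k) * F k)) R.0#
  Leading-Σ< zero    F lead C = Leading-resp f.0#-homo R.refl (Leading-const R.0#)
  Leading-Σ< (suc n) F lead C = Leading-resp (sym (Σ<-last n (λ k → f.to (C k) * F k))) (R.+-identityˡ R.0#)
    (Leading-+ (Leading-suc (Leading-Σ< n F (λ k k<n → lead k (ℕ.<-trans k<n (ℕ.n<1+n n))) C))
               (Leading-suc (Leading-* (Leading-const (C n)) (lead n (ℕ.n<1+n n)))))

  module _ (F Φ : ℕ → Carrier) (C : ℕ → ℕ → R.Carrier) (r : ℕ → R.Carrier) (r-unit : ∀ n → Units.IsUnit R (r n))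
           (Leading-Φ : ∀ n → Leading n (Φ n) (r n))
           (Φ≈ : ∀ n → Φ n ≈ Σ< n (λ k → f.to (C n k) * F k) + F n) where

    -- By triangularity `F n` differs from `Φ n` only by terms of lower index, which do not affect
    -- the leading coefficient.
    Leading-F< : ∀ n k → k ℕ.< n → Leading k (F k) (r k)
    Leading-F< (suc n) k (ℕ.s≤s k≤n) with ℕ.m≤n⇒m<n∨m≡n k≤n
    ... | inj₁ k<n    = Leading-F< n k k<n
    ... | inj₂ ≡.refl = Leading-resp F≈ (R.trans (R.+-congˡ (R.zeroʳ _)) (R.+-identityʳ _))
      (Leading-+ (Leading-Φ n) (Leading-* (Leading-const (R.- R.1#)) (Leading-Σ< n F (Leading-F< n) (C n))))
      where
      s : Carrier
      s = Σ< n (λ k → f.to (C n k) * F k)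
      F≈ : Φ n + f.to (R.- R.1#) * s ≈ F n
      F≈ = begin
        Φ n + f.to (R.- R.1#) * s       ≈⟨ +-cong (Φ≈ n) (*-congʳ (trans (f.-‿homo _) (-‿cong f.1#-homo))) ⟩
        (s + F n) + - 1# * s            ≈⟨ solve 2 (λ s y → (s :+ y) :+ (:- :1) :* s := y) refl s (F n) ⟩
        F n                             ∎

    -- The combination has leading coefficient `C N` times `r N`, which must vanish. As `r N` is a
    -- unit, `C N` is 0 and the last term drops out.
    independent : LinearlyIndependent F
    independent (suc N) C Σ≈0 = go
      where
      s : Carrier
      s = Σ< N (λ k → f.to (C k) * F k)
      last : Σ< (suc N) (λ k → f.to (C k) * F k) ≈ s + f.to (C N) * F N
      last = Σ<-last N (λ k → f.to (C k) * F k)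
      lead : Leading N (s + f.to (C N) * F N) (R.0# R.+ C N R.* r N)
      lead = Leading-+ (Leading-Σ< N F (Leading-F< N) C) (Leading-* (Leading-const (C N)) (Leading-F< (suc N) N (ℕ.n<1+n N)))
      C≈0 : C N R.≈ R.0#
      C≈0 = R.trans (R.sym (R.*-identityʳ _)) (R.trans (R.*-congˡ (R.sym (proj₂ (proj₂ (r-unit N)))))
        (R.trans (R.sym (R.*-assoc _ _ _)) (R.trans (R.*-congʳ
          (R.trans (R.sym (R.+-identityˡ _)) (Leading-0 lead (trans (sym last) Σ≈0)))) (R.zeroˡ _))))
      s≈0 : s ≈ 0#
      s≈0 = begin
        s                           ≈⟨ +-identityʳ s ⟨
        s + 0#                      ≈⟨ +-congˡ (trans (*-congʳ (trans (f.⟦⟧-cong C≈0) f.0#-homo)) (zeroˡ (F N))) ⟨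
        s + f.to (C N) * F N        ≈⟨ last ⟨
        Σ< (suc N) (λ k → f.to (C k) * F k) ≈⟨ Σ≈0 ⟩
        0#                          ∎
      go : ∀ k → k ℕ.< suc N → C k R.≈ R.0#
      go k (ℕ.s≤s k≤N) with ℕ.m≤n⇒m<n∨m≡n k≤N
      ... | inj₁ k<N    = independent N C s≈0 k k<N
      ... | inj₂ ≡.refl = C≈0

  module _ (P : AskeyWilsonParameters R) where
    private
      module RC = AskeyWilsonCoefficients P
      module RQ = QBinomialTransform R RC.q
    open AskeyWilsonTerms (mapParameters f P) eⁱᶿ
    open AskeyWilsonExpansion {T} eⁱᶿ using (expansion)
    open QBinomialTransform T q
    open MixedMomentsModulo f P eⁱᶿ using (node-homo; γ-homo; D-homo)

    Leading-x-node : ∀ j → Leading 1 (x - node j) RC.½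
    Leading-x-node j = Leading-resp
      (+-congˡ (trans (f.-‿homo _) (-‿cong (node-homo j)))) (R.trans (R.+-identityʳ _) (R.*-identityˡ RC.½))
      (Leading-+ (Leading-* Leading-eⁱᶿ+e⁻ⁱᶿ (Leading-const RC.½)) (Leading-suc (Leading-const (R.- RC.node j))))

    Leading-Φ : ∀ n → Leading n (Φ n) (RC.½ ^ᴿ n)
    Leading-Φ zero    = Leading-resp f.1#-homo R.refl (Leading-const R.1#)
    Leading-Φ (suc n) = Leading-resp (*-comm _ _) R.refl (Leading-* (Leading-x-node n) (Leading-Φ n))

    p-independent : LinearlyIndependent p
    p-independent = independent p Φ C (RC.½ ^ᴿ_)
      (Units.isUnit-^ R (Units.mkUnit R (proj₁ (proj₂ (AskeyWilsonParameters.isUnit-2 P))))) Leading-Φ Φ≈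
      where
      C : ℕ → ℕ → R.Carrier
      C n = RQ.D (RC.u ∘ suc) RC.γ n
      D≈C : ∀ n k → D (u ⁺) γ n k ≈ f.to (C n k)
      D≈C n k = sym (trans (D-homo _ _ n k) (D-cong (λ _ → refl) γ-homo n k))
      Φ≈ : ∀ n → Φ n ≈ Σ< n (λ k → f.to (C n k) * p k) + p n
      Φ≈ n = begin
        Φ n
          ≈⟨ expansion (mapParameters f P) n (suc n) (ℕ.n<1+n n) ⟩
        Σ< (suc n) (λ k → D (u ⁺) γ n k * p k)
          ≈⟨ Σ<-last n (λ k → D (u ⁺) γ n k * p k) ⟩
        Σ< n (λ k → D (u ⁺) γ n k * p k) + D (u ⁺) γ n n * p n
          ≈⟨ +-cong (Σ<-cong n (λ k → *-congʳ {p k} (D≈C n k))) (trans (*-congʳ {p n} (D-diagonal (u ⁺) γ n)) (*-identityˡ (p n))) ⟩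
        Σ< n (λ k → f.to (C n k) * p k) + p n ∎

    open LectureHallTransfer P using (α; α-high)

    -- c stands for the extraction of one coefficient.
    module PathExpansion (w : Weights.WeightSystem R)
      (bottom : LectureHallTransfer.BottomWeights P w) (upper : LectureHallTransfer.UpperWeights P w)
      (K : Ring₀) (c : R.Carrier → CommutativeRing.Carrier K)
      (c-cong : ∀ {x y} → x R.≈ y → CommutativeRing._≈_ K (c x) (c y))
      (c-+ : ∀ x y → CommutativeRing._≈_ K (c (x R.+ y)) (CommutativeRing._+_ K (c x) (c y)))
      (l : ℕ) (c-dˡ : ∀ z → CommutativeRing._≈_ K (c (RC.d ^ᴿ l R.* z)) (CommutativeRing.0# K))
      where
      private
        module K = CommutativeRing K
        open LectureHallPaths
        open PathWeights R w using (wt; coefficients-sum)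

        wt-bottom : ∀ r j → wt 0 (r ℕ.+ j) j R.≈ RC.node j
        wt-bottom r j = R.trans (bottom (r ℕ.+ j) (clamp (r ℕ.+ j) j)) (R.reflexive (≡.cong RC.node (toℕ-clamp r j)))

        wt-above : ∀ t r j → wt (suc t) (r ℕ.+ j) j R.≈ RC.q ^ᴿ j R.* α t (r ℕ.+ j)
        wt-above t r j = R.trans (upper t (r ℕ.+ j) (clamp (r ℕ.+ j) j))
          (R.*-congʳ (R.reflexive (≡.cong (RC.q ^ᴿ_) (toℕ-clamp r j))))

        w-high : ∀ t i j → ∃ λ z → w (suc (l ℕ.* 8 ℕ.+ t)) i j R.≈ RC.d ^ᴿ l R.* z
        w-high t i j = _ , R.trans (upper (l ℕ.* 8 ℕ.+ t) i j) (R.trans (R.*-congˡ (proj₂ (α-high l t i)))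
          (R.trans (R.sym (R.*-assoc _ _ _)) (R.trans (R.*-congʳ (R.*-comm _ _)) (R.*-assoc _ _ _))))

      path-expansion : ∀ σ → MixedMomentsOver.IsMixedMoments f P eⁱᶿ σ → ∀ n k → k ℕ.≤ n →
        Σ (List (SE k n)) λ ps →
            UniqueSetoid.Unique (SE-setoid k n) ps
          × (∀ p → ¬ Membership._∈_ (SE-setoid k n) p ps → c (Weights.weight R w p) K.≈ K.0#)
          × c (σ n k) K.≈ foldr K._+_ K.0# (map (λ p → c (Weights.weight R w p)) ps)
      path-expansion σ moments n k k≤n = coefficients-sum K c c-cong c-+ (RC.d ^ᴿ l) c-dˡ (l ℕ.* 8) w-high k n
        (σ n k) (proj₁ modulo) (proj₂ modulo)
        where
        modulo : ∃ λ z → σ n k R.≈ LatticeWalks.Z R wt (l ℕ.* 8) 0 0 n (λ m → KroneckerDelta.δ R m k) R.+ RC.d ^ᴿ l R.* z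
        modulo = MixedMomentsModulo.mixed-moments f P eⁱᶿ wt wt-bottom wt-above p-independent σ moments l n k k≤n

-- Coefficients of formal power series and the concrete rings

module _ (B : Ring₀) where
  open CommutativeRing B hiding (zero)
  open PowerSeries B
  private module S = CommutativeRing seriesRing
  open SemiringExp S.semiring using (_^_)

  X^-⊛-coefficient : ∀ n f {m} → m ℕ.< n → (X ^ n ⊛ f) m ≈ 0#
  X^-⊛-coefficient (suc n) f {m} (s≤s m≤n) = trans (at (S.*-assoc X (X ^ n) f) m) (lemma m m≤n)
    where
    lemma : ∀ m → m ≤ n → (X ⊛ (X ^ n ⊛ f)) m ≈ 0#
    lemma zero    _    = trans (+-identityʳ _) (zeroˡ _)
    lemma (suc m) m<n  = trans (X-⊛ (X ^ n ⊛ f) m) (X^-⊛-coefficient n f m<n)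

module LaurentEmbedding (R : Ring₀) where
  private
    module R = CommutativeRing R
    module S = Polynomials R
    module S′ = CommutativeRing S.polynomialRing
    module L = Localization S.polynomialRing (LaurentPolynomials.powersOfX R)
    module T = CommutativeRing (LaurentPolynomials.laurentRing R)

  polynomials : Ring₀
  polynomials = S.polynomialRing

  const : R ⟶ polynomials
  const = S.constHom

  embed : polynomials ⟶ LaurentPolynomials.laurentRing R
  embed = L.embedHom

  head : polynomials ⟶ R
  head = mkHom polynomials R (λ g → S.coeff g 0) (λ p → PowerSeries.at (S.coeff-≋ p) 0)
    (λ _ _ → R.refl) (λ _ _ → R.+-identityʳ _) (λ _ → R.refl) R.refl R.refl

  head-const : ∀ r → _⟶_.to head (_⟶_.to const r) R.≈ r
  head-const r = R.refl

  head-X : _⟶_.to head S.X R.≈ R.0#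
  head-X = R.refl

  embed-const : ∀ r → _⟶_.to (LaurentPolynomials.constHom R) r T.≈ _⟶_.to embed (_⟶_.to const r)
  embed-const r = T.refl

  embed-X : proj₁ (LaurentPolynomials.X R) T.≈ _⟶_.to embed S.X
  embed-X = T.refl

  embed-injective : ∀ g → _⟶_.to embed g T.≈ T.0# → g S′.≈ S′.0#
  embed-injective g g≈0 = S′.trans (S′.sym (S′.*-identityʳ g)) (S′.trans (L.cross g≈0) (S′.zeroˡ S′.1#))

module MixedMomentsAsPathSums (𝒦 : CoefficientRing) where
  private
    module R = CommutativeRing (MixedMoments.R 𝒦)
    module L = LaurentEmbedding (MixedMoments.R 𝒦)
    module RC = AskeyWilsonCoefficients {MixedMoments.R 𝒦} (MixedMoments.parameters 𝒦)
    open SemiringExp R.semiring using (_^_)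

  MomentsOver : (ℕ → ℕ → MixedMoments.FormalPowerSeries 𝒦) → Set
  MomentsOver σ = MixedMomentsOver.IsMixedMoments {MixedMoments.R 𝒦} {MixedMoments.T 𝒦}
    (MixedMoments.embedding 𝒦) (MixedMoments.parameters 𝒦) (LaurentPolynomials.X (MixedMoments.R 𝒦)) σ

  over : ∀ σ → MixedMoments.IsMixedMoments 𝒦 σ → MomentsOver σ
  over σ moments n = moments n

  ½≈ : proj₁ (proj₂ (MixedMoments.2ᵘ 𝒦)) R.≈ RC.½
  ½≈ = R.refl

  bottom : LectureHallTransfer.BottomWeights {MixedMoments.R 𝒦} (MixedMoments.parameters 𝒦) (MixedMoments.w 𝒦)
  bottom = LectureHallTransfer.bottom-formula {MixedMoments.R 𝒦} (MixedMoments.parameters 𝒦) (MixedMoments.2ᵘ 𝒦) ½≈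

  open CommutativeRing (MixedMoments.R 𝒦) using (_*_; -_; _≈_)
  open Units (MixedMoments.R 𝒦) using (_^ᶻ_; _÷_)
  open AskeyWilsonParameters (MixedMoments.parameters 𝒦) using (a; b; c; d; q; aᵘ; qᵘ)

  UpperFormula : Set
  UpperFormula = ∀ t i (j : Fin (suc i)) → (a * b * c * d * q ^ (2 ℕ.* i)) ^ (t / 8) * q ^ toℕ j * lookup
    ( - (aᵘ ^ᶻ -[1+ 0 ] * qᵘ ^ᶻ (ℤ.- + i))
    ∷ d
    ∷ c
    ∷ - (a * c * d * q ^ i)
    ∷ b
    ∷ - (a * b * d * q ^ i)
    ∷ - (a * b * c * q ^ i)
    ∷ a ^ 2 * b * c * d * q ^ (2 ℕ.* i)
    ∷ []) (t mod 8) ÷ MixedMoments.2ᵘ 𝒦 ≈ q ^ toℕ j * LectureHallTransfer.α {MixedMoments.R 𝒦} (MixedMoments.parameters 𝒦) t i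

  upper-formula : UpperFormula
  upper-formula = LectureHallTransfer.upper-formula {MixedMoments.R 𝒦} (MixedMoments.parameters 𝒦) (MixedMoments.2ᵘ 𝒦) ½≈
    (λ xs r → lookup {A = ℕ → CommutativeRing.Carrier (PowerSeries.seriesRing (PowerSeries.seriesRing (CoefficientRing.K 𝒦)))} xs r)
    (λ _ _ → ≡.refl)

  upper : LectureHallTransfer.UpperWeights {MixedMoments.R 𝒦} (MixedMoments.parameters 𝒦) (MixedMoments.w 𝒦)
  upper = upper-formula

  private
    module K = CommutativeRing (CoefficientRing.K 𝒦)
    module S₁ = PowerSeries (CoefficientRing.K 𝒦)
    module S₂ = PowerSeries S₁.seriesRing
    module S₃ = PowerSeries S₂.seriesRing

  coefficient-cong : ∀ i j l {f g : MixedMoments.FormalPowerSeries 𝒦} → f ≈ g → f l j i K.≈ g l j i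
  coefficient-cong i j l f≈g = S₁.at (S₂.at (S₃.at f≈g l) j) i

  -- d is the outermost variable, so its exponent is read off first, and one power more than l is
  -- what makes this coefficient vanish.
  coefficient-dˡ : ∀ i j l (f : MixedMoments.FormalPowerSeries 𝒦) → (RC.d ^ suc l * f) l j i K.≈ K.0#
  coefficient-dˡ i j l f = S₁.at (S₂.at (X^-⊛-coefficient S₂.seriesRing (suc l) f (ℕ.n<1+n l)) j) i

  -- For the monomial bⁱcʲdˡ everything is computed modulo dˡ⁺¹, hence with 8(l + 1) levels above
  -- the bottom one.
  has-sum : ∀ σ → MixedMoments.IsMixedMoments 𝒦 σ → ∀ n k → k ≤ n →
            MixedMoments.HasSum 𝒦 (SE-setoid k n) (Weights.weight (MixedMoments.R 𝒦) (MixedMoments.w 𝒦)) (σ n k)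
  has-sum σ moments n k k≤n (i , j , l) = LeadingCoefficients.PathExpansion.path-expansion
    {MixedMoments.R 𝒦} {L.polynomials} {MixedMoments.T 𝒦} (MixedMoments.embedding 𝒦) (LaurentPolynomials.X (MixedMoments.R 𝒦))
    L.const L.embed L.head (Polynomials.X (MixedMoments.R 𝒦)) L.embed-const L.embed-X L.head-const L.head-X L.embed-injective
    (MixedMoments.parameters 𝒦) (MixedMoments.w 𝒦) bottom upper (CoefficientRing.K 𝒦) (λ f → f l j i)
    (coefficient-cong i j l) (λ _ _ → K.refl) (suc l) (coefficient-dˡ i j l) σ (over σ moments) n k k≤n

open Defs using (FormalPowerSeries; IsMixedMoments; HasSum; weight; w)

theorem4p24 : (σ : ℕ → ℕ → FormalPowerSeries) → IsMixedMoments σ →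
    (n k : ℕ) → k ≤ n → HasSum (SE-setoid k n) (weight w) (σ n k)
theorem4p24 = MixedMomentsAsPathSums.has-sum ℚ⟨q⟩[a,a⁻¹]
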